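{- Suppose the universe size $U = \mathrm{poly}(n)$ is a sufficiently large polynomial in $n$. Consider a (deterministic) classical open-addressed hash table that stores $n$ keys in $N = (1+\Theta(\epsilon)) n$ slots (load factor $1-\epsilon$, with $1/n \le \epsilon \le \Theta(1)$), uses a nearly uniform probe-sequence function $h$, and, at any given moment of the workload below, has expected average probe complexity (over the currently stored keys) $O\big(2^{\sqrt{\log \epsilon^{ -1}}}\big)$. Then the expected amortized switching cost per insertion or deletion is $\Omega(\log \log \epsilon^{ -1})$.
   Context: The hash table has slots $[N]$, slot $N$ being a special slot: each inserted key is first placed into the special slot, and the algorithm then rearranges keys to move it to a normal slot. A probe-sequence function $h$ maps each key $x \in [U]$ to a sequence $(h_1(x), h_2(x), \ldots)$ with entries in $[N] \cup \{\mathrm{Null}\}$. A key $x$ stored in slot $s$ has probe complexity $\min\{k : h_k(x) = s\}$; a key in the special slot has probe complexity $N$. For $i \ge 1$ and $s \in [N]$ let $q(h,i,s) = n \Pr_{x \in [U]}[h_k(x) = s \text{ for some } k \le i]$ ($x$ uniform). $h$ is nearly uniform if there is an absolute constant $C$ with $q(h,i,s) \le C i^{10}$ for all $i, s$. The switching cost of an insertion or deletion is the number of keys moved between slots during it. The workload: initialize the table with $n$ uniformly random keys from $[U]$, then repeat $n^2$ times: delete a uniformly random element of the current key set $S$, then insert a uniformly random element of $[U]\setminus S$. -}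

module Defs where

open import Data.Nat using (ℕ; zero; suc; _+_; _*_; _∸_; _^_; _≤_; _/_; _≤ᵇ_)
open import Data.Nat.Logarithm using (⌊log₂_⌋)
open import Data.Fin using (Fin; _≟_)
open import Data.Bool using (Bool; true; false; if_then_else_; not)
open import Data.Maybe using (Maybe; just; nothing; maybe′)
open import Data.Product using (_×_; _,_; proj₁; proj₂)
open import Data.List using (List; []; _∷_; map; foldl; length; allFin; upTo; concatMap; filterᵇ; take; replicate; concat; _++_)
open import Relation.Nullary.Decidable using (⌊_⌋)
open import Data.Nat.ListAction using (sum)
open import Data.Bool.ListAction using (any)
open import Relation.Binary.PropositionalEquality using (_≡_)

isqrtGo : ℕ → ℕ → ℕ
isqrtGo m zero    = zero
isqrtGo m (suc r) = if (suc r * suc r) ≤ᵇ m then suc r else isqrtGo m r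

isqrt : ℕ → ℕ
isqrt m = isqrtGo m m

-- ε = a / b ;  recipFloor a b = ⌊ 1/ε ⌋ = ⌊ b / a ⌋   (0 if a = 0)
recipFloor : ℕ → ℕ → ℕ
recipFloor zero    b = 0
recipFloor (suc a) b = b / suc a

probeBudget : ℕ → ℕ → ℕ
probeBudget a b = 2 ^ isqrt ⌊log₂ recipFloor a b ⌋

loglogInv : ℕ → ℕ → ℕ
loglogInv a b = ⌊log₂ ⌊log₂ recipFloor a b ⌋ ⌋

data Slot (N : ℕ) : Set where
  normal  : Fin N → Slot N
  special : Slot N

allSlots : (N : ℕ) → List (Slot N)
allSlots N = special ∷ map normal (allFin N)

sameSlot : {N : ℕ} → Slot N → Slot N → Bool
sameSlot (normal s) (normal t) = ⌊ s ≟ t ⌋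
sameSlot special    special    = true
sameSlot (normal _) special    = false
sameSlot special    (normal _) = false

Table : ℕ → ℕ → Set
Table U N = Slot N → Maybe (Fin U)

emptyTable : {U N : ℕ} → Table U N
emptyTable _ = nothing

setSlot : {U N : ℕ} → Table U N → Slot N → Maybe (Fin U) → Table U N
setSlot T s v t = if sameSlot s t then v else T t

-- moving the key in slot 'from' to the empty slot 'to'
Move : ℕ → Set
Move N = Slot N × Slot N

-- an ill-formed move (source empty or target occupied) does nothing
-- (but is still charged as a move)
applyMove : {U N : ℕ} → Table U N → Move N → Table U N
applyMove T (a , b) = go (T a) (T b)
  where
  go : Maybe _ → Maybe _ → Table _ _
  go (just x) nothing = setSlot (setSlot T a nothing) b (just x)
  go _        _       = T

dropKey : {U : ℕ} → Fin U → Maybe (Fin U) → Maybe (Fin U)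
dropKey x nothing  = nothing
dropKey x (just y) = if ⌊ y ≟ x ⌋ then nothing else just y

removeKey : {U N : ℕ} → Table U N → Fin U → Table U N
removeKey T x t = dropKey x (T t)

-- h x k = h_k(x) (index 0 is unused); nothing = Null
ProbeSeq : ℕ → ℕ → Set
ProbeSeq U N = Fin U → ℕ → Maybe (Fin N)

hitB : {N : ℕ} → Maybe (Fin N) → Fin N → Bool
hitB nothing  s = false
hitB (just t) s = ⌊ t ≟ s ⌋

searchHit : {U N : ℕ} → ProbeSeq U N → Fin U → Fin N → (cap fuel k : ℕ) → ℕ
searchHit h x s cap zero     k = cap
searchHit h x s cap (suc f)  k = if hitB (h x k) s then k else searchHit h x s cap f (suc k)

-- min( min{k ≥ 1 : h_k(x) = s} , K )  (truncated probe complexity; the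
-- untruncated one may be infinite)
truncPC : {U N : ℕ} → ProbeSeq U N → ℕ → Fin U → Fin N → ℕ
truncPC h K x s = searchHit h x s K K 1

slotPC : {U N : ℕ} → ProbeSeq U N → ℕ → Slot N → Fin U → ℕ
slotPC h K (normal s) x = truncPC h K x s
slotPC {N = N} h K special x = N

pcSum : {U N : ℕ} → ProbeSeq U N → ℕ → Table U N → ℕ
pcSum {N = N} h K T = sum (map (λ t → maybe′ (slotPC h K t) 0 (T t)) (allSlots N))

countB : {U : ℕ} → (Fin U → Bool) → ℕ
countB {U} p = sum (map (λ x → if p x then 1 else 0) (allFin U))

hitsWithin : {U N : ℕ} → ProbeSeq U N → ℕ → Fin N → Fin U → Bool
hitsWithin h i s x = any (λ k → hitB (h x k) s) (map suc (upTo i))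

-- q(h,i,s) = n · Pr_x[…] = n · count / U ≤ C i^10, cleared of denominators
NearlyUniformWith : {U N : ℕ} → (n C : ℕ) → ProbeSeq U N → Set
NearlyUniformWith {U} n C h = ∀ i s → n * countB (hitsWithin h i s) ≤ C * i ^ 10 * U

-- Deterministic classical open-addressed hash table algorithms.
-- The algorithm may keep arbitrary internal memory (it is any deterministic
-- procedure).  On insertion of y, y has already been put in the special slot
-- and the algorithm returns its new memory and the list of moves it performs;
-- on deletion of x, x has already been removed from its slot.

record Algorithm (U N : ℕ) : Set₁ where
  field
    Mem      : Set
    mem₀     : Mem
    onInsert : Mem → Table U N → Fin U → Mem × List (Move N)
    onDelete : Mem → Table U N → Fin U → Mem × List (Move N)

open Algorithm public

record Config {U N : ℕ} (A : Algorithm U N) : Set where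
  field
    mem  : Mem A
    tab  : Table U N
    keys : List (Fin U)
    cost : ℕ

open Config public

data Kind : Set where
  ins del : Kind

record Op : Set where
  constructor op
  field
    kind    : Kind
    counted : Bool

memberB : {U : ℕ} → Fin U → List (Fin U) → Bool
memberB y S = any (λ z → ⌊ z ≟ y ⌋) S

charge : Bool → ℕ → ℕ
charge true  m = m
charge false m = 0

module _ {U N : ℕ} (A : Algorithm U N) where

  config₀ : Config A
  config₀ = record { mem = mem₀ A ; tab = emptyTable ; keys = [] ; cost = 0 }

  insertStep : Bool → Config A → Fin U → Config A
  insertStep b c y =
    let T1 = setSlot (tab c) special (just y)
        r  = onInsert A (mem c) T1 y
    in record { mem = proj₁ r ; tab = foldl applyMove T1 (proj₂ r)
              ; keys = y ∷ keys c ; cost = cost c + charge b (length (proj₂ r)) }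

  deleteStep : Bool → Config A → Fin U → Config A
  deleteStep b c x =
    let T1 = removeKey (tab c) x
        r  = onDelete A (mem c) T1 x
    in record { mem = proj₁ r ; tab = foldl applyMove T1 (proj₂ r)
              ; keys = filterᵇ (λ z → not ⌊ z ≟ x ⌋) (keys c)
              ; cost = cost c + charge b (length (proj₂ r)) }

  -- all equally likely outcomes of one random operation:
  -- insert a uniformly random element of [U] \ S, or delete a uniformly random element of S
  branches : Config A → Op → List (Config A)
  branches c (op ins b) = concatMap (λ y → if memberB y (keys c) then [] else insertStep b c y ∷ []) (allFin U)
  branches c (op del b) = map (deleteStep b c) (keys c)

  sumAfter : List Op → (Config A → ℕ) → Config A → ℕ
  sumAfter []        f c = f c
  sumAfter (o ∷ os)  f c = sum (map (sumAfter os f) (branches c o))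

  schedule : ℕ → List Op
  schedule n = replicate n (op ins false) ++ concat (replicate (n * n) (op del true ∷ op ins true ∷ []))

  -- sum of f over all equally likely executions of the first m operations
  -- (so  E[f after m operations] = sumAt n m f / sumAt n m (λ _ → 1))
  sumAt : ℕ → ℕ → (Config A → ℕ) → ℕ
  sumAt n m f = sumAfter (take m (schedule n)) f config₀

  specialOccupied : Config A → ℕ
  specialOccupied c = maybe′ (λ _ → 1) 0 (tab c special)

  -- the algorithm always moves the inserted key out of the special slot
  -- (at every moment of the workload, with probability 1)
  ValidOn : ℕ → Set
  ValidOn n = ∀ m → m ≤ n + 2 * (n * n) → sumAt n m specialOccupied ≡ 0

  -- at every moment of the workload (after initialization and after every
  -- subsequent operation), E[average probe complexity of stored keys] ≤ B.
  -- Since |S| is deterministic at each moment, E[Σ pc / |S|] ≤ B ⇔ E[Σ pc] ≤ B·E[|S|];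
  -- quantifying over all truncations K expresses the (possibly infinite) untruncated value.
  ProbeBoundedOn : ProbeSeq U N → ℕ → ℕ → Set
  ProbeBoundedOn h n B = ∀ K j → j ≤ 2 * (n * n) →
    sumAt n (n + j) (λ c → pcSum h K (tab c)) ≤ B * sumAt n (n + j) (λ c → length (keys c))

  totalRuns : ℕ → ℕ
  totalRuns n = sumAt n (n + 2 * (n * n)) (λ _ → 1)

  totalCost : ℕ → ℕ
  totalCost n = sumAt n (n + 2 * (n * n)) cost

{-# OPTIONS --safe #-}

-- For a scale D = 2^i, let Φ_D be the least cost of an assignment of the stored keys to slots, where a key pays
-- nothing for keeping its present slot (if its probe complexity is at most about 2^(32D)), min(D, log p) for a slot of
-- probe complexity p, and D for being left out. A move to probe complexity p lowers Φ_D by at most log p, and by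
-- nothing if p > 2^(32D); hence one move lowers the sum of the Φ_D/D over all dyadic scales by O(1) only.
-- Inserting a random key raises Φ_D by D unless the key has a cheap probe into the few slots from which a cheap chain of
-- moves leads to a free slot or to a key of huge probe complexity. Deleting a random key does not lower Φ_D unless a
-- cheap chain leads from a key of huge probe complexity to its slot. Both exceptions are rare for
-- √(log 1/ε) ≪ D ≪ log 1/ε: the probe bound makes keys of huge probe complexity rare, and the exponential moment of the
-- number of keys probing a slot stays bounded along the workload, so cheap chains reach few slots. There are
-- Ω(log log 1/ε) such dyadic scales, and the Φ_D stay bounded by D n, so the moves must pay D per insertion at every scale.

module Submission where

open import Defs
open import Data.Bool using (Bool; true; false; if_then_else_; not; _∧_; _∨_)
open import Data.Bool.ListAction using (any)
open import Data.Bool.Properties using (T?; T-≡; ∨-zeroʳ)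
open import Data.Empty using (⊥-elim)
import Data.Fin as Fin
open import Data.Fin using (Fin)
import Data.Fin.Properties as Fin
open import Data.List using (List; []; _∷_; map; length; allFin; upTo; concatMap; _++_; filterᵇ; foldl; filter; [_]; concat; replicate; take; drop)
open import Data.List.Extrema.Nat using (argmin; f[argmin]≤f[xs]; argmin-all)
open import Data.List.Membership.DecPropositional using (_∈?_)
open import Data.List.Membership.Propositional using (_∈_; _∉_; lose; find)
open import Data.List.Membership.Propositional.Properties using (∈-allFin; ∈-map⁺; ∈-filter⁺; ∈-filter⁻; ∈-concatMap⁺; ∈-map⁻; ∈-upTo⁺; ∈-upTo⁻; ∈-concatMap⁻)
open import Data.List.Properties using (map-++; length-tabulate; length-map; length-upTo; foldl-∷ʳ)
import Data.List.Relation.Unary.All as All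
import Data.List.Relation.Unary.All.Properties as All
open import Data.List.Relation.Unary.AllPairs using ([]; _∷_)
open import Data.List.Relation.Unary.Any using (here; there)
open import Data.List.Relation.Unary.Unique.Propositional using (Unique)
open import Data.List.Relation.Unary.Unique.Propositional.Properties using (allFin⁺; map⁺; filter⁺)
open import Data.Maybe using (Maybe; just; nothing; maybe′)
import Data.Maybe.Properties as Maybe
open import Data.Maybe.Properties using (just-injective)
open import Data.Nat using (ℕ; zero; suc; _+_; _*_; _∸_; _^_; _≤_; _<_; z≤n; s≤s; _≤ᵇ_; _⊓_; _≤?_; _<?_; >-nonZero; ⌊_/2⌋; ⌈_/2⌉; _/_)
open import Data.Nat.DivMod using (m/n*n≤m; /-monoˡ-≤; m*n/n≡m)
open import Data.Nat.Induction using (<-rec)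
open import Data.Nat.ListAction using (sum)
open import Data.Nat.ListAction.Properties using (sum-++)
open import Data.Nat.Logarithm using (⌊log₂_⌋; ⌊log₂⌋-mono-≤; ⌊log₂⌊n/2⌋⌋≡⌊log₂n⌋∸1; ⌊log₂[2^n]⌋≡n)
open import Data.Nat.Properties
open import Data.Nat.Tactic.RingSolver using (solve-∀)
open import Data.Product using (_×_; _,_; proj₁; proj₂; ∃; ∃-syntax)
open import Data.Sum using (_⊎_; inj₁; inj₂)
open import Data.Vec using (Vec; lookup; _[_]≔_) renaming ([] to []ᵥ; _∷_ to _∷ᵥ_; replicate to replicateᵥ)
open import Data.Vec.Properties using (lookup∘update; lookup∘update′; lookup-replicate)
open import Function using (_∘_; Equivalence)
open import Relation.Binary.PropositionalEquality using (_≡_; _≢_; refl; sym; trans; cong; cong₂; subst; module ≡-Reasoning)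
open import Relation.Nullary using (yes; no; Dec)
open import Relation.Nullary.Decidable using (⌊_⌋; _→-dec_; map′)

-- The obstacle is that near uniformity speaks of a random key of the universe, while chains run
-- through stored keys, which the algorithm places adaptively. Two bounds replace it. A chain
-- followed forwards from an expensive key branches at most 2^ℓ ways, since a key has only 2^ℓ early
-- probes. A chain followed backwards branches by the number of stored keys that probe a slot; this
-- depends on the key set and not on the layout, so its exponential moment can be followed along the
-- workload without knowing the algorithm. The surplus of crowded slots is added to the number of
-- starting slots. The constants: chains of weight D multiply the number of slots by 2^(12D), where
-- 12 leaves room above the exponent 10 of near uniformity; a random key hits a given slot early
-- with probability about 2^(10D)/n; a further 2^D absorbs constants. Hence starting slots of
-- density 2^(-30D) are rare enough. The cutoff 32D provides this density for expensive keys, and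
-- 64D ≤ log 1/ε provides it for free slots. Expectations appear as sums over the list of all
-- equally likely runs, cleared of denominators.

private variable
  X Y : Set

-- Finite sums and Boolean indicators.

false≢true : false ≢ true
false≢true ()

∑ : (X → ℕ) → List X → ℕ
∑ f xs = sum (map f xs)

χ : Bool → ℕ
χ b = if b then 1 else 0

∑-mono : {f g : X → ℕ} (xs : List X) → (∀ {x} → x ∈ xs → f x ≤ g x) → ∑ f xs ≤ ∑ g xs
∑-mono []       p = z≤n
∑-mono (x ∷ xs) p = +-mono-≤ (p (here refl)) (∑-mono xs (p ∘ there))

∑-cong : {f g : X → ℕ} (xs : List X) → (∀ {x} → x ∈ xs → f x ≡ g x) → ∑ f xs ≡ ∑ g xs
∑-cong []       p = refl
∑-cong (x ∷ xs) p = cong₂ _+_ (p (here refl)) (∑-cong xs (p ∘ there))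

∑-+ : (f g : X → ℕ) (xs : List X) → ∑ (λ x → f x + g x) xs ≡ ∑ f xs + ∑ g xs
∑-+ f g []       = refl
∑-+ f g (x ∷ xs) = trans (cong (f x + g x +_) (∑-+ f g xs)) (lem (f x) (g x) (∑ f xs) (∑ g xs))
  where
  lem : ∀ a b c d → a + b + (c + d) ≡ a + c + (b + d)
  lem = solve-∀

∑-* : (k : ℕ) (f : X → ℕ) (xs : List X) → ∑ (λ x → k * f x) xs ≡ k * ∑ f xs
∑-* k f []       = sym (*-zeroʳ k)
∑-* k f (x ∷ xs) = trans (cong (k * f x +_) (∑-* k f xs)) (sym (*-distribˡ-+ k (f x) (∑ f xs)))

∑-const : (k : ℕ) (xs : List X) → ∑ (λ _ → k) xs ≡ length xs * k
∑-const k []       = refl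
∑-const k (x ∷ xs) = cong (k +_) (∑-const k xs)

∑-one : (xs : List X) → ∑ (λ _ → 1) xs ≡ length xs
∑-one xs = trans (∑-const 1 xs) (*-identityʳ _)

∑-zero : (xs : List X) → ∑ (λ _ → 0) xs ≡ 0
∑-zero xs = trans (∑-const 0 xs) (*-zeroʳ (length xs))

∑-swap : (f : X → Y → ℕ) (xs : List X) (ys : List Y) →
         ∑ (λ x → ∑ (f x) ys) xs ≡ ∑ (λ y → ∑ (λ x → f x y) xs) ys
∑-swap f []       ys = sym (∑-zero ys)
∑-swap f (x ∷ xs) ys = trans (cong (∑ (f x) ys +_) (∑-swap f xs ys))
                             (sym (∑-+ (f x) (λ y → ∑ (λ x → f x y) xs) ys))

∑-++ : (f : X → ℕ) (xs ys : List X) → ∑ f (xs ++ ys) ≡ ∑ f xs + ∑ f ys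
∑-++ f xs ys = trans (cong sum (map-++ f xs ys)) (sum-++ (map f xs) (map f ys))

∑-concatMap : (f : Y → ℕ) (g : X → List Y) (xs : List X) →
              ∑ f (concatMap g xs) ≡ ∑ (λ x → ∑ f (g x)) xs
∑-concatMap f g []       = refl
∑-concatMap f g (x ∷ xs) = trans (∑-++ f (g x) (concatMap g xs)) (cong (∑ f (g x) +_) (∑-concatMap f g xs))

∑-map : (f : Y → ℕ) (g : X → Y) (xs : List X) → ∑ f (map g xs) ≡ ∑ (f ∘ g) xs
∑-map f g []       = refl
∑-map f g (x ∷ xs) = cong (f (g x) +_) (∑-map f g xs)

∑-∈ : (f : X → ℕ) {x : X} {xs : List X} → x ∈ xs → f x ≤ ∑ f xs
∑-∈ f (here refl) = m≤m+n _ _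
∑-∈ f (there p)   = ≤-trans (∑-∈ f p) (m≤n+m _ _)

∑-∈₂ : (f : X → ℕ) {x y : X} {xs : List X} → x ∈ xs → y ∈ xs → x ≢ y → f x + f y ≤ ∑ f xs
∑-∈₂ f (here refl) (here refl) x≢y = ⊥-elim (x≢y refl)
∑-∈₂ f (here refl) (there q)   x≢y = +-monoʳ-≤ _ (∑-∈ f q)
∑-∈₂ f {x} {y} (there p) (here refl) x≢y =
  ≤-trans (≤-reflexive (+-comm (f x) (f y))) (+-monoʳ-≤ (f y) (∑-∈ f p))
∑-∈₂ f (there p)   (there q)   x≢y = ≤-trans (∑-∈₂ f p q x≢y) (m≤n+m _ _)

∑-positive : (f : X → ℕ) (xs : List X) → 1 ≤ ∑ f xs → ∃ λ x → x ∈ xs × 1 ≤ f x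
∑-positive f (x ∷ xs) p with f x in eq
... | suc _ = x , here refl , subst (1 ≤_) (sym eq) (s≤s z≤n)
... | zero with ∑-positive f xs p
...   | y , y∈ , q = y , there y∈ , q

-- Each side adds the value that the other sum contains, so a change at one point can be used
-- without subtraction.
∑-update : {f g : X → ℕ} {x : X} {xs : List X} → Unique xs → x ∈ xs →
           (∀ y → y ≢ x → f y ≡ g y) → ∑ f xs + g x ≡ ∑ g xs + f x
∑-update {f = f} {g} {x} {_ ∷ xs} (x∉ ∷ u) (here refl) e = begin
  f x + ∑ f xs + g x ≡⟨ cong (λ z → f x + z + g x) (∑-cong xs λ y∈ → e _ λ { refl → All.lookup x∉ y∈ refl }) ⟩
  f x + ∑ g xs + g x ≡⟨ lem (f x) (∑ g xs) (g x) ⟩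
  g x + ∑ g xs + f x ∎
  where
  open ≡-Reasoning
  lem : ∀ a b c → a + b + c ≡ c + b + a
  lem = solve-∀
∑-update {f = f} {g} {x} {y ∷ xs} (y∉ ∷ u) (there p) e = begin
  f y + ∑ f xs + g x  ≡⟨ +-assoc (f y) _ _ ⟩
  f y + (∑ f xs + g x) ≡⟨ cong₂ _+_ (e y (All.lookup y∉ p)) (∑-update u p e) ⟩
  g y + (∑ g xs + f x) ≡⟨ +-assoc (g y) _ _ ⟨
  g y + ∑ g xs + f x  ∎
  where open ≡-Reasoning

any-intro : (p : X → Bool) {x : X} {xs : List X} → x ∈ xs → p x ≡ true → any p xs ≡ true
any-intro p {xs = x ∷ xs} (here refl) e rewrite e = refl
any-intro p {xs = y ∷ xs} (there q) e with p y
... | true  = refl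
... | false = any-intro p q e

any-elim : (p : X → Bool) (xs : List X) → any p xs ≡ true → ∃ λ x → x ∈ xs × p x ≡ true
any-elim p (x ∷ xs) e with p x in eq
... | true = x , here refl , eq
... | false with any-elim p xs e
...   | y , y∈ , q = y , there y∈ , q

χ-any : (p : X → Bool) (xs : List X) → χ (any p xs) ≤ ∑ (χ ∘ p) xs
χ-any p []       = z≤n
χ-any p (x ∷ xs) with p x
... | true  = s≤s z≤n
... | false = χ-any p xs

χ-true : ∀ {b} → 1 ≤ χ b → b ≡ true
χ-true {true} _ = refl

χ-∧ : ∀ a b → χ (a ∧ b) ≡ χ a * χ b
χ-∧ true  b = sym (+-identityʳ (χ b))
χ-∧ false b = refl

χ-∨ : ∀ a b → χ (a ∨ b) ≤ χ a + χ b
χ-∨ true  b = s≤s z≤n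
χ-∨ false b = ≤-refl

χ-not : ∀ b → χ b + χ (not b) ≡ 1
χ-not true  = refl
χ-not false = refl

≟-true : ∀ {n} {i j : Fin n} → ⌊ i Fin.≟ j ⌋ ≡ true → i ≡ j
≟-true {i = i} {j} e with i Fin.≟ j
... | yes p = p

≟-refl : ∀ {n} (i : Fin n) → ⌊ i Fin.≟ i ⌋ ≡ true
≟-refl i with i Fin.≟ i
... | yes _ = refl
... | no ¬p = ⊥-elim (¬p refl)

≟-false : ∀ {n} {i j : Fin n} → i ≢ j → ⌊ i Fin.≟ j ⌋ ≡ false
≟-false {i = i} {j} i≢j with i Fin.≟ j
... | yes p = ⊥-elim (i≢j p)
... | no _ = refl

∑-≟ : ∀ {n} {i : Fin n} {xs : List (Fin n)} → Unique xs → i ∈ xs → ∑ (λ j → χ ⌊ j Fin.≟ i ⌋) xs ≡ 1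
∑-≟ {i = i} {xs} u i∈ = begin
  ∑ (λ j → χ ⌊ j Fin.≟ i ⌋) xs  ≡⟨ +-identityʳ _ ⟨
  ∑ (λ j → χ ⌊ j Fin.≟ i ⌋) xs + 0  ≡⟨ ∑-update {g = λ _ → 0} u i∈ (λ y ne → cong χ (≟-false ne)) ⟩
  ∑ (λ _ → 0) xs + χ ⌊ i Fin.≟ i ⌋  ≡⟨ cong₂ _+_ (∑-zero xs) (cong χ (≟-refl i)) ⟩
  1  ∎
  where open ≡-Reasoning

length-allFin : ∀ n → length (allFin n) ≡ n
length-allFin n = length-tabulate (λ i → i)

≟-sym : ∀ {n} (i j : Fin n) → ⌊ i Fin.≟ j ⌋ ≡ ⌊ j Fin.≟ i ⌋
≟-sym i j with i Fin.≟ j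
... | yes refl = sym (≟-refl i)
... | no  i≢j  = sym (≟-false (i≢j ∘ sym))

∑-≟ʳ : ∀ {n} (i : Fin n) → ∑ (λ j → χ ⌊ i Fin.≟ j ⌋) (allFin n) ≡ 1
∑-≟ʳ {n} i = trans (∑-cong (allFin n) (λ {j} _ → cong χ (≟-sym i j))) (∑-≟ (allFin⁺ n) (∈-allFin i))

-- Tables and the key sets that they store.

normal-injective : ∀ {N} {s t : Fin N} → normal s ≡ normal t → s ≡ t
normal-injective refl = refl

slot-≟ : ∀ {N} (s t : Slot N) → Dec (s ≡ t)
slot-≟ (normal s) (normal t) with s Fin.≟ t
... | yes refl = yes refl
... | no s≢t   = no (s≢t ∘ normal-injective)
slot-≟ (normal s) special    = no λ ()
slot-≟ special    (normal t) = no λ ()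
slot-≟ special    special    = yes refl

sameSlot-refl : ∀ {N} (s : Slot N) → sameSlot s s ≡ true
sameSlot-refl (normal s) = ≟-refl s
sameSlot-refl special    = refl

sameSlot-≢ : ∀ {N} {s t : Slot N} → s ≢ t → sameSlot s t ≡ false
sameSlot-≢ {s = normal s} {normal t} ne = ≟-false (ne ∘ cong normal)
sameSlot-≢ {s = normal s} {special}  ne = refl
sameSlot-≢ {s = special}  {normal t} ne = refl
sameSlot-≢ {s = special}  {special}  ne = ⊥-elim (ne refl)

allSlots-unique : ∀ N → Unique (allSlots N)
allSlots-unique N = All.map⁺ (All.tabulate λ _ ()) ∷ map⁺ normal-injective (allFin⁺ N)

∈-allSlots : ∀ {N} (s : Slot N) → s ∈ allSlots N
∈-allSlots (normal s) = there (∈-map⁺ normal (∈-allFin s))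
∈-allSlots special    = here refl

module _ {U N : ℕ} where

  setSlot-same : (T : Table U N) (s : Slot N) (v : Maybe (Fin U)) → setSlot T s v s ≡ v
  setSlot-same T s v rewrite sameSlot-refl s = refl

  setSlot-other : (T : Table U N) {s t : Slot N} (v : Maybe (Fin U)) → s ≢ t → setSlot T s v t ≡ T t
  setSlot-other T v ne rewrite sameSlot-≢ ne = refl

  data MoveEffect (T : Table U N) (a b : Slot N) (T′ : Table U N) : Set where
    ill-formed : T′ ≡ T → MoveEffect T a b T′
    moved : ∀ x → T a ≡ just x → T b ≡ nothing →
            T′ ≡ setSlot (setSlot T a nothing) b (just x) → MoveEffect T a b T′

  moveEffect : (T : Table U N) (a b : Slot N) → MoveEffect T a b (applyMove T (a , b))
  moveEffect T a b with T a in eqa | T b in eqb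
  ... | just x  | nothing = moved x eqa eqb refl
  ... | just x  | just _  = ill-formed refl
  ... | nothing | just _  = ill-formed refl
  ... | nothing | nothing = ill-formed refl

  contents : (Fin U → ℕ) → Table U N → ℕ
  contents f T = ∑ (λ t → maybe′ f 0 (T t)) (allSlots N)

  contents-setSlot : (f : Fin U → ℕ) (T : Table U N) (s : Slot N) (v : Maybe (Fin U)) →
                     contents f (setSlot T s v) + maybe′ f 0 (T s) ≡ contents f T + maybe′ f 0 v
  contents-setSlot f T s v =
    trans (∑-update (allSlots-unique N) (∈-allSlots s)
             λ t t≢s → cong (maybe′ f 0) (setSlot-other T v (t≢s ∘ sym)))
          (cong (λ o → contents f T + maybe′ f 0 o) (setSlot-same T s v))

  -- Equality of all weighted sums says that the table and `S` agree as multisets. Indicator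
  -- functions recover membership, positions and injectivity, while moves, insertions and deletions
  -- need only arithmetic of sums.
  record Consistent (T : Table U N) (S : List (Fin U)) : Set where
    field
      unique : Unique S
      stored : ∀ f → contents f T ≡ ∑ f S

    stored⇒∈ : ∀ {t y} → T t ≡ just y → y ∈ S
    stored⇒∈ {t} {y} e with ∑-positive (λ z → χ ⌊ z Fin.≟ y ⌋) S pos
      where
      pos : 1 ≤ ∑ (λ z → χ ⌊ z Fin.≟ y ⌋) S
      pos = begin
        1  ≡⟨ cong χ (≟-refl y) ⟨
        χ ⌊ y Fin.≟ y ⌋  ≡⟨ cong (maybe′ (λ z → χ ⌊ z Fin.≟ y ⌋) 0) e ⟨
        maybe′ (λ z → χ ⌊ z Fin.≟ y ⌋) 0 (T t)  ≤⟨ ∑-∈ (λ t → maybe′ (λ z → χ ⌊ z Fin.≟ y ⌋) 0 (T t)) (∈-allSlots t) ⟩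
        contents (λ z → χ ⌊ z Fin.≟ y ⌋) T  ≡⟨ stored _ ⟩
        ∑ (λ z → χ ⌊ z Fin.≟ y ⌋) S  ∎
        where open ≤-Reasoning
    ... | z , z∈ , q = subst (_∈ S) (≟-true (χ-true q)) z∈

    position : ∀ {y} → y ∈ S → ∃ λ t → T t ≡ just y
    position {y} y∈ with ∑-positive (λ t → maybe′ (λ z → χ ⌊ z Fin.≟ y ⌋) 0 (T t)) (allSlots N)
                           (≤-reflexive (sym (trans (stored _) (∑-≟ unique y∈))))
    ... | t , _ , q with T t in e
    ...   | just z = t , trans e (cong just (≟-true (χ-true q)))

    injective : ∀ {s t y} → T s ≡ just y → T t ≡ just y → s ≡ t
    injective {s} {t} {y} es et with slot-≟ s t
    ... | yes s≡t = s≡t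
    ... | no  s≢t = ⊥-elim (<-irrefl refl (begin
      2  ≡⟨ cong₂ _+_ (h es) (h et) ⟨
      g s + g t  ≤⟨ ∑-∈₂ g (∈-allSlots s) (∈-allSlots t) s≢t ⟩
      ∑ g (allSlots N)  ≡⟨ stored _ ⟩
      ∑ (λ z → χ ⌊ z Fin.≟ y ⌋) S  ≡⟨ ∑-≟ unique (stored⇒∈ es) ⟩
      1  ∎))
      where
      open ≤-Reasoning
      g : Slot N → ℕ
      g t = maybe′ (λ z → χ ⌊ z Fin.≟ y ⌋) 0 (T t)
      h : ∀ {t} → T t ≡ just y → g t ≡ 1
      h e = trans (cong (maybe′ (λ z → χ ⌊ z Fin.≟ y ⌋) 0) e) (cong χ (≟-refl y))

  open Consistent public

  consistent-empty : Consistent (emptyTable {U} {N}) []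
  consistent-empty = record { unique = [] ; stored = λ f → ∑-zero (allSlots N) }

  consistent-move : ∀ {T S} m → Consistent T S → Consistent (applyMove T m) S
  consistent-move {T} {S} (a , b) C with applyMove T (a , b) | moveEffect T a b
  ... | _ | ill-formed refl = C
  ... | _ | moved x ea eb refl = record { unique = unique C ; stored = λ f → trans (eq f) (stored C f) }
    where
    T₁ : Table U N
    T₁ = setSlot T a nothing
    a≢b : a ≢ b
    a≢b refl with trans (sym ea) eb
    ... | ()
    eq : ∀ f → contents f (setSlot T₁ b (just x)) ≡ contents f T
    eq f = begin
      contents f (setSlot T₁ b (just x))  ≡⟨ +-identityʳ _ ⟨
      contents f (setSlot T₁ b (just x)) + 0  ≡⟨ cong (λ o → contents f (setSlot T₁ b (just x)) + maybe′ f 0 o)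
                                                                        (trans (setSlot-other T nothing a≢b) eb) ⟨
      contents f (setSlot T₁ b (just x)) + maybe′ f 0 (T₁ b)  ≡⟨ contents-setSlot f T₁ b (just x) ⟩
      contents f T₁ + f x  ≡⟨ cong (λ o → contents f T₁ + maybe′ f 0 o) ea ⟨
      contents f T₁ + maybe′ f 0 (T a)  ≡⟨ contents-setSlot f T a nothing ⟩
      contents f T + 0  ≡⟨ +-identityʳ _ ⟩
      contents f T  ∎
      where open ≡-Reasoning

  consistent-moves : ∀ {T S} ms → Consistent T S → Consistent (foldl applyMove T ms) S
  consistent-moves []       C = C
  consistent-moves (m ∷ ms) C = consistent-moves ms (consistent-move m C)

  consistent-insert : ∀ {T S x} → T special ≡ nothing → x ∉ S → Consistent T S →
                      Consistent (setSlot T special (just x)) (x ∷ S)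
  consistent-insert {T} {S} {x} e x∉ C = record
    { unique = All.tabulate (λ { y∈ refl → x∉ y∈ }) ∷ unique C
    ; stored = λ f → begin
        contents f T′  ≡⟨ +-identityʳ _ ⟨
        contents f T′ + 0  ≡⟨ cong (λ o → contents f T′ + maybe′ f 0 o) e ⟨
        contents f T′ + maybe′ f 0 (T special)  ≡⟨ contents-setSlot f T special (just x) ⟩
        contents f T + f x  ≡⟨ +-comm _ (f x) ⟩
        f x + contents f T  ≡⟨ cong (f x +_) (stored C f) ⟩
        f x + ∑ f S  ∎ }
    where
    open ≡-Reasoning
    T′ : Table U N
    T′ = setSlot T special (just x)

without : ∀ {U} → Fin U → List (Fin U) → List (Fin U)
without x = filterᵇ (λ z → not ⌊ z Fin.≟ x ⌋)

∑-filterᵇ : {X : Set} (f : X → ℕ) (p : X → Bool) (xs : List X) →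
            ∑ f (filterᵇ p xs) ≡ ∑ (λ x → χ (p x) * f x) xs
∑-filterᵇ f p []       = refl
∑-filterᵇ f p (x ∷ xs) with p x
... | true  = cong₂ _+_ (sym (+-identityʳ (f x))) (∑-filterᵇ f p xs)
... | false = ∑-filterᵇ f p xs

∑-without : ∀ {U} (f : Fin U → ℕ) {x : Fin U} {S : List (Fin U)} → Unique S → x ∈ S →
            ∑ f (without x S) + f x ≡ ∑ f S
∑-without f {x} {S} u x∈ = begin
  ∑ f (without x S) + f x ≡⟨ cong (_+ f x) (∑-filterᵇ f _ S) ⟩
  ∑ g S + f x  ≡⟨ ∑-update u x∈ (λ y ne → trans (cong (λ b → χ (not b) * f y) (≟-false ne)) (+-identityʳ (f y))) ⟩
  ∑ f S + g x  ≡⟨ cong (λ b → ∑ f S + χ (not b) * f x) (≟-refl x) ⟩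
  ∑ f S + 0  ≡⟨ +-identityʳ _ ⟩
  ∑ f S  ∎
  where
  open ≡-Reasoning
  g : Fin _ → ℕ
  g z = χ (not ⌊ z Fin.≟ x ⌋) * f z

module _ {U N : ℕ} where

  consistent-delete : ∀ {T : Table U N} {S} x → Consistent T S → Consistent (removeKey T x) (without x S)
  consistent-delete {T} {S} x C = record
    { unique = filter⁺ (T? ∘ (λ z → not ⌊ z Fin.≟ x ⌋)) (unique C)
    ; stored = λ f → begin
        contents f (removeKey T x)  ≡⟨ ∑-cong (allSlots N) (λ {t} _ → lem f (T t)) ⟩
        contents (λ z → χ (not ⌊ z Fin.≟ x ⌋) * f z) T  ≡⟨ stored C _ ⟩
        ∑ (λ z → χ (not ⌊ z Fin.≟ x ⌋) * f z) S  ≡⟨ ∑-filterᵇ f _ S ⟨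
        ∑ f (without x S)  ∎ }
    where
    open ≡-Reasoning
    lem : ∀ f o → maybe′ f 0 (dropKey x o) ≡ maybe′ (λ z → χ (not ⌊ z Fin.≟ x ⌋) * f z) 0 o
    lem f nothing = refl
    lem f (just y) with ⌊ y Fin.≟ x ⌋
    ... | true  = refl
    ... | false = sym (+-identityʳ (f y))

memberB⇒∈ : ∀ {U} {y : Fin U} {S} → memberB y S ≡ true → y ∈ S
memberB⇒∈ {y = y} {S} e with any-elim (λ z → ⌊ z Fin.≟ y ⌋) S e
... | z , z∈ , q = subst (_∈ S) (≟-true q) z∈

∈⇒memberB : ∀ {U} {y : Fin U} {S} → y ∈ S → memberB y S ≡ true
∈⇒memberB {y = y} y∈ = any-intro (λ z → ⌊ z Fin.≟ y ⌋) y∈ (≟-refl y)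

∑-memberB : ∀ {U} {S : List (Fin U)} → Unique S → ∑ (λ y → χ (memberB y S)) (allFin U) ≡ length S
∑-memberB {U} {S} u = begin
  ∑ (λ y → χ (memberB y S)) (allFin U)  ≡⟨ ∑-cong (allFin U) (λ {y} _ → count y) ⟩
  ∑ (λ y → ∑ (λ z → χ ⌊ z Fin.≟ y ⌋) S) (allFin U)  ≡⟨ ∑-swap (λ y z → χ ⌊ z Fin.≟ y ⌋) (allFin U) S ⟩
  ∑ (λ z → ∑ (λ y → χ ⌊ z Fin.≟ y ⌋) (allFin U)) S  ≡⟨ ∑-cong S (λ {z} _ → ∑-≟ʳ z) ⟩
  ∑ (λ _ → 1) S  ≡⟨ ∑-one S ⟩
  length S  ∎
  where
  open ≡-Reasoning
  count : ∀ y → χ (memberB y S) ≡ ∑ (λ z → χ ⌊ z Fin.≟ y ⌋) S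
  count y with memberB y S in e
  ... | true  = sym (∑-≟ u (memberB⇒∈ e))
  ... | false = sym (n<1⇒n≡0 (≰⇒> λ p → let z , z∈ , q = ∑-positive (λ z → χ ⌊ z Fin.≟ y ⌋) S p in
                  false≢true (trans (sym e) (any-intro (λ z → ⌊ z Fin.≟ y ⌋) z∈ (χ-true q)))))

-- The potential of one scale: the least cost of an assignment.

allVecs : {X : Set} → List X → (n : ℕ) → List (Vec X n)
allVecs xs zero    = []ᵥ ∷ []
allVecs xs (suc n) = concatMap (λ x → map (x ∷ᵥ_) (allVecs xs n)) xs

∈-allVecs : {X : Set} {xs : List X} → (∀ x → x ∈ xs) → ∀ {n} (v : Vec X n) → v ∈ allVecs xs n
∈-allVecs all∈ []ᵥ       = here refl
∈-allVecs all∈ (x ∷ᵥ v) = ∈-concatMap⁺ _ (lose (all∈ x) (∈-map⁺ (x ∷ᵥ_) (∈-allVecs all∈ v)))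

≤ᵇ-true : ∀ {m n} → m ≤ n → (m ≤ᵇ n) ≡ true
≤ᵇ-true p = Equivalence.to T-≡ (≤⇒≤ᵇ p)

≤ᵇ-true⁻ : ∀ {m n} → (m ≤ᵇ n) ≡ true → m ≤ n
≤ᵇ-true⁻ {m} e = ≤ᵇ⇒≤ m _ (Equivalence.from T-≡ e)

≤ᵇ-false : ∀ {m n} → n < m → (m ≤ᵇ n) ≡ false
≤ᵇ-false {m} {n} p with m ≤ᵇ n in e
... | true  = ⊥-elim (<⇒≱ p (≤ᵇ-true⁻ e))
... | false = refl

holds : ∀ {U} → Maybe (Fin U) → Fin U → Bool
holds o y = maybe′ (λ z → ⌊ z Fin.≟ y ⌋) false o

holds⇒≡ : ∀ {U} (o : Maybe (Fin U)) {y} → holds o y ≡ true → o ≡ just y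
holds⇒≡ (just z) e = cong just (≟-true e)

≢⇒holds : ∀ {U} (o : Maybe (Fin U)) {y} → o ≢ just y → holds o y ≡ false
≢⇒holds o {y} ne with holds o y in e
... | true  = ⊥-elim (ne (holds⇒≡ o e))
... | false = refl

just≢nothing : {X : Set} {x : X} {o : Maybe X} → o ≡ just x → o ≢ nothing
just≢nothing refl ()

charge≤ : ℕ → ℕ → ℕ
charge≤ θ v = if v ≤ᵇ θ then v else 0

charge≤-light : ∀ {θ v} → v ≤ θ → charge≤ θ v ≡ v
charge≤-light p rewrite ≤ᵇ-true p = refl

moveWeight : ∀ {U N} → (Fin U → Fin N → ℕ) → Table U N → Move N → ℕ
moveWeight w T (a , normal t) = maybe′ (λ x → w x t) 0 (T a)
moveWeight w T (a , special)  = 0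

module Potential {U N : ℕ} (w : Fin U → Fin N → ℕ) (w≥1 : ∀ y t → 1 ≤ w y t) (D θ : ℕ) (D≥1 : 1 ≤ D) where

  -- The discount for staying ends at weight `θ`: a key parked at a very expensive slot gets no
  -- credit for being there, so moving a key to such a slot gains nothing.
  cost₁ : Table U N → Fin U → Maybe (Fin N) → ℕ
  cost₁ T y nothing  = D
  cost₁ T y (just t) = if holds (T (normal t)) y ∧ (w y t ≤ᵇ θ) then 0 else D ⊓ w y t

  -- Every key of the universe has an entry, although `total` charges only the keys of `S`; the same
  -- assignment can then be read before and after an insertion or deletion. Entries outside `S` may
  -- still block slots.
  Assignment : Set
  Assignment = Vec (Maybe (Fin N)) U

  record Valid (π : Assignment) : Set where
    constructor valid
    field
      separates : ∀ y z t → lookup π y ≡ just t → lookup π z ≡ just t → y ≡ z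

  open Valid

  valid? : (π : Assignment) → Dec (Valid π)
  valid? π = map′ valid separates (Fin.all? λ y → Fin.all? λ z → Fin.all? λ t →
    Maybe.≡-dec Fin._≟_ (lookup π y) (just t) →-dec (Maybe.≡-dec Fin._≟_ (lookup π z) (just t) →-dec (y Fin.≟ z)))

  total : Table U N → List (Fin U) → Assignment → ℕ
  total T S π = ∑ (λ y → cost₁ T y (lookup π y)) S

  unassigned : Assignment
  unassigned = replicateᵥ U nothing

  assignments : List Assignment
  assignments = filter valid? (allVecs (nothing ∷ map just (allFin N)) U)

  unassigned-valid : Valid unassigned
  unassigned-valid = valid λ y z t e _ → ⊥-elim (just≢nothing e (lookup-replicate y nothing))

  abstract
    best : Table U N → List (Fin U) → Assignment
    best T S = argmin (total T S) unassigned assignments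

    best-valid : ∀ T S → Valid (best T S)
    best-valid T S = argmin-all (total T S) unassigned-valid (All.all-filter valid? (allVecs _ U))

    best-minimal : ∀ T S {π} → Valid π → total T S (best T S) ≤ total T S π
    best-minimal T S {π} v = All.lookup (f[argmin]≤f[xs] {f = total T S} unassigned assignments)
                               (∈-filter⁺ valid? (∈-allVecs all∈ π) v)
      where
      all∈ : ∀ o → o ∈ (nothing ∷ map just (allFin N))
      all∈ nothing  = here refl
      all∈ (just t) = there (∈-map⁺ just (∈-allFin t))

  Φ : Table U N → List (Fin U) → ℕ
  Φ T S = total T S (best T S)

  Φ≤total : ∀ T S {π} → Valid π → Φ T S ≤ total T S π
  Φ≤total = best-minimal

  Φ≤D*length : ∀ T S → Φ T S ≤ D * length S
  Φ≤D*length T S = begin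
    Φ T S  ≤⟨ Φ≤total T S unassigned-valid ⟩
    ∑ (λ y → cost₁ T y (lookup unassigned y)) S  ≡⟨ ∑-cong S (λ {y} _ → cong (cost₁ T y) (lookup-replicate y nothing)) ⟩
    ∑ (λ _ → D) S  ≡⟨ ∑-const D S ⟩
    length S * D  ≡⟨ *-comm (length S) D ⟩
    D * length S  ∎
    where open ≤-Reasoning

  assign-free : ∀ {π} y s → Valid π → (∀ z → lookup π z ≢ just s) → Valid (π [ y ]≔ just s)
  assign-free {π} y s v free .separates a b t ea eb with a Fin.≟ y | b Fin.≟ y
  ... | yes refl | yes refl = refl
  ... | no  a≢y  | no  b≢y  = separates v a b t (trans (sym (lookup∘update′ a≢y π _)) ea) (trans (sym (lookup∘update′ b≢y π _)) eb)
  ... | yes refl | no  b≢y  with trans (sym (lookup∘update y π _)) ea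
  ...   | refl = ⊥-elim (free b (trans (sym (lookup∘update′ b≢y π _)) eb))
  assign-free {π} y s v free .separates a b t ea eb | no a≢y | yes refl with trans (sym (lookup∘update y π _)) eb
  ...   | refl = ⊥-elim (free a (trans (sym (lookup∘update′ a≢y π _)) ea))

  unassign : ∀ {π} y → Valid π → Valid (π [ y ]≔ nothing)
  unassign {π} y v = valid λ a b t ea eb → separates v a b t (old a ea) (old b eb)
    where
    old : ∀ z {t} → lookup (π [ y ]≔ nothing) z ≡ just t → lookup π z ≡ just t
    old z e with z Fin.≟ y
    ... | no z≢y = trans (sym (lookup∘update′ z≢y π _)) e
    ... | yes refl with trans (sym (lookup∘update y π _)) e
    ...   | ()

  total-set : ∀ T {S π y} o → Unique S → y ∈ S →
              total T S (π [ y ]≔ o) + cost₁ T y (lookup π y) ≡ total T S π + cost₁ T y o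
  total-set T {S} {π} {y} o u y∈ =
    trans (∑-update u y∈ (λ z z≢y → cong (cost₁ T z) (lookup∘update′ z≢y π o)))
          (cong (λ o′ → total T S π + cost₁ T y o′) (lookup∘update y π o))

  total-set-∉ : ∀ T {S π y} o → y ∉ S → total T S (π [ y ]≔ o) ≡ total T S π
  total-set-∉ T {S} {π} o y∉ = ∑-cong S λ {z} z∈ → cong (cost₁ T z) (lookup∘update′ (λ { refl → y∉ z∈ }) π o)

  cost-home : ∀ T {y s} → T (normal s) ≡ just y → w y s ≤ θ → cost₁ T y (just s) ≡ 0
  cost-home T {y} e p rewrite e | ≟-refl y | ≤ᵇ-true p = refl

  cost-away : ∀ T {y s} → T (normal s) ≢ just y → cost₁ T y (just s) ≡ D ⊓ w y s
  cost-away T {y} {s} ne rewrite ≢⇒holds (T (normal s)) ne = refl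

  cost≤ : ∀ T y s → cost₁ T y (just s) ≤ D ⊓ w y s
  cost≤ T y s with holds (T (normal s)) y ∧ (w y s ≤ᵇ θ)
  ... | true  = z≤n
  ... | false = ≤-refl

  cost-cases : ∀ T y s → cost₁ T y (just s) ≡ D ⊓ w y s ⊎ (T (normal s) ≡ just y × w y s ≤ θ)
  cost-cases T y s with holds (T (normal s)) y in e | w y s ≤ᵇ θ in e′
  ... | true  | true  = inj₂ (holds⇒≡ (T (normal s)) e , ≤ᵇ-true⁻ e′)
  ... | true  | false = inj₁ refl
  ... | false | _     = inj₁ refl

  Light : Table U N → Fin N → Set
  Light T s = ∃ λ y → T (normal s) ≡ just y × w y s ≤ θ

  module Walk {T : Table U N} {S : List (Fin U)} (C : Consistent T S) where

    -- Returning the light resident of s to s frees another slot and saves its cost, so P-walks can be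
    -- followed until they leave the light slots.
    release : (P : ℕ → Fin N → Set) →
              (∀ s → Light T s ⊎ P 0 s) →
              (∀ {j s t y} → P j t → T (normal s) ≡ just y → w y s ≤ θ → w y t ≤ D → P (j + w y t) s) →
              ∀ fuel {π} s → total T S π ≤ fuel → Valid π → (∀ z → lookup π z ≢ just s) →
              Φ T S + D ≤ total T S π ⊎ ∃ λ j → P j s × Φ T S + j ≤ total T S π
    release P base step fuel {π} s le v free with base s
    ... | inj₂ p = inj₂ (0 , p , ≤-trans (≤-reflexive (+-identityʳ _)) (Φ≤total T S v))
    ... | inj₁ (y , e , p) with lookup π y in eπ | total-set T {π = π} (just s) (unique C) (stored⇒∈ C e)
    -- The resident was left out at cost `D`; sending it home to the free slot `s` saves all of it.
    ...   | nothing | eq = inj₁ (begin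
        Φ T S + D  ≤⟨ +-monoˡ-≤ D (Φ≤total T S (assign-free y s v free)) ⟩
        total T S (π [ y ]≔ just s) + D  ≡⟨ eq ⟩
        total T S π + cost₁ T y (just s)  ≡⟨ cong (total T S π +_) (cost-home T e p) ⟩
        total T S π + 0  ≡⟨ +-identityʳ _ ⟩
        total T S π  ∎)
      where open ≤-Reasoning
    -- Sending `y` home saves its cost at `t`, which is at least 1, so the total bounds the length
    -- of the walk. By injectivity `t` is free afterwards, and the walk continues there.
    ...   | just t | eq = continue fuel le
      where
      π′ : Assignment
      π′ = π [ y ]≔ just s
      t≢s : t ≢ s
      t≢s refl = free y eπ
      v′ : Valid π′
      v′ = assign-free y s v free
      eq′ : total T S π′ + (D ⊓ w y t) ≡ total T S π
      eq′ = begin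
        total T S π′ + (D ⊓ w y t)  ≡⟨ cong (total T S π′ +_) (cost-away T (λ e′ → t≢s (normal-injective (injective C e′ e)))) ⟨
        total T S π′ + cost₁ T y (just t)  ≡⟨ eq ⟩
        total T S π + cost₁ T y (just s)  ≡⟨ cong (total T S π +_) (cost-home T e p) ⟩
        total T S π + 0  ≡⟨ +-identityʳ _ ⟩
        total T S π  ∎
        where open ≡-Reasoning
      free′ : ∀ z → lookup π′ z ≢ just t
      free′ z ez with z Fin.≟ y
      ... | yes refl = t≢s (sym (just-injective (trans (sym (lookup∘update y π _)) ez)))
      ... | no  z≢y  = z≢y (separates v z y t (trans (sym (lookup∘update′ z≢y π _)) ez) eπ)
      less : suc (total T S π′) ≤ total T S π
      less = begin
        suc (total T S π′)  ≡⟨ +-comm 1 _ ⟩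
        total T S π′ + 1  ≤⟨ +-monoʳ-≤ (total T S π′) (⊓-glb D≥1 (w≥1 y t)) ⟩
        total T S π′ + (D ⊓ w y t)  ≡⟨ eq′ ⟩
        total T S π  ∎
        where open ≤-Reasoning
      open ≤-Reasoning
      continue : ∀ fuel → total T S π ≤ fuel →
                 Φ T S + D ≤ total T S π ⊎ ∃ λ j → P j s × Φ T S + j ≤ total T S π
      continue zero le = ⊥-elim (<⇒≱ less (≤-trans le z≤n))
      continue (suc fuel) le with release P base step fuel t (≤-pred (≤-trans less le)) v′ free′
      ... | inj₁ q = inj₁ (≤-trans q (≤-trans (n≤1+n _) less))
      ... | inj₂ (j , q , r) with ≤-total D (w y t)
      ...   | inj₁ D≤w = inj₁ (begin
          Φ T S + D  ≤⟨ +-monoˡ-≤ D (Φ≤total T S v′) ⟩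
          total T S π′ + D  ≡⟨ cong (total T S π′ +_) (m≤n⇒m⊓n≡m D≤w) ⟨
          total T S π′ + (D ⊓ w y t)  ≡⟨ eq′ ⟩
          total T S π  ∎)
      ...   | inj₂ w≤D = inj₂ (j + w y t , step q e p w≤D , (begin
          Φ T S + (j + w y t)  ≡⟨ +-assoc (Φ T S) j _ ⟨
          Φ T S + j + w y t  ≤⟨ +-monoˡ-≤ _ r ⟩
          total T S π′ + w y t  ≡⟨ cong (total T S π′ +_) (m≥n⇒m⊓n≡n w≤D) ⟨
          total T S π′ + (D ⊓ w y t)  ≡⟨ eq′ ⟩
          total T S π  ∎))

    -- A displaced light key w₀ reclaims its home s; whoever occupied s is displaced in turn.
    reclaim : (Q : ℕ → Fin N → Set) → T special ≡ nothing →
              (∀ {s y} → T (normal s) ≡ just y → w y s ≤ θ ⊎ Q 0 s) →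
              (∀ {j s t y} → Q j s → T (normal s) ≡ just y → w y t ≤ D → Q (j + w y t) t) →
              ∀ fuel {π} s w₀ → total T S π ≤ fuel → Valid π → lookup π w₀ ≡ nothing →
              T (normal s) ≡ just w₀ → w w₀ s ≤ θ →
              Φ T S + D ≤ total T S π ⊎ ∃ λ j → Q j s × Φ T S + j ≤ total T S π
    reclaim Q sp base step fuel {π} s w₀ le v eπ e p
      with Fin.any? (λ z → Maybe.≡-dec Fin._≟_ (lookup π z) (just s))
    -- An unoccupied home is reclaimed at no cost, which saves the `D` paid for leaving `w₀` out.
    ... | no none = inj₁ (home v (λ z ez → none (z , ez)) eπ)
      where
      open ≤-Reasoning
      home : ∀ {π} → Valid π → (∀ z → lookup π z ≢ just s) → lookup π w₀ ≡ nothing → Φ T S + D ≤ total T S π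
      home {π} v free eπ = begin
        Φ T S + D  ≤⟨ +-monoˡ-≤ D (Φ≤total T S (assign-free w₀ s v free)) ⟩
        total T S (π [ w₀ ]≔ just s) + D  ≡⟨ cong (λ o → total T S (π [ w₀ ]≔ just s) + cost₁ T w₀ o) eπ ⟨
        total T S (π [ w₀ ]≔ just s) + cost₁ T w₀ (lookup π w₀) ≡⟨ total-set T {π = π} (just s) (unique C) (stored⇒∈ C e) ⟩
        total T S π + cost₁ T w₀ (just s)  ≡⟨ cong (total T S π +_) (cost-home T e p) ⟩
        total T S π + 0  ≡⟨ +-identityʳ _ ⟩
        total T S π  ∎
    ... | yes (z , ez) = body (_∈?_ Fin._≟_ z S)
      where
      Result : Set
      Result = Φ T S + D ≤ total T S π ⊎ ∃ λ j → Q j s × Φ T S + j ≤ total T S π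
      w₀≢z : w₀ ≢ z
      w₀≢z refl = just≢nothing ez eπ
      π₁ π₂ : Assignment
      π₁ = π [ z ]≔ nothing
      π₂ = π₁ [ w₀ ]≔ just s
      v₂ : Valid π₂
      v₂ = assign-free w₀ s (unassign z v) free
        where
        free : ∀ x → lookup π₁ x ≢ just s
        free x ex with x Fin.≟ z
        ... | yes refl = just≢nothing ex (lookup∘update z π nothing)
        ... | no  x≢z  = x≢z (separates v x z s (trans (sym (lookup∘update′ x≢z π nothing)) ex) ez)
      eπ₁ : lookup π₁ w₀ ≡ nothing
      eπ₁ = trans (lookup∘update′ w₀≢z π nothing) eπ
      eπ₂ : lookup π₂ z ≡ nothing
      eπ₂ = trans (lookup∘update′ (w₀≢z ∘ sym) π₁ (just s)) (lookup∘update z π nothing)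
      eq₂ : total T S π₂ + D ≡ total T S π₁
      eq₂ = begin
        total T S π₂ + D  ≡⟨ cong (λ o → total T S π₂ + cost₁ T w₀ o) eπ₁ ⟨
        total T S π₂ + cost₁ T w₀ (lookup π₁ w₀)  ≡⟨ total-set T {π = π₁} (just s) (unique C) (stored⇒∈ C e) ⟩
        total T S π₁ + cost₁ T w₀ (just s)  ≡⟨ cong (total T S π₁ +_) (cost-home T e p) ⟩
        total T S π₁ + 0  ≡⟨ +-identityʳ _ ⟩
        total T S π₁  ∎
        where open ≡-Reasoning
      open ≤-Reasoning
      body : Dec (z ∈ S) → Result
      -- An occupant outside `S` is not charged, so it is evicted for free.
      body (no z∉) = inj₁ (begin
        Φ T S + D  ≤⟨ +-monoˡ-≤ D (Φ≤total T S v₂) ⟩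
        total T S π₂ + D  ≡⟨ eq₂ ⟩
        total T S π₁  ≡⟨ total-set-∉ T {π = π} nothing z∉ ⟩
        total T S π  ∎)
      body (yes z∈) with position C z∈
      ... | special , ep = ⊥-elim (just≢nothing ep sp)
      ... | normal t , ep = split (≤-total D (w z s))
        where
        -- `w₀` saves `D` by going home, while `z` now pays `D` instead of its cost at `s`; the net
        -- saving is exactly that cost.
        eq : total T S π₂ + (D ⊓ w z s) ≡ total T S π
        eq = +-cancelʳ-≡ D _ _ (begin-equality
          total T S π₂ + (D ⊓ w z s) + D  ≡⟨ lem (total T S π₂) (D ⊓ w z s) D ⟩
          total T S π₂ + D + (D ⊓ w z s)  ≡⟨ cong₂ _+_ eq₂ (sym (cost-away T (λ e′ → w₀≢z (just-injective (trans (sym e) e′))))) ⟩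
          total T S π₁ + cost₁ T z (just s)  ≡⟨ cong (λ o → total T S π₁ + cost₁ T z o) ez ⟨
          total T S π₁ + cost₁ T z (lookup π z)  ≡⟨ total-set T {π = π} nothing (unique C) z∈ ⟩
          total T S π + D  ∎)
          where
          lem : ∀ a b c → a + b + c ≡ a + c + b
          lem = solve-∀
        less : suc (total T S π₂) ≤ total T S π
        less = begin
          suc (total T S π₂)  ≡⟨ +-comm 1 _ ⟩
          total T S π₂ + 1  ≤⟨ +-monoʳ-≤ (total T S π₂) (⊓-glb D≥1 (w≥1 z s)) ⟩
          total T S π₂ + (D ⊓ w z s)  ≡⟨ eq ⟩
          total T S π  ∎
        extend : w z s ≤ D → ∀ {j} → Q j t → Φ T S + j ≤ total T S π₂ → Result
        extend w≤D {j} q r = inj₂ (j + w z s , step q ep w≤D , (begin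
          Φ T S + (j + w z s)  ≡⟨ +-assoc (Φ T S) j _ ⟨
          Φ T S + j + w z s  ≤⟨ +-monoˡ-≤ _ r ⟩
          total T S π₂ + w z s  ≡⟨ cong (total T S π₂ +_) (m≥n⇒m⊓n≡n w≤D) ⟨
          total T S π₂ + (D ⊓ w z s)  ≡⟨ eq ⟩
          total T S π  ∎))
        continue : w z s ≤ D → w z t ≤ θ → ∀ fuel → total T S π ≤ fuel → Result
        continue w≤D p′ zero le = ⊥-elim (<⇒≱ less (≤-trans le z≤n))
        continue w≤D p′ (suc fuel) le
          with reclaim Q sp base step fuel t z (≤-pred (≤-trans less le)) v₂ eπ₂ ep p′
        ... | inj₁ r           = inj₁ (≤-trans r (≤-trans (n≤1+n _) less))
        ... | inj₂ (j , q , r) = extend w≤D q r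
        split : D ≤ w z s ⊎ w z s ≤ D → Result
        split (inj₁ D≤w) = inj₁ (begin
          Φ T S + D  ≤⟨ +-monoˡ-≤ D (Φ≤total T S v₂) ⟩
          total T S π₂ + D  ≡⟨ cong (total T S π₂ +_) (m≤n⇒m⊓n≡m D≤w) ⟨
          total T S π₂ + (D ⊓ w z s)  ≡⟨ eq ⟩
          total T S π  ∎)
        split (inj₂ w≤D) with base ep
        ... | inj₁ p′ = continue w≤D p′ fuel le
        ... | inj₂ q  = extend w≤D q (≤-trans (≤-reflexive (+-identityʳ _)) (Φ≤total T S v₂))

    -- The best assignment after the insertion, with `x` taken out, assigns the old keys and leaves
    -- the slot of `x` free. By `release` it exceeds the old optimum by `D` or by the weight of a
    -- chain at that slot. The cost of `x` comes on top, so the gain is `D` unless chain and probe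
    -- together weigh less than `D`.
    Φ-insert : (P : ℕ → Fin N → Set) →
               (∀ s → Light T s ⊎ P 0 s) →
               (∀ {j s t y} → P j t → T (normal s) ≡ just y → w y s ≤ θ → w y t ≤ D → P (j + w y t) s) →
               ∀ x → x ∉ S → let Φ′ = Φ (setSlot T special (just x)) (x ∷ S) in
               Φ T S + D ≤ Φ′ ⊎ (Φ T S ≤ Φ′ × ∃ λ s → ∃ λ j → P j s × j + w x s < D)
    Φ-insert P base step x x∉ = split (lookup π x) refl
      where
      open ≤-Reasoning
      T′ = setSlot T special (just x)
      π π₁ : Assignment
      π = best T′ (x ∷ S)
      π₁ = π [ x ]≔ nothing
      v : Valid π
      v = best-valid T′ (x ∷ S)
      same-cost : ∀ z o → cost₁ T′ z o ≡ cost₁ T z o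
      same-cost z nothing  = refl
      same-cost z (just t) = refl
      eq′ : Φ T′ (x ∷ S) ≡ cost₁ T x (lookup π x) + total T S π
      eq′ = ∑-cong (x ∷ S) λ {z} _ → same-cost z (lookup π z)
      eq : total T S π₁ ≡ total T S π
      eq = total-set-∉ T {π = π} nothing x∉
      Goal : Set
      Goal = Φ T S + D ≤ Φ T′ (x ∷ S) ⊎ (Φ T S ≤ Φ T′ (x ∷ S) × ∃ λ s → ∃ λ j → P j s × j + w x s < D)
      split : ∀ o → lookup π x ≡ o → Goal
      split nothing eπ = inj₁ (begin
        Φ T S + D  ≤⟨ +-monoˡ-≤ D (Φ≤total T S v) ⟩
        total T S π + D  ≡⟨ +-comm _ D ⟩
        D + total T S π  ≡⟨ cong (λ o → cost₁ T x o + total T S π) eπ ⟨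
        cost₁ T x (lookup π x) + total T S π  ≡⟨ eq′ ⟨
        Φ T′ (x ∷ S)  ∎)
      split (just s) eπ = conclude (release P base step (total T S π₁) s ≤-refl (unassign x v) free)
        where
        free : ∀ z → lookup π₁ z ≢ just s
        free z ez with z Fin.≟ x
        ... | yes refl = just≢nothing ez (lookup∘update x π nothing)
        ... | no  z≢x  = z≢x (separates v z x s (trans (sym (lookup∘update′ z≢x π nothing)) ez) eπ)
        eq″ : Φ T′ (x ∷ S) ≡ (D ⊓ w x s) + total T S π
        eq″ = trans eq′ (cong (_+ total T S π)
                (trans (cong (cost₁ T x) eπ) (cost-away T (λ e → x∉ (stored⇒∈ C e)))))
        conclude : Φ T S + D ≤ total T S π₁ ⊎ (∃ λ j → P j s × Φ T S + j ≤ total T S π₁) → Goal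
        conclude (inj₁ r) = inj₁ (begin
          Φ T S + D  ≤⟨ r ⟩
          total T S π₁  ≡⟨ eq ⟩
          total T S π  ≤⟨ m≤n+m _ _ ⟩
          (D ⊓ w x s) + total T S π  ≡⟨ eq″ ⟨
          Φ T′ (x ∷ S)  ∎)
        conclude (inj₂ (j , q , r)) with ≤-total D (w x s) | (j + w x s) <? D
        ... | inj₁ D≤w | _ = inj₁ (begin
          Φ T S + D  ≤⟨ +-monoˡ-≤ D (Φ≤total T S v) ⟩
          total T S π + D  ≡⟨ +-comm _ D ⟩
          D + total T S π  ≡⟨ cong (_+ total T S π) (m≤n⇒m⊓n≡m D≤w) ⟨
          (D ⊓ w x s) + total T S π  ≡⟨ eq″ ⟨
          Φ T′ (x ∷ S)  ∎)
        ... | inj₂ w≤D | yes b = inj₂ ((begin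
          Φ T S  ≤⟨ Φ≤total T S v ⟩
          total T S π  ≤⟨ m≤n+m _ _ ⟩
          (D ⊓ w x s) + total T S π  ≡⟨ eq″ ⟨
          Φ T′ (x ∷ S)  ∎) , s , j , q , b)
        ... | inj₂ w≤D | no ¬b = inj₁ (begin
          Φ T S + D  ≤⟨ +-monoʳ-≤ (Φ T S) (≮⇒≥ ¬b) ⟩
          Φ T S + (j + w x s)  ≡⟨ +-assoc (Φ T S) j _ ⟨
          Φ T S + j + w x s  ≤⟨ +-monoˡ-≤ _ (≤-trans r (≤-reflexive eq)) ⟩
          total T S π + w x s  ≡⟨ +-comm _ (w x s) ⟩
          w x s + total T S π  ≡⟨ cong (_+ total T S π) (m≥n⇒m⊓n≡n w≤D) ⟨
          (D ⊓ w x s) + total T S π  ≡⟨ eq″ ⟨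
          Φ T′ (x ∷ S)  ∎)

    -- The best assignment after the deletion, with `y` left out at cost `D`, is an assignment of
    -- the old keys. Letting `y` reclaim its home recovers this `D`, unless the evictions lead to a
    -- slot of `Q 0` with total weight below `D`.
    Φ-delete : (Q : ℕ → Fin N → Set) → T special ≡ nothing →
               (∀ {s y} → T (normal s) ≡ just y → w y s ≤ θ ⊎ Q 0 s) →
               (∀ {j s t y} → Q j s → T (normal s) ≡ just y → w y t ≤ D → Q (j + w y t) t) →
               ∀ y → y ∈ S → let Φ′ = Φ (removeKey T y) (without y S) in
               Φ T S ≤ Φ′ ⊎ (Φ T S ≤ Φ′ + D × ∃ λ s → ∃ λ j → T (normal s) ≡ just y × Q j s × j < D)
    Φ-delete Q sp base step y y∈ = conclude
      where
      open ≤-Reasoning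
      T′ = removeKey T y
      S′ = without y S
      π π₁ : Assignment
      π = best T′ S′
      π₁ = π [ y ]≔ nothing
      v₁ : Valid π₁
      v₁ = unassign y (best-valid T′ S′)
      removed : ∀ s {z} → T (normal s) ≡ just z → z ≢ y → T′ (normal s) ≡ just z
      removed s {z} e z≢y rewrite e | ≟-false z≢y = refl
      away : ∀ s {z} → T (normal s) ≢ just z → T′ (normal s) ≢ just z
      away s ne e with T (normal s)
      ... | just a with a Fin.≟ y
      ...   | no _ = ne e
      same-cost : ∀ {z} → z ≢ y → ∀ o → cost₁ T z o ≡ cost₁ T′ z o
      same-cost z≢y nothing = refl
      same-cost {z} z≢y (just s) with Maybe.≡-dec Fin._≟_ (T (normal s)) (just z)
      ... | no  ne = trans (cost-away T ne) (sym (cost-away T′ (away s ne)))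
      ... | yes e  with w z s ≤? θ
      ...   | yes p = trans (cost-home T e p) (sym (cost-home T′ (removed s e z≢y) p))
      ...   | no ¬p rewrite e | ≟-false z≢y | ≟-refl z | ≤ᵇ-false (≰⇒> ¬p) = refl
      same : ∀ {z} → z ≢ y → cost₁ T z (lookup π₁ z) ≡ cost₁ T′ z (lookup π z)
      same {z} z≢y = trans (cong (cost₁ T z) (lookup∘update′ z≢y π nothing)) (same-cost z≢y (lookup π z))
      y∉S′ : y ∉ S′
      y∉S′ y∈′ with ∈-filter⁻ (T? ∘ (λ z → not ⌊ z Fin.≟ y ⌋)) {xs = S} y∈′
      ... | _ , t rewrite ≟-refl y = t
      eq : total T S π₁ ≡ Φ T′ S′ + D
      eq = begin-equality
        total T S π₁  ≡⟨ ∑-without (λ z → cost₁ T z (lookup π₁ z)) (unique C) y∈ ⟨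
        total T S′ π₁ + cost₁ T y (lookup π₁ y)  ≡⟨ cong₂ _+_ (∑-cong S′ (λ z∈ → same λ { refl → y∉S′ z∈ })) (cong (cost₁ T y) (lookup∘update y π nothing)) ⟩
        Φ T′ S′ + D  ∎
      always : Φ T S ≤ Φ T′ S′ + D
      always = ≤-trans (Φ≤total T S v₁) (≤-reflexive eq)
      Goal : Set
      Goal = Φ T S ≤ Φ T′ S′ ⊎ (Φ T S ≤ Φ T′ S′ + D × ∃ λ s → ∃ λ j → T (normal s) ≡ just y × Q j s × j < D)
      conclude : Goal
      conclude with position C y∈
      ... | special , e = ⊥-elim (just≢nothing e sp)
      ... | normal s , e with base e
      ...   | inj₂ q = inj₂ (always , s , 0 , e , q , D≥1)
      ...   | inj₁ p with reclaim Q sp base step (total T S π₁) s y ≤-refl v₁ (lookup∘update y π nothing) e p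
      ...     | inj₁ r = inj₁ (+-cancelʳ-≤ D _ _ (≤-trans r (≤-reflexive eq)))
      ...     | inj₂ (j , q , r) with j <? D
      ...       | yes j<D = inj₂ (always , s , j , e , q , j<D)
      ...       | no  j≮D = inj₁ (+-cancelʳ-≤ D _ _ (≤-trans (+-monoʳ-≤ (Φ T S) (≮⇒≥ j≮D)) (≤-trans r (≤-reflexive eq))))

    -- Only the moved key changes its home. Losing the old home makes no assignment cheaper. At the
    -- new slot a cost of at most the weight drops to 0 if the weight is within the cutoff, and
    -- stays as it was otherwise.
    Φ-move : ∀ m → Φ T S ≤ Φ (applyMove T m) S + charge≤ θ (moveWeight w T m)
    Φ-move (a , b) with applyMove T (a , b) | moveEffect T a b
    ... | _ | ill-formed refl = m≤m+n _ _
    ... | _ | moved x ea eb refl = goal b eb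
      where
      open ≤-Reasoning
      T₁ : Table U N
      T₁ = setSlot T a nothing
      module _ (b : Slot N) (eb : T b ≡ nothing) where
        T₂ : Table U N
        T₂ = setSlot T₁ b (just x)
        π = best T₂ S
        back : ∀ {z} t → z ≢ x → T₂ (normal t) ≡ just z → T (normal t) ≡ just z
        back t z≢x e with slot-≟ b (normal t)
        ... | yes refl = ⊥-elim (z≢x (just-injective (trans (sym e) (setSlot-same T₁ b (just x)))))
        ... | no b≢t with slot-≟ a (normal t)
        ...   | yes refl = ⊥-elim (just≢nothing (trans (sym (setSlot-other T₁ (just x) b≢t)) e) (setSlot-same T a nothing))
        ...   | no a≢t = trans (sym (setSlot-other T nothing a≢t)) (trans (sym (setSlot-other T₁ (just x) b≢t)) e)
        others : ∀ {z} → z ≢ x → ∀ o → cost₁ T z o ≤ cost₁ T₂ z o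
        others z≢x nothing = ≤-refl
        others {z} z≢x (just t) with cost-cases T₂ z t
        ... | inj₁ eq      = ≤-trans (cost≤ T z t) (≤-reflexive (sym eq))
        ... | inj₂ (e , p) = ≤-trans (≤-reflexive (cost-home T (back t z≢x e) p)) z≤n
        others′ : ∀ {t} → b ≢ normal t → cost₁ T x (just t) ≤ cost₁ T₂ x (just t)
        others′ {t} b≢t with cost-cases T₂ x t
        ... | inj₁ eq      = ≤-trans (cost≤ T x t) (≤-reflexive (sym eq))
        ... | inj₂ (e , _) with slot-≟ a (normal t)
        ...   | yes refl = ⊥-elim (just≢nothing (trans (sym (setSlot-other T₁ (just x) b≢t)) e) (setSlot-same T a nothing))
        ...   | no a≢t = ⊥-elim (a≢t (injective C ea (trans (sym (setSlot-other T nothing a≢t))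
                           (trans (sym (setSlot-other T₁ (just x) b≢t)) e))))
        summed : ∀ v → cost₁ T x (lookup π x) ≤ cost₁ T₂ x (lookup π x) + v → Φ T S ≤ Φ T₂ S + v
        summed v le = begin
          Φ T S  ≤⟨ Φ≤total T S (best-valid T₂ S) ⟩
          ∑ (λ z → cost₁ T z (lookup π z)) S  ≤⟨ ∑-mono S (λ {z} _ → each z (z Fin.≟ x)) ⟩
          ∑ (λ z → cost₁ T₂ z (lookup π z) + v * χ ⌊ z Fin.≟ x ⌋) S  ≡⟨ ∑-+ _ _ S ⟩
          Φ T₂ S + ∑ (λ z → v * χ ⌊ z Fin.≟ x ⌋) S  ≡⟨ cong (Φ T₂ S +_) (∑-* v _ S) ⟩
          Φ T₂ S + v * ∑ (λ z → χ ⌊ z Fin.≟ x ⌋) S  ≡⟨ cong (λ k → Φ T₂ S + v * k) (∑-≟ (unique C) (stored⇒∈ C ea)) ⟩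
          Φ T₂ S + v * 1  ≡⟨ cong (Φ T₂ S +_) (*-identityʳ v) ⟩
          Φ T₂ S + v  ∎
          where
          each : ∀ z → Dec (z ≡ x) → cost₁ T z (lookup π z) ≤ cost₁ T₂ z (lookup π z) + v * χ ⌊ z Fin.≟ x ⌋
          each z (yes refl) rewrite ≟-refl z | *-identityʳ v = le
          each z (no z≢x)   = ≤-trans (others z≢x (lookup π z)) (m≤m+n _ _)
      goal : ∀ b (eb : T b ≡ nothing) → Φ T S ≤ Φ (T₂ b eb) S + charge≤ θ (moveWeight w T (a , b))
      goal special eb = summed special eb 0 (≤-trans (x-cost (lookup (π special eb) x)) (m≤m+n _ 0))
        where
        x-cost : ∀ o → cost₁ T x o ≤ cost₁ (T₂ special eb) x o
        x-cost nothing  = ≤-refl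
        x-cost (just t) = others′ special eb λ ()
      goal (normal q) eb rewrite ea = summed (normal q) eb _ (x-cost (lookup (π (normal q) eb) x))
        where
        v = charge≤ θ (w x q)
        x-cost : ∀ o → cost₁ T x o ≤ cost₁ (T₂ (normal q) eb) x o + v
        x-cost nothing  = m≤m+n D v
        x-cost (just t) = at (q Fin.≟ t)
          where
          at : Dec (q ≡ t) → cost₁ T x (just t) ≤ cost₁ (T₂ (normal q) eb) x (just t) + v
          at (no  q≢t)  = ≤-trans (others′ (normal q) eb (q≢t ∘ normal-injective)) (m≤m+n _ v)
          at (yes refl) with cost-cases (T₂ (normal q) eb) x q
          ... | inj₁ eq      = ≤-trans (≤-trans (cost≤ T x q) (≤-reflexive (sym eq))) (m≤m+n _ v)
          ... | inj₂ (_ , p) = ≤-trans (≤-trans (cost≤ T x q) (m⊓n≤n D _)) (≤-trans (≤-reflexive (sym (charge≤-light p))) (m≤n+m v _))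

-- Counting the slots reached by cheap chains.

∧-intro : ∀ {a b} → a ≡ true → b ≡ true → a ∧ b ≡ true
∧-intro refl refl = refl

∧-elim : ∀ {a b} → a ∧ b ≡ true → a ≡ true × b ≡ true
∧-elim {true} {true} refl = refl , refl

∨-introˡ : ∀ {a b} → a ≡ true → a ∨ b ≡ true
∨-introˡ refl = refl

∨-introʳ : ∀ {a b} → b ≡ true → a ∨ b ≡ true
∨-introʳ {a} refl = ∨-zeroʳ a

upTo₁ : ℕ → List ℕ
upTo₁ n = map suc (upTo n)

∈-upTo₁⁺ : ∀ {v n} → 1 ≤ v → v ≤ n → v ∈ upTo₁ n
∈-upTo₁⁺ {suc v} _ p = ∈-map⁺ suc (∈-upTo⁺ p)

∈-upTo₁⁻ : ∀ {v n} → v ∈ upTo₁ n → 1 ≤ v × v ≤ n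
∈-upTo₁⁻ v∈ with ∈-map⁻ suc v∈
... | u , u∈ , refl = s≤s z≤n , ∈-upTo⁻ u∈

length-upTo₁ : ∀ n → length (upTo₁ n) ≡ n
length-upTo₁ n = trans (length-map suc (upTo n)) (length-upTo n)

size : ∀ {N} → (Fin N → Bool) → ℕ
size {N} p = ∑ (χ ∘ p) (allFin N)

degree : ∀ {N} → (ℕ → Fin N → Fin N → Bool) → ℕ → Fin N → ℕ
degree {N} e v t = size (e v t)

excess : ∀ {N} → (ℕ → Fin N → Fin N → Bool) → (ℕ → ℕ) → ℕ → ℕ
excess {N} e A v = ∑ (λ t → degree e v t ∸ A v) (allFin N)

module Closure {N : ℕ} (e : ℕ → Fin N → Fin N → Bool) (base : Fin N → Bool) (D : ℕ) where

  -- The first argument bounds the number of steps and drives the recursion, the second bounds the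
  -- total weight. Every step weighs at least 1, so taking both equal loses no chain.
  closure : ℕ → ℕ → Fin N → Bool
  closure zero    j s = base s
  closure (suc k) j s =
    base s ∨ any (λ v → (v ≤ᵇ j) ∧ any (λ t → closure k (j ∸ v) t ∧ e v t s) (allFin N)) (upTo₁ D)

  closure-base : ∀ k {j s} → base s ≡ true → closure k j s ≡ true
  closure-base zero    p = p
  closure-base (suc k) p = ∨-introˡ p

  closure-step : ∀ k {j v t s} → 1 ≤ v → v ≤ D → closure k j t ≡ true → e v t s ≡ true →
                 closure (suc k) (j + v) s ≡ true
  closure-step k {j} {v} {t} {s} 1≤v v≤D p q = ∨-introʳ {base s}
    (any-intro _ (∈-upTo₁⁺ 1≤v v≤D) (∧-intro (≤ᵇ-true (m≤n+m v j))
      (any-intro (λ t → closure k (j + v ∸ v) t ∧ e v t s) (∈-allFin t)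
        (∧-intro (subst (λ i → closure k i t ≡ true) (sym (m+n∸n≡m j v)) p) q))))

  closure-mono : ∀ {k k′ j j′ s} → k ≤ k′ → j ≤ j′ → closure k j s ≡ true → closure k′ j′ s ≡ true
  closure-mono {zero} {k′} _ _ p = closure-base k′ p
  closure-mono {suc k} {suc k′} {j} {j′} {s} (s≤s k≤) j≤ p with base s
  ... | true  = refl
  ... | false with any-elim (λ v → (v ≤ᵇ j) ∧ any (λ t → closure k (j ∸ v) t ∧ e v t s) (allFin N)) (upTo₁ D) p
  ...   | v , v∈ , q with ∧-elim {v ≤ᵇ j} q
  ...     | q₁ , q₂ with any-elim (λ t → closure k (j ∸ v) t ∧ e v t s) (allFin N) q₂
  ...       | t , t∈ , r with ∧-elim {closure k (j ∸ v) t} r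
  ...         | r₁ , r₂ =
    any-intro (λ v → (v ≤ᵇ j′) ∧ any (λ t → closure k′ (j′ ∸ v) t ∧ e v t s) (allFin N)) v∈
      (∧-intro (≤ᵇ-true {v} (≤-trans (≤ᵇ-true⁻ {v} q₁) j≤))
        (any-intro (λ t → closure k′ (j′ ∸ v) t ∧ e v t s) t∈ (∧-intro (closure-mono k≤ (∸-monoˡ-≤ v j≤) r₁) r₂)))

  module Bound (A : ℕ → ℕ) (D≥1 : 1 ≤ D) (A-small : ∀ v → 1 ≤ v → v ≤ D → 2 * D * A v ≤ 2 ^ (12 * v)) where

    -- A slot of large degree may lie anywhere on a chain. The targets beyond the cap are counted
    -- once and for all, as if they were further starting slots.
    G : ℕ
    G = size base + ∑ (excess e A) (upTo₁ D)

    capped : ∀ b x a → χ b * x ≤ a * χ b + (x ∸ a)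
    capped true  x a = ≤-trans (≤-reflexive (+-identityʳ x))
                        (≤-trans (m≤n+m∸n x a) (≤-reflexive (cong (_+ (x ∸ a)) (sym (*-identityʳ a)))))
    capped false x a = z≤n

    image-size : ∀ C v → ∑ (λ s → χ (any (λ t → C t ∧ e v t s) (allFin N))) (allFin N) ≤ A v * size C + excess e A v
    image-size C v = begin
      ∑ (λ s → χ (any (λ t → C t ∧ e v t s) (allFin N))) (allFin N)  ≤⟨ ∑-mono (allFin N) (λ {s} _ → χ-any _ (allFin N)) ⟩
      ∑ (λ s → ∑ (λ t → χ (C t ∧ e v t s)) (allFin N)) (allFin N)  ≡⟨ ∑-swap (λ s t → χ (C t ∧ e v t s)) (allFin N) (allFin N) ⟩
      ∑ (λ t → ∑ (λ s → χ (C t ∧ e v t s)) (allFin N)) (allFin N)  ≡⟨ ∑-cong (allFin N) (λ {t} _ → trans (∑-cong (allFin N) (λ {s} _ → χ-∧ (C t) (e v t s))) (∑-* (χ (C t)) _ (allFin N))) ⟩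
      ∑ (λ t → χ (C t) * degree e v t) (allFin N)  ≤⟨ ∑-mono (allFin N) (λ {t} _ → capped (C t) (degree e v t) (A v)) ⟩
      ∑ (λ t → A v * χ (C t) + (degree e v t ∸ A v)) (allFin N)  ≡⟨ ∑-+ _ _ (allFin N) ⟩
      ∑ (λ t → A v * χ (C t)) (allFin N) + excess e A v  ≡⟨ cong (_+ excess e A v) (∑-* (A v) _ (allFin N)) ⟩
      A v * size C + excess e A v  ∎
      where open ≤-Reasoning

    -- A last step of weight v multiplies the count by at most `A v`, which is at most 2^(12v) /
    -- (2D). With the induction hypothesis for j - v, each of the `D` values of v contributes at
    -- most 2^(12j) G / D. All last steps together thus need one copy of 2^(12j) G, and the start
    -- needs another.
    closure-size : ∀ k j → size (closure k j) ≤ 2 * (2 ^ (12 * j) * G)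
    closure-size zero j = begin
      size base  ≤⟨ m≤m+n _ _ ⟩
      G  ≤⟨ m≤n*m G (2 ^ (12 * j)) {{m^n≢0 2 (12 * j)}} ⟩
      2 ^ (12 * j) * G  ≤⟨ m≤n*m _ 2 ⟩
      2 * (2 ^ (12 * j) * G) ∎
      where open ≤-Reasoning
    closure-size (suc k) j = begin
      size (closure (suc k) j)
        ≤⟨ ∑-mono (allFin N) (λ {s} _ → ≤-trans (χ-∨ (base s) _) (+-monoʳ-≤ (χ (base s)) (χ-any _ (upTo₁ D)))) ⟩
      ∑ (λ s → χ (base s) + ∑ (λ v → χ ((v ≤ᵇ j) ∧ image v s)) (upTo₁ D)) (allFin N)
        ≡⟨ trans (∑-+ _ _ (allFin N)) (cong (size base +_) (∑-swap (λ s v → χ ((v ≤ᵇ j) ∧ image v s)) (allFin N) (upTo₁ D))) ⟩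
      size base + ∑ (λ v → ∑ (λ s → χ ((v ≤ᵇ j) ∧ image v s)) (allFin N)) (upTo₁ D)
        ≤⟨ +-monoʳ-≤ (size base) (∑-mono (upTo₁ D) (λ {v} v∈ → gated v)) ⟩
      size base + ∑ (λ v → main v + excess e A v) (upTo₁ D)
        ≡⟨ trans (cong (size base +_) (∑-+ _ _ (upTo₁ D))) (lem (size base) _ _) ⟩
      G + ∑ main (upTo₁ D)
        ≤⟨ +-mono-≤ (m≤n*m G (2 ^ (12 * j)) {{m^n≢0 2 (12 * j)}}) main-sum ⟩
      2 ^ (12 * j) * G + 2 ^ (12 * j) * G
        ≡⟨ cong (2 ^ (12 * j) * G +_) (+-identityʳ _) ⟨
      2 * (2 ^ (12 * j) * G) ∎
      where
      open ≤-Reasoning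
      image : ℕ → Fin N → Bool
      image v s = any (λ t → closure k (j ∸ v) t ∧ e v t s) (allFin N)
      main : ℕ → ℕ
      main v = χ (v ≤ᵇ j) * (A v * size (closure k (j ∸ v)))
      lem : ∀ a b c → a + (b + c) ≡ a + c + b
      lem = solve-∀
      gated : ∀ v → ∑ (λ s → χ ((v ≤ᵇ j) ∧ image v s)) (allFin N) ≤ main v + excess e A v
      gated v with v ≤ᵇ j
      ... | true  = ≤-trans (image-size (closure k (j ∸ v)) v) (≤-reflexive (cong (_+ excess e A v) (sym (+-identityʳ _))))
      ... | false = ≤-trans (≤-reflexive (∑-zero (allFin N))) z≤n
      each : ∀ {v} → v ∈ upTo₁ D → D * main v ≤ 2 ^ (12 * j) * G
      each {v} v∈ with v ≤ᵇ j in eq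
      ... | false = ≤-trans (≤-reflexive (*-zeroʳ D)) z≤n
      ... | true  = begin
        D * (A v * size (closure k (j ∸ v)) + 0)  ≡⟨ cong (D *_) (+-identityʳ _) ⟩
        D * (A v * size (closure k (j ∸ v)))  ≤⟨ *-monoʳ-≤ D (*-monoʳ-≤ (A v) (closure-size k (j ∸ v))) ⟩
        D * (A v * (2 * (2 ^ (12 * (j ∸ v)) * G)))  ≡⟨ lem₁ D (A v) (2 ^ (12 * (j ∸ v))) G ⟩
        2 * D * A v * (2 ^ (12 * (j ∸ v)) * G)  ≤⟨ *-monoˡ-≤ _ (A-small v (proj₁ (∈-upTo₁⁻ v∈)) (proj₂ (∈-upTo₁⁻ v∈))) ⟩
        2 ^ (12 * v) * (2 ^ (12 * (j ∸ v)) * G)  ≡⟨ *-assoc (2 ^ (12 * v)) _ G ⟨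
        2 ^ (12 * v) * 2 ^ (12 * (j ∸ v)) * G  ≡⟨ cong (_* G) (^-distribˡ-+-* 2 (12 * v) _) ⟨
        2 ^ (12 * v + 12 * (j ∸ v)) * G  ≡⟨ cong (λ i → 2 ^ i * G) (trans (sym (*-distribˡ-+ 12 v _)) (cong (12 *_) (m+[n∸m]≡n (≤ᵇ-true⁻ {v} eq)))) ⟩
        2 ^ (12 * j) * G  ∎
        where
        lem₁ : ∀ d a p g → d * (a * (2 * (p * g))) ≡ 2 * d * a * (p * g)
        lem₁ = solve-∀
      main-sum : ∑ main (upTo₁ D) ≤ 2 ^ (12 * j) * G
      main-sum = *-cancelˡ-≤ D {{>-nonZero D≥1}} (begin
        D * ∑ main (upTo₁ D)  ≡⟨ ∑-* D main (upTo₁ D) ⟨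
        ∑ (λ v → D * main v) (upTo₁ D)  ≤⟨ ∑-mono (upTo₁ D) each ⟩
        ∑ (λ _ → 2 ^ (12 * j) * G) (upTo₁ D)  ≡⟨ ∑-const _ (upTo₁ D) ⟩
        length (upTo₁ D) * (2 ^ (12 * j) * G)  ≡⟨ cong (_* (2 ^ (12 * j) * G)) (length-upTo₁ D) ⟩
        D * (2 ^ (12 * j) * G)  ∎)

-- Logarithmic probe complexity as weight, and the exceptional keys of a state.

search : (ℕ → Bool) → ℕ → ℕ → ℕ
search p zero    k = k
search p (suc f) k = if p k then k else search p f (suc k)

-- An unsuccessful search returns `k + f`; the bound `v < k + f` excludes this default, so the value
-- found is a genuine hit.
search≤⇒ : ∀ p → (∀ {i j} → i ≤ j → p i ≡ true → p j ≡ true) →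
           ∀ f k {v} → search p f k ≤ v → v < k + f → p v ≡ true
search≤⇒ p mono zero    k le lt = ⊥-elim (<⇒≱ lt (≤-trans (≤-reflexive (+-identityʳ k)) le))
search≤⇒ p mono (suc f) k le lt with p k in e
... | true  = mono le e
... | false = search≤⇒ p mono f (suc k) le (≤-trans lt (≤-reflexive (+-suc k f)))

search≤ : ∀ p f k {v} → k ≤ v → p v ≡ true → search p f k ≤ v
search≤ p zero    k le e = le
search≤ p (suc f) k le e with p k in e′
... | true  = le
... | false = search≤ p f (suc k) (≤∧≢⇒< le λ { refl → false≢true (trans (sym e′) e) }) e

module Weights {U N : ℕ} (h : ProbeSeq U N) (Λ ℓ₀ : ℕ) (ℓ₀≥1 : 1 ≤ ℓ₀) where

  hits : ℕ → Fin U → Fin N → Bool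
  hits ℓ y t = hitsWithin h (2 ^ ℓ) t y

  hits-mono : ∀ {y t i j} → i ≤ j → hits i y t ≡ true → hits j y t ≡ true
  hits-mono {y} {t} {i} {j} i≤j p with any-elim (λ k → hitB (h y k) t) (upTo₁ (2 ^ i)) p
  ... | k , k∈ , q = any-intro (λ k → hitB (h y k) t)
    (∈-upTo₁⁺ (proj₁ (∈-upTo₁⁻ k∈)) (≤-trans (proj₂ (∈-upTo₁⁻ k∈)) (^-monoʳ-≤ 2 i≤j))) q

  -- The probe complexity enters through its logarithm, rounded up and capped at `Λ`. The summand
  -- `ℓ₀` makes every step of a chain heavy enough to pay for the factors `D`, `c` and `L` that
  -- occur in the degree caps.
  weight : Fin U → Fin N → ℕ
  weight y t = ℓ₀ + search (λ ℓ → hits ℓ y t) Λ 0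

  weight≥1 : ∀ y t → 1 ≤ weight y t
  weight≥1 y t = ≤-trans ℓ₀≥1 (m≤m+n ℓ₀ _)

  weight≤⇒ : ∀ {y t v} → weight y t ≤ v → v < Λ → ℓ₀ ≤ v × hits (v ∸ ℓ₀) y t ≡ true
  weight≤⇒ {y} {t} {v} le lt = ≤-trans (m≤m+n ℓ₀ _) le ,
    search≤⇒ (λ ℓ → hits ℓ y t) (hits-mono {y} {t}) Λ 0
      (≤-trans (≤-reflexive (sym (m+n∸m≡n ℓ₀ _))) (∸-monoˡ-≤ ℓ₀ le)) (≤-trans (s≤s (m∸n≤m v ℓ₀)) lt)

  heavy⇒miss : ∀ {y t} ℓ → ℓ₀ + ℓ < weight y t → hits ℓ y t ≡ false
  heavy⇒miss {y} {t} ℓ lt with hits ℓ y t in e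
  ... | false = refl
  ... | true  = ⊥-elim (<⇒≱ lt (+-monoʳ-≤ ℓ₀ (search≤ (λ ℓ → hits ℓ y t) Λ 0 z≤n e)))

  hits-spread : ∀ ℓ y → size (hits ℓ y) ≤ 2 ^ ℓ
  hits-spread ℓ y = begin
    size (hits ℓ y)  ≤⟨ ∑-mono (allFin N) (λ {t} _ → χ-any (λ k → hitB (h y k) t) (upTo₁ (2 ^ ℓ))) ⟩
    ∑ (λ t → ∑ (λ k → χ (hitB (h y k) t)) (upTo₁ (2 ^ ℓ))) (allFin N) ≡⟨ ∑-swap (λ t k → χ (hitB (h y k) t)) (allFin N) (upTo₁ (2 ^ ℓ)) ⟩
    ∑ (λ k → ∑ (λ t → χ (hitB (h y k) t)) (allFin N)) (upTo₁ (2 ^ ℓ)) ≤⟨ ∑-mono (upTo₁ (2 ^ ℓ)) (λ {k} _ → once (h y k)) ⟩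
    ∑ (λ _ → 1) (upTo₁ (2 ^ ℓ))  ≡⟨ trans (∑-one (upTo₁ (2 ^ ℓ))) (length-upTo₁ (2 ^ ℓ)) ⟩
    2 ^ ℓ  ∎
    where
    open ≤-Reasoning
    once : (o : Maybe (Fin N)) → ∑ (λ t → χ (hitB o t)) (allFin N) ≤ 1
    once nothing  = ≤-trans (≤-reflexive (∑-zero (allFin N))) z≤n
    once (just s) = ≤-reflexive (∑-≟ʳ s)

  load : ℕ → List (Fin U) → Fin N → ℕ
  load ℓ S t = ∑ (λ y → χ (hits ℓ y t)) S

  searchHit-miss : ∀ y t cap f k → (∀ i → k ≤ i → i < k + f → hitB (h y i) t ≡ false) →
                   searchHit h y t cap f k ≡ cap
  searchHit-miss y t cap zero    k miss = refl
  searchHit-miss y t cap (suc f) k miss rewrite miss k ≤-refl (m<m+n k (s≤s z≤n)) =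
    searchHit-miss y t cap f (suc k) λ i le lt → miss i (≤-trans (n≤1+n k) le) (≤-trans lt (≤-reflexive (sym (+-suc k f))))

  miss⇒truncPC : ∀ {y t} ℓ → hits ℓ y t ≡ false → truncPC h (2 ^ ℓ) y t ≡ 2 ^ ℓ
  miss⇒truncPC {y} {t} ℓ e = searchHit-miss y t (2 ^ ℓ) (2 ^ ℓ) 1 misses
    where
    misses : ∀ i → 1 ≤ i → i < 1 + 2 ^ ℓ → hitB (h y i) t ≡ false
    misses i 1≤i (s≤s i≤) with hitB (h y i) t in e′
    ... | false = refl
    ... | true  with trans (sym e) (any-intro (λ k → hitB (h y k) t) (∈-upTo₁⁺ 1≤i i≤) e′)
    ...   | ()

  module Scale (D : ℕ) (D≥1 : 1 ≤ D) (D<Λ : D < Λ) (ℓ₀≤D : ℓ₀ ≤ D) where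

    open Potential weight weight≥1 D (32 * D) D≥1 public

    module State (T : Table U N) where

      heavy vacant open-slot : Fin N → Bool
      heavy     s = maybe′ (λ y → not (weight y s ≤ᵇ 32 * D)) false (T (normal s))
      vacant    s = maybe′ (λ _ → false) true (T (normal s))
      open-slot s = vacant s ∨ heavy s

      -- `backward` leads from `t` to the slots whose residents could cheaply move to `t`; `forward`
      -- leads from `t` to the slots where its own resident could cheaply go. Insertions need the
      -- chains that end at an open slot, deletions those that start at a heavy key.
      backward forward : ℕ → Fin N → Fin N → Bool
      backward v t s = maybe′ (λ y → weight y t ≤ᵇ v) false (T (normal s))
      forward  v t s = maybe′ (λ y → weight y s ≤ᵇ v) false (T (normal t))

      module B = Closure backward open-slot D
      module F = Closure forward heavy D

      reaching reached : Fin N → Bool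
      reaching = B.closure D D
      reached  = F.closure D D

      badInsert badDelete : Fin U → Bool
      badInsert x = any (λ s → reaching s ∧ (weight x s ≤ᵇ D)) (allFin N)
      badDelete y = any (λ s → reached s ∧ holds (T (normal s)) y) (allFin N)

      heavy-cost : size heavy * 2 ^ (31 * D) ≤ pcSum h (2 ^ (31 * D)) T
      heavy-cost = begin
        size heavy * 2 ^ (31 * D)  ≡⟨ *-comm (size heavy) _ ⟩
        2 ^ (31 * D) * size heavy  ≡⟨ ∑-* (2 ^ (31 * D)) (χ ∘ heavy) (allFin N) ⟨
        ∑ (λ s → 2 ^ (31 * D) * χ (heavy s)) (allFin N)  ≤⟨ ∑-mono (allFin N) (λ {s} _ → each s) ⟩
        ∑ (pc ∘ normal) (allFin N)  ≡⟨ ∑-map pc normal (allFin N) ⟨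
        ∑ pc (map normal (allFin N))  ≤⟨ m≤n+m _ (pc special) ⟩
        pcSum h (2 ^ (31 * D)) T  ∎
        where
        open ≤-Reasoning
        pc : Slot N → ℕ
        pc t = maybe′ (slotPC h (2 ^ (31 * D)) t) 0 (T t)
        each : ∀ s → 2 ^ (31 * D) * χ (heavy s) ≤ pc (normal s)
        each s with T (normal s)
        ... | nothing = ≤-reflexive (*-zeroʳ (2 ^ (31 * D)))
        ... | just y with weight y s ≤ᵇ 32 * D in e
        ...   | true  = ≤-trans (≤-reflexive (*-zeroʳ (2 ^ (31 * D)))) z≤n
        -- Since `ℓ₀ ≤ D`, a weight above 32D means no hit among the first 2^(31D) probes, so the
        -- truncated probe complexity attains its maximum.
        ...   | false = ≤-reflexive (trans (*-identityʳ _) (sym (miss⇒truncPC (31 * D) (heavy⇒miss (31 * D) (begin-strict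
          ℓ₀ + 31 * D  ≤⟨ +-monoˡ-≤ _ ℓ₀≤D ⟩
          32 * D  <⟨ ≰⇒> (λ p → false≢true (trans (sym e) (≤ᵇ-true p))) ⟩
          weight y s  ∎)))))

      degree-forward : ∀ v t → v ≤ D → degree forward v t ≤ (if ℓ₀ ≤ᵇ v then 2 ^ (v ∸ ℓ₀) else 0)
      degree-forward v t v≤D with T (normal t) | ℓ₀ ≤ᵇ v in e
      ... | nothing | b = ≤-trans (≤-reflexive (∑-zero (allFin N))) z≤n
      ... | just y  | true = ≤-trans (∑-mono (allFin N) (λ {s} _ → each s)) (hits-spread (v ∸ ℓ₀) y)
        where
        each : ∀ s → χ (weight y s ≤ᵇ v) ≤ χ (hits (v ∸ ℓ₀) y s)
        each s with weight y s ≤ᵇ v in e′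
        ... | false = z≤n
        ... | true  rewrite proj₂ (weight≤⇒ {y} {s} (≤ᵇ-true⁻ {weight y s} e′) (≤-trans (s≤s v≤D) D<Λ)) = ≤-refl
      ... | just y  | false = ≤-trans (∑-mono (allFin N) (λ {s} _ → each s)) (≤-reflexive (∑-zero (allFin N)))
        where
        each : ∀ s → χ (weight y s ≤ᵇ v) ≤ 0
        each s with weight y s ≤ᵇ v in e′
        ... | false = z≤n
        ... | true with trans (sym e) (≤ᵇ-true (proj₁ (weight≤⇒ {y} {s} (≤ᵇ-true⁻ {weight y s} e′) (≤-trans (s≤s v≤D) D<Λ))))
        ...   | ()

      module _ {S : List (Fin U)} (C : Consistent T S) where

        normal-contents : (f : Fin U → ℕ) → ∑ (λ s → maybe′ f 0 (T (normal s))) (allFin N) ≤ ∑ f S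
        normal-contents f = begin
          ∑ (λ s → maybe′ f 0 (T (normal s))) (allFin N)  ≡⟨ ∑-map (λ t → maybe′ f 0 (T t)) normal (allFin N) ⟨
          ∑ (λ t → maybe′ f 0 (T t)) (map normal (allFin N))  ≤⟨ m≤n+m _ (maybe′ f 0 (T special)) ⟩
          contents f T  ≡⟨ stored C f ⟩
          ∑ f S  ∎
          where open ≤-Reasoning

        vacant-count : T special ≡ nothing → size vacant + length S ≡ N
        vacant-count sp = begin
          size vacant + length S  ≡⟨ cong (size vacant +_) (sym occupied) ⟩
          size vacant + ∑ (λ s → maybe′ (λ _ → 1) 0 (T (normal s))) (allFin N)  ≡⟨ ∑-+ _ _ (allFin N) ⟨
          ∑ (λ s → χ (vacant s) + maybe′ (λ _ → 1) 0 (T (normal s))) (allFin N)  ≡⟨ ∑-cong (allFin N) (λ {s} _ → one s) ⟩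
          ∑ (λ _ → 1) (allFin N)  ≡⟨ trans (∑-one (allFin N)) (length-allFin N) ⟩
          N  ∎
          where
          open ≡-Reasoning
          one : ∀ s → χ (vacant s) + maybe′ (λ _ → 1) 0 (T (normal s)) ≡ 1
          one s with T (normal s)
          ... | just _  = refl
          ... | nothing = refl
          occupied : ∑ (λ s → maybe′ (λ _ → 1) 0 (T (normal s))) (allFin N) ≡ length S
          occupied = begin
            ∑ (λ s → maybe′ (λ _ → 1) 0 (T (normal s))) (allFin N)  ≡⟨ ∑-map (λ t → maybe′ (λ _ → 1) 0 (T t)) normal (allFin N) ⟨
            ∑ (λ t → maybe′ (λ _ → 1) 0 (T t)) (map normal (allFin N))  ≡⟨ cong (λ o → maybe′ (λ _ → 1) 0 o + ∑ (λ t → maybe′ (λ _ → 1) 0 (T t)) (map normal (allFin N))) sp ⟨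
            contents (λ _ → 1) T  ≡⟨ stored C (λ _ → 1) ⟩
            ∑ (λ _ → 1) S  ≡⟨ ∑-one S ⟩
            length S  ∎

        -- The residents of normal slots are distinct elements of `S`, so the branching is bounded
        -- by the keys of `S` that probe `t` early, wherever the algorithm has put them. No weight
        -- is below `ℓ₀`, whence the 0.
        degree-backward : ∀ v t → v ≤ D → degree backward v t ≤ (if ℓ₀ ≤ᵇ v then load (v ∸ ℓ₀) S t else 0)
        degree-backward v t v≤D = begin
          degree backward v t  ≡⟨ ∑-cong (allFin N) (λ {s} _ → shift (T (normal s))) ⟩
          ∑ (λ s → maybe′ (λ y → χ (weight y t ≤ᵇ v)) 0 (T (normal s))) (allFin N)  ≤⟨ normal-contents (λ y → χ (weight y t ≤ᵇ v)) ⟩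
          ∑ (λ y → χ (weight y t ≤ᵇ v)) S  ≤⟨ bound ⟩
          (if ℓ₀ ≤ᵇ v then load (v ∸ ℓ₀) S t else 0)  ∎
          where
          open ≤-Reasoning
          shift : ∀ o → χ (maybe′ (λ y → weight y t ≤ᵇ v) false o) ≡ maybe′ (λ y → χ (weight y t ≤ᵇ v)) 0 o
          shift nothing  = refl
          shift (just y) = refl
          each : ∀ y → χ (weight y t ≤ᵇ v) ≤ χ (ℓ₀ ≤ᵇ v) * χ (hits (v ∸ ℓ₀) y t)
          each y with weight y t ≤ᵇ v in e′
          ... | false = z≤n
          ... | true with weight≤⇒ {y} {t} (≤ᵇ-true⁻ {weight y t} e′) (≤-trans (s≤s v≤D) D<Λ)
          ...   | p , q rewrite ≤ᵇ-true p | q = ≤-refl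
          bound : ∑ (λ y → χ (weight y t ≤ᵇ v)) S ≤ (if ℓ₀ ≤ᵇ v then load (v ∸ ℓ₀) S t else 0)
          bound = ≤-trans (∑-mono S (λ {y} _ → each y)) (≤-trans (≤-reflexive (∑-* (χ (ℓ₀ ≤ᵇ v)) _ S)) (fin (ℓ₀ ≤ᵇ v)))
            where
            fin : ∀ b → χ b * load (v ∸ ℓ₀) S t ≤ (if b then load (v ∸ ℓ₀) S t else 0)
            fin true  = ≤-reflexive (+-identityʳ _)
            fin false = z≤n

        insert-gain : ∀ x → x ∉ S → Φ T S + D ≤ Φ (setSlot T special (just x)) (x ∷ S) + D * χ (badInsert x)
        insert-gain x x∉ with Walk.Φ-insert C (λ j s → B.closure j j s ≡ true) base (λ {j} {s} {t} {y} → step {j} {s} {t} {y}) x x∉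
          where
          base : ∀ s → Light T s ⊎ B.closure 0 0 s ≡ true
          base s with T (normal s) in e
          ... | nothing = inj₂ refl
          ... | just y with weight y s ≤ᵇ 32 * D in e′
          ...   | true  = inj₁ (y , refl , ≤ᵇ-true⁻ e′)
          ...   | false = inj₂ refl
          step : ∀ {j s t y} → B.closure j j t ≡ true → T (normal s) ≡ just y → weight y s ≤ 32 * D → weight y t ≤ D →
                 B.closure (j + weight y t) (j + weight y t) s ≡ true
          step {j} {s} {t} {y} p e _ w≤D =
            -- A step adds at least 1 to the weight, so one more step still fits when the step bound
            -- equals the weight bound.
            B.closure-mono {k = suc j} (≤-trans (≤-reflexive (+-comm 1 j)) (+-monoʳ-≤ j (weight≥1 y t))) ≤-refl
              (B.closure-step j {t = t} (weight≥1 y t) w≤D p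
                (subst (λ o → maybe′ (λ y′ → weight y′ t ≤ᵇ weight y t) false o ≡ true) (sym e) (≤ᵇ-true {weight y t} ≤-refl)))
        ... | inj₁ r = ≤-trans r (m≤m+n _ _)
        ... | inj₂ (r , s , j , q , lt) = +-mono-≤ r (≤-reflexive (sym (trans (cong (λ b → D * χ b) bad) (*-identityʳ D))))
          where
          bad : badInsert x ≡ true
          bad = any-intro (λ s → reaching s ∧ (weight x s ≤ᵇ D)) (∈-allFin s)
            (∧-intro (B.closure-mono j≤D j≤D q) (≤ᵇ-true (≤-trans (m≤n+m _ j) (<⇒≤ lt))))
            where
            j≤D : j ≤ D
            j≤D = ≤-trans (m≤m+n j _) (<⇒≤ lt)

        delete-loss : T special ≡ nothing → ∀ y → y ∈ S → Φ T S ≤ Φ (removeKey T y) (without y S) + D * χ (badDelete y)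
        delete-loss sp y y∈ with Walk.Φ-delete C (λ j s → F.closure j j s ≡ true) sp base (λ {j} {s} {t} {y} → step {j} {s} {t} {y}) y y∈
          where
          base : ∀ {s y} → T (normal s) ≡ just y → weight y s ≤ 32 * D ⊎ heavy s ≡ true
          base {s} {y} e with weight y s ≤ᵇ 32 * D in e′
          ... | true  = inj₁ (≤ᵇ-true⁻ e′)
          ... | false = inj₂ (trans (cong (maybe′ (λ y → not (weight y s ≤ᵇ 32 * D)) false) e) (cong not e′))
          step : ∀ {j s t y} → F.closure j j s ≡ true → T (normal s) ≡ just y → weight y t ≤ D →
                 F.closure (j + weight y t) (j + weight y t) t ≡ true
          step {j} {s} {t} {y} p e w≤D =
            F.closure-mono {k = suc j} (≤-trans (≤-reflexive (+-comm 1 j)) (+-monoʳ-≤ j (weight≥1 y t))) ≤-refl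
              (F.closure-step j {t = s} (weight≥1 y t) w≤D p
                (subst (λ o → maybe′ (λ y′ → weight y′ t ≤ᵇ weight y t) false o ≡ true) (sym e) (≤ᵇ-true {weight y t} ≤-refl)))
        ... | inj₁ r = ≤-trans r (m≤m+n _ _)
        ... | inj₂ (r , s , j , e , q , lt) = ≤-trans r (+-monoʳ-≤ (Φ (removeKey T y) (without y S))
                (≤-reflexive (sym (trans (cong (λ b → D * χ b) bad) (*-identityʳ D)))))
          where
          bad : badDelete y ≡ true
          bad = any-intro (λ s → reached s ∧ holds (T (normal s)) y) (∈-allFin s)
            (∧-intro (F.closure-mono (<⇒≤ lt) (<⇒≤ lt) q) (subst (λ o → holds o y ≡ true) (sym e) (≟-refl y)))

        -- A slot holds at most one key, so each reached slot spoils at most one deletion.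
        badDelete-count : ∑ (χ ∘ badDelete) S ≤ size reached
        badDelete-count = begin
          ∑ (χ ∘ badDelete) S  ≤⟨ ∑-mono S (λ {y} _ → χ-any _ (allFin N)) ⟩
          ∑ (λ y → ∑ (λ s → χ (reached s ∧ holds (T (normal s)) y)) (allFin N)) S
            ≡⟨ ∑-swap (λ y s → χ (reached s ∧ holds (T (normal s)) y)) S (allFin N) ⟩
          ∑ (λ s → ∑ (λ y → χ (reached s ∧ holds (T (normal s)) y)) S) (allFin N) ≤⟨ ∑-mono (allFin N) (λ {s} _ → each s) ⟩
          size reached  ∎
          where
          open ≤-Reasoning
          once : ∀ s → ∑ (λ y → χ (holds (T (normal s)) y)) S ≤ 1
          once s with T (normal s) in e
          ... | nothing = ≤-trans (≤-reflexive (∑-zero S)) z≤n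
          ... | just z  = ≤-reflexive (trans (∑-cong S (λ {y} _ → cong χ (≟-sym z y))) (∑-≟ (unique C) (stored⇒∈ C e)))
          each : ∀ s → ∑ (λ y → χ (reached s ∧ holds (T (normal s)) y)) S ≤ χ (reached s)
          each s = begin
            ∑ (λ y → χ (reached s ∧ holds (T (normal s)) y)) S  ≡⟨ ∑-cong S (λ {y} _ → χ-∧ (reached s) _) ⟩
            ∑ (λ y → χ (reached s) * χ (holds (T (normal s)) y)) S  ≡⟨ ∑-* (χ (reached s)) _ S ⟩
            χ (reached s) * ∑ (λ y → χ (holds (T (normal s)) y)) S  ≤⟨ *-monoʳ-≤ (χ (reached s)) (once s) ⟩
            χ (reached s) * 1  ≡⟨ *-identityʳ _ ⟩
            χ (reached s)  ∎

      -- A union bound over the reaching slots: weight at most `D` forces a hit among the first 2^D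
      -- probes, and near uniformity bounds the keys with such a hit.
      badInsert-count : ∀ {n c} → NearlyUniformWith n c h →
                        n * ∑ (χ ∘ badInsert) (allFin U) ≤ size reaching * (c * (2 ^ D) ^ 10 * U)
      badInsert-count {n} {c} nu = begin
        n * ∑ (χ ∘ badInsert) (allFin U)
          ≤⟨ *-monoʳ-≤ n (∑-mono (allFin U) (λ {x} _ → χ-any _ (allFin N))) ⟩
        n * ∑ (λ x → ∑ (λ s → χ (reaching s ∧ (weight x s ≤ᵇ D))) (allFin N)) (allFin U)
          ≡⟨ cong (n *_) (∑-swap (λ x s → χ (reaching s ∧ (weight x s ≤ᵇ D))) (allFin U) (allFin N)) ⟩
        n * ∑ (λ s → ∑ (λ x → χ (reaching s ∧ (weight x s ≤ᵇ D))) (allFin U)) (allFin N)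
          ≤⟨ *-monoʳ-≤ n (∑-mono (allFin N) (λ {s} _ → each s)) ⟩
        n * ∑ (λ s → χ (reaching s) * countB (hitsWithin h (2 ^ D) s)) (allFin N)
          ≡⟨ ∑-* n _ (allFin N) ⟨
        ∑ (λ s → n * (χ (reaching s) * countB (hitsWithin h (2 ^ D) s))) (allFin N)
          ≤⟨ ∑-mono (allFin N) (λ {s} _ → ≤-trans (≤-reflexive (lem n (χ (reaching s)) _))
                (≤-trans (*-monoʳ-≤ (χ (reaching s)) (nu (2 ^ D) s)) (≤-reflexive (*-comm (χ (reaching s)) _)))) ⟩
        ∑ (λ s → c * (2 ^ D) ^ 10 * U * χ (reaching s)) (allFin N)
          ≡⟨ trans (∑-* (c * (2 ^ D) ^ 10 * U) _ (allFin N)) (*-comm (c * (2 ^ D) ^ 10 * U) _) ⟩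
        size reaching * (c * (2 ^ D) ^ 10 * U) ∎
        where
        open ≤-Reasoning
        lem : ∀ n a b → n * (a * b) ≡ a * (n * b)
        lem = solve-∀
        near : ∀ s x → χ (weight x s ≤ᵇ D) ≤ χ (hitsWithin h (2 ^ D) s x)
        near s x with weight x s ≤ᵇ D in e
        ... | false = z≤n
        ... | true rewrite hits-mono {x} {s} (m∸n≤m D ℓ₀) (proj₂ (weight≤⇒ {x} {s} (≤ᵇ-true⁻ {weight x s} e) D<Λ)) = ≤-refl
        each : ∀ s → ∑ (λ x → χ (reaching s ∧ (weight x s ≤ᵇ D))) (allFin U) ≤ χ (reaching s) * countB (hitsWithin h (2 ^ D) s)
        each s = begin
          ∑ (λ x → χ (reaching s ∧ (weight x s ≤ᵇ D))) (allFin U)  ≡⟨ ∑-cong (allFin U) (λ {x} _ → χ-∧ (reaching s) _) ⟩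
          ∑ (λ x → χ (reaching s) * χ (weight x s ≤ᵇ D)) (allFin U)  ≡⟨ ∑-* (χ (reaching s)) _ (allFin U) ⟩
          χ (reaching s) * ∑ (λ x → χ (weight x s ≤ᵇ D)) (allFin U)  ≤⟨ *-monoʳ-≤ (χ (reaching s)) (∑-mono (allFin U) (λ {x} _ → near s x)) ⟩
          χ (reaching s) * countB (hitsWithin h (2 ^ D) s)  ∎

-- The workload as a list of equally likely runs.

take-snoc : {X : Set} (m : ℕ) (xs : List X) {x : X} {ys : List X} →
            drop m xs ≡ x ∷ ys → take (suc m) xs ≡ take m xs ++ [ x ]
take-snoc zero    (x ∷ xs) refl = refl
take-snoc (suc m) (x ∷ xs) e    = cong (x ∷_) (take-snoc m xs e)

drop-replicate : {X : Set} (m k : ℕ) (a : X) (ys : List X) → drop m (replicate (m + k) a ++ ys) ≡ replicate k a ++ ys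
drop-replicate zero    k a ys = refl
drop-replicate (suc m) k a ys = drop-replicate m k a ys

drop-past : {X : Set} (m i : ℕ) (a : X) (ys : List X) → drop (m + i) (replicate m a ++ ys) ≡ drop i ys
drop-past zero    i a ys = refl
drop-past (suc m) i a ys = drop-past m i a ys

drop-pairs : {X : Set} (j k : ℕ) (a b : X) → drop (j * 2) (concat (replicate (j + k) (a ∷ b ∷ []))) ≡ concat (replicate k (a ∷ b ∷ []))
drop-pairs zero    k a b = refl
drop-pairs (suc j) k a b = drop-pairs j k a b

drop-pairs-suc : {X : Set} (j k : ℕ) (a b : X) →
                 drop (suc (j * 2)) (concat (replicate (j + suc k) (a ∷ b ∷ []))) ≡ b ∷ concat (replicate k (a ∷ b ∷ []))
drop-pairs-suc zero    k a b = refl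
drop-pairs-suc (suc j) k a b = drop-pairs-suc j k a b

module _ {U N : ℕ} (A : Algorithm U N) where

  next : Op → List (Config A) → List (Config A)
  next o = concatMap (λ c → branches A c o)

  evolve : List (Config A) → List Op → List (Config A)
  evolve = foldl (λ cs o → next o cs)

  -- `sumAfter` recurses from the first operation to the last, whereas the potential argument needs
  -- the configurations present at a given moment. `evolve` lists them with multiplicity, and both
  -- views give the same sums.
  ∑-evolve : ∀ f os cs → ∑ (sumAfter A os f) cs ≡ ∑ f (evolve cs os)
  ∑-evolve f []       cs = refl
  ∑-evolve f (o ∷ os) cs = trans (sym (∑-concatMap (sumAfter A os f) (λ c → branches A c o) cs)) (∑-evolve f os (next o cs))

  ∑-next-ins : ∀ f b cs → ∑ f (next (op ins b) cs) ≡
    ∑ (λ c → ∑ (λ y → if memberB y (keys c) then 0 else f (insertStep A b c y)) (allFin U)) cs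
  ∑-next-ins f b cs = trans (∑-concatMap f _ cs) (∑-cong cs λ {c} _ →
      trans (∑-concatMap f _ (allFin U)) (∑-cong (allFin U) λ {y} _ → each c y))
    where
    each : ∀ c y → ∑ f (if memberB y (keys c) then [] else insertStep A b c y ∷ []) ≡
                   (if memberB y (keys c) then 0 else f (insertStep A b c y))
    each c y with memberB y (keys c)
    ... | true  = refl
    ... | false = +-identityʳ _

  ∑-next-del : ∀ f b cs → ∑ f (next (op del b) cs) ≡ ∑ (λ c → ∑ (λ y → f (deleteStep A b c y)) (keys c)) cs
  ∑-next-del f b cs = trans (∑-concatMap f _ cs) (∑-cong cs λ {c} _ → ∑-map f (deleteStep A b c) (keys c))

  record Good (k : ℕ) (c : Config A) : Set where
    field
      consistent    : Consistent (tab c) (keys c)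
      size-keys     : length (keys c) ≡ k
      special-empty : tab c special ≡ nothing

  open Good public

  fresh-count : ∀ {k c} → Good k c → ∑ (λ y → χ (not (memberB y (keys c)))) (allFin U) + k ≡ U
  fresh-count {k} {c} g = begin
    ∑ (λ y → χ (not (memberB y (keys c)))) (allFin U) + k
      ≡⟨ cong (∑ (λ y → χ (not (memberB y (keys c)))) (allFin U) +_) (trans (sym (size-keys g)) (sym (∑-memberB (unique (consistent g))))) ⟩
    ∑ (λ y → χ (not (memberB y (keys c)))) (allFin U) + ∑ (λ y → χ (memberB y (keys c))) (allFin U)
      ≡⟨ ∑-+ _ _ (allFin U) ⟨
    ∑ (λ y → χ (not (memberB y (keys c))) + χ (memberB y (keys c))) (allFin U)
      ≡⟨ ∑-cong (allFin U) (λ {y} _ → trans (+-comm (χ (not (memberB y (keys c)))) _) (χ-not (memberB y (keys c)))) ⟩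
    ∑ (λ _ → 1) (allFin U)
      ≡⟨ trans (∑-one (allFin U)) (length-allFin U) ⟩
    U ∎
    where open ≡-Reasoning

  AllGood : ℕ → List (Config A) → Set
  AllGood k cs = ∀ {c} → c ∈ cs → Good k c

  SpecialFree : List (Config A) → Set
  SpecialFree cs = ∀ {c} → c ∈ cs → tab c special ≡ nothing

  good-ins : ∀ {k b cs} → AllGood k cs → SpecialFree (next (op ins b) cs) → AllGood (suc k) (next (op ins b) cs)
  good-ins {k} {b} {cs} good free {c′} c′∈ with find (∈-concatMap⁻ (λ c → branches A c (op ins b)) {xs = cs} c′∈)
  ... | c , c∈ , q with find (∈-concatMap⁻ (λ y → if memberB y (keys c) then [] else insertStep A b c y ∷ []) {xs = allFin U} q)
  ...   | y , _ , r with memberB y (keys c) in e | r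
  ...     | false | here refl = record
    { consistent = consistent-moves (proj₂ (onInsert A (mem c) _ y))
                     (consistent-insert (special-empty (good c∈)) (λ y∈ → false≢true (trans (sym e) (∈⇒memberB y∈))) (consistent (good c∈)))
    ; size-keys = cong suc (size-keys (good c∈))
    ; special-empty = free c′∈ }

  good-del : ∀ {k b cs} → AllGood (suc k) cs → SpecialFree (next (op del b) cs) → AllGood k (next (op del b) cs)
  good-del {k} {b} {cs} good free {c′} c′∈ with find (∈-concatMap⁻ (λ c → branches A c (op del b)) {xs = cs} c′∈)
  ... | c , c∈ , q with ∈-map⁻ (deleteStep A b c) q
  ...   | y , y∈ , refl = record
    { consistent = consistent-moves (proj₂ (onDelete A (mem c) _ y)) (consistent-delete y (consistent (good c∈)))
    ; size-keys = suc-injective (begin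
        suc (length (without y (keys c)))  ≡⟨ +-comm 1 _ ⟩
        length (without y (keys c)) + 1  ≡⟨ cong (_+ 1) (∑-one (without y (keys c))) ⟨
        ∑ (λ _ → 1) (without y (keys c)) + 1  ≡⟨ ∑-without (λ _ → 1) (unique (consistent (good c∈))) y∈ ⟩
        ∑ (λ _ → 1) (keys c)  ≡⟨ ∑-one (keys c) ⟩
        length (keys c)  ≡⟨ size-keys (good c∈) ⟩
        suc k  ∎)
    ; special-empty = free c′∈ }
    where open ≡-Reasoning

  -- All configurations of one moment store equally many keys and hence have equally many
  -- successors. Therefore a sum divided by the length of the list is the true expectation.
  length-next-ins : ∀ {k b cs} → AllGood k cs → length (next (op ins b) cs) + k * length cs ≡ U * length cs
  length-next-ins {k} {b} {cs} good = begin
    length (next (op ins b) cs) + k * length cs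
      ≡⟨ cong (_+ k * length cs) (trans (sym (∑-one (next (op ins b) cs))) (∑-next-ins (λ _ → 1) b cs)) ⟩
    ∑ (λ c → ∑ (λ y → if memberB y (keys c) then 0 else 1) (allFin U)) cs + k * length cs
      ≡⟨ cong (∑ (λ c → ∑ (λ y → if memberB y (keys c) then 0 else 1) (allFin U)) cs +_) (trans (*-comm k _) (sym (∑-const k cs))) ⟩
    ∑ (λ c → ∑ (λ y → if memberB y (keys c) then 0 else 1) (allFin U)) cs + ∑ (λ _ → k) cs
      ≡⟨ ∑-+ _ _ cs ⟨
    ∑ (λ c → ∑ (λ y → if memberB y (keys c) then 0 else 1) (allFin U) + k) cs
      ≡⟨ ∑-cong cs (λ {c} c∈ → trans (cong (_+ k) (∑-cong (allFin U) (λ {y} _ → flip (memberB y (keys c))))) (fresh-count (good c∈))) ⟩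
    ∑ (λ _ → U) cs
      ≡⟨ trans (∑-const U cs) (*-comm (length cs) U) ⟩
    U * length cs ∎
    where
    open ≡-Reasoning
    flip : ∀ b → (if b then 0 else 1) ≡ χ (not b)
    flip true  = refl
    flip false = refl

  length-next-del : ∀ {k b cs} → AllGood k cs → length (next (op del b) cs) ≡ k * length cs
  length-next-del {k} {b} {cs} good = begin
    length (next (op del b) cs)  ≡⟨ trans (sym (∑-one (next (op del b) cs))) (∑-next-del (λ _ → 1) b cs) ⟩
    ∑ (λ c → ∑ (λ _ → 1) (keys c)) cs  ≡⟨ ∑-cong cs (λ {c} c∈ → trans (∑-one (keys c)) (size-keys (good c∈))) ⟩
    ∑ (λ _ → k) cs  ≡⟨ trans (∑-const k cs) (*-comm (length cs) k) ⟩
    k * length cs  ∎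
    where open ≡-Reasoning

  module Run (p : ℕ) (valid-on : ValidOn A (suc p)) where

    n : ℕ
    n = suc p

    abstract
      runs : ℕ → List (Config A)
      runs m = evolve (config₀ A ∷ []) (take m (schedule A n))

      sumAt≡∑ : ∀ m f → sumAt A n m f ≡ ∑ f (runs m)
      sumAt≡∑ m f = trans (sym (+-identityʳ _)) (∑-evolve f (take m (schedule A n)) (config₀ A ∷ []))

      runs-suc : ∀ m {o os} → drop m (schedule A n) ≡ o ∷ os → runs (suc m) ≡ next o (runs m)
      runs-suc m {o} e = trans (cong (evolve (config₀ A ∷ [])) (take-snoc m (schedule A n) e))
                               (foldl-∷ʳ (λ cs o → next o cs) (config₀ A ∷ []) o (take m (schedule A n)))

      runs-zero : runs 0 ≡ config₀ A ∷ []
      runs-zero = refl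

    runs-init : ∀ m → m < n → runs (suc m) ≡ next (op ins false) (runs m)
    runs-init m m<n with m≤n⇒∃[o]m+o≡n m<n
    ... | k , eq = runs-suc m (trans (cong (λ i → drop m (replicate i (op ins false) ++ workload)) (trans (sym eq) (sym (+-suc m k))))
                                     (drop-replicate m (suc k) (op ins false) workload))
      where
      workload : List Op
      workload = concat (replicate (n * n) (op del true ∷ op ins true ∷ []))

    runs-del : ∀ j → j < n * n → runs (suc (n + j * 2)) ≡ next (op del true) (runs (n + j * 2))
    runs-del j j<n² with m≤n⇒∃[o]m+o≡n j<n²
    ... | k , eq = runs-suc (n + j * 2) (trans (drop-past n (j * 2) (op ins false) _)
      (trans (cong (λ i → drop (j * 2) (concat (replicate i (op del true ∷ op ins true ∷ [])))) (trans (sym eq) (sym (+-suc j k))))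
             (drop-pairs j (suc k) (op del true) (op ins true))))

    runs-ins : ∀ j → j < n * n → runs (n + suc j * 2) ≡ next (op ins true) (runs (suc (n + j * 2)))
    runs-ins j j<n² with m≤n⇒∃[o]m+o≡n j<n²
    ... | k , eq = trans (cong runs shift) (runs-suc (suc (n + j * 2)) (trans (cong (λ i → drop i (schedule A n)) (sym (+-suc n (j * 2))))
      (trans (drop-past n (suc (j * 2)) (op ins false) _)
      (trans (cong (λ i → drop (suc (j * 2)) (concat (replicate i (op del true ∷ op ins true ∷ [])))) (trans (sym eq) (sym (+-suc j k))))
             (drop-pairs-suc j k (op del true) (op ins true))))))
      where
      shift : n + suc j * 2 ≡ suc (suc (n + j * 2))
      shift = trans (+-suc n (suc (j * 2))) (cong suc (+-suc n (j * 2)))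

    -- A sum of naturals that vanishes has only zero terms; this turns validity from a statement
    -- about sums into one about every single run.
    special-free : ∀ m → m ≤ n + 2 * (n * n) → SpecialFree (runs m)
    special-free m le {c} c∈ with tab c special in e
    ... | nothing = refl
    ... | just x with ≤-trans (≤-reflexive (sym (cong (maybe′ (λ _ → 1) 0) e)))
                        (≤-trans (∑-∈ (specialOccupied A) c∈) (≤-reflexive (trans (sym (sumAt≡∑ m (specialOccupied A))) (valid-on m le))))
    ...   | ()

    good-init : ∀ m → m ≤ n → AllGood m (runs m)
    good-init zero    _   c∈ with subst (_ ∈_) runs-zero c∈
    ... | here refl = record { consistent = consistent-empty ; size-keys = refl ; special-empty = refl }
    good-init (suc m) m<n rewrite runs-init m m<n =
      good-ins (good-init m (<⇒≤ m<n)) (subst SpecialFree (runs-init m m<n) (special-free (suc m) (≤-trans m<n (m≤m+n n _))))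

    time≤ : ∀ {i} → i ≤ n * n → n + i * 2 ≤ n + 2 * (n * n)
    time≤ {i} i≤ = +-monoʳ-≤ n (≤-trans (*-monoˡ-≤ 2 i≤) (≤-reflexive (*-comm (n * n) 2)))

    good-full : ∀ j → j ≤ n * n → AllGood n (runs (n + j * 2))
    good-less : ∀ j → j < n * n → AllGood p (runs (suc (n + j * 2)))

    good-full zero    _    = subst (λ m → AllGood n (runs m)) (sym (+-identityʳ n)) (good-init n ≤-refl)
    good-full (suc j) j<n² = subst (AllGood n) (sym (runs-ins j j<n²))
      (good-ins (good-less j j<n²) (subst SpecialFree (runs-ins j j<n²) (special-free _ (time≤ j<n²))))

    good-less j j<n² = subst (AllGood p) (sym (runs-del j j<n²))
      (good-del (good-full j (<⇒≤ j<n²)) (subst SpecialFree (runs-del j j<n²) (special-free _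
        (≤-trans (≤-trans (n≤1+n _) (≤-reflexive (sym (trans (+-suc n (suc (j * 2))) (cong suc (+-suc n (j * 2))))))) (time≤ j<n²)))))

-- Elementary inequalities for powers.

^-distribʳ-* : ∀ m a b → (a * b) ^ m ≡ a ^ m * b ^ m
^-distribʳ-* zero    a b = refl
^-distribʳ-* (suc m) a b = trans (cong (a * b *_) (^-distribʳ-* m a b)) (lem a b (a ^ m) (b ^ m))
  where
  lem : ∀ a b x y → a * b * (x * y) ≡ a * x * (b * y)
  lem = solve-∀

-- (1 − 1/(n+1))^h ≥ 1 − h/(n+1), cleared of denominators, with n + 1 = h + d.
bernoulli-inv : ∀ n h d → suc n ≡ h + d → suc n ^ h * d ≤ n ^ h * suc n
bernoulli-inv n zero    d e = ≤-reflexive (trans (+-identityʳ d) (trans (sym e) (sym (+-identityʳ (suc n)))))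
bernoulli-inv n (suc h) d e = *-cancelʳ-≤ _ _ (suc d) (begin
  suc n * suc n ^ h * d * suc d  ≡⟨ lem₁ (suc n) (suc n ^ h) d (suc d) ⟩
  suc n * d * (suc n ^ h * suc d)  ≤⟨ *-mono-≤ small (bernoulli-inv n h (suc d) (trans e (sym (+-suc h d)))) ⟩
  n * suc d * (n ^ h * suc n)  ≡⟨ lem₂ n (suc d) (n ^ h) (suc n) ⟩
  n * n ^ h * suc n * suc d  ∎)
  where
  open ≤-Reasoning
  lem₁ : ∀ a b c d → a * b * c * d ≡ a * c * (b * d)
  lem₁ = solve-∀
  lem₂ : ∀ a b c d → a * b * (c * d) ≡ a * c * d * b
  lem₂ = solve-∀
  small : suc n * d ≤ n * suc d
  small = begin
    d + n * d  ≤⟨ +-monoˡ-≤ (n * d) (≤-pred (≤-trans (s≤s (m≤n+m d h)) (≤-reflexive (sym e)))) ⟩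
    n + n * d  ≡⟨ *-suc n d ⟨
    n * suc d  ∎

-- For h at most (n+1)/2 the preceding bound gives (1 - 1/(n+1))^h ≥ 1/2; this is its reciprocal.
half-power : ∀ n h → h + h ≤ suc n → suc n ^ h ≤ 2 * n ^ h
half-power n h 2h≤ = *-cancelʳ-≤ _ _ (suc n) (begin
  suc n ^ h * suc n  ≤⟨ *-monoʳ-≤ (suc n ^ h) (+-cancelˡ-≤ (h + h) _ _ big) ⟩
  suc n ^ h * (2 * d)  ≡⟨ lem (suc n ^ h) d ⟩
  2 * (suc n ^ h * d)  ≤⟨ *-monoʳ-≤ 2 (bernoulli-inv n h d (sym (m+[n∸m]≡n h≤))) ⟩
  2 * (n ^ h * suc n)  ≡⟨ *-assoc 2 (n ^ h) _ ⟨
  2 * n ^ h * suc n  ∎)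
  where
  open ≤-Reasoning
  h≤ : h ≤ suc n
  h≤ = ≤-trans (m≤m+n h h) 2h≤
  d = suc n ∸ h
  lem : ∀ a b → a * (2 * b) ≡ 2 * (a * b)
  lem = solve-∀
  lem′ : ∀ a b → a + b + (a + b) ≡ a + a + 2 * b
  lem′ = solve-∀
  big : h + h + suc n ≤ h + h + 2 * d
  big = begin
    h + h + suc n  ≤⟨ +-monoˡ-≤ (suc n) 2h≤ ⟩
    suc n + suc n  ≡⟨ cong₂ _+_ (m+[n∸m]≡n h≤) (m+[n∸m]≡n h≤) ⟨
    h + d + (h + d)  ≡⟨ lem′ h d ⟩
    h + h + 2 * d  ∎

suc-power : ∀ n → 1 ≤ n → suc n ^ n ≤ 8 * n ^ n
suc-power n 1≤n = begin
  suc n ^ n  ≡⟨ cong (suc n ^_) (sym split) ⟩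
  suc n ^ (h + h′)  ≡⟨ ^-distribˡ-+-* (suc n) h h′ ⟩
  suc n ^ h * suc n ^ h′  ≤⟨ *-mono-≤ (half-power n h (≤-trans (+-monoʳ-≤ h h≤h′) (≤-trans (≤-reflexive split) (n≤1+n n)))) (half-power n h′ 2h′≤) ⟩
  2 * n ^ h * (2 * n ^ h′)  ≡⟨ lem (n ^ h) (n ^ h′) ⟩
  4 * (n ^ h * n ^ h′)  ≤⟨ *-monoˡ-≤ (n ^ h * n ^ h′) (m≤m+n 4 4) ⟩
  8 * (n ^ h * n ^ h′)  ≡⟨ cong (8 *_) (^-distribˡ-+-* n h h′) ⟨
  8 * n ^ (h + h′)  ≡⟨ cong (λ i → 8 * n ^ i) split ⟩
  8 * n ^ n  ∎
  where
  open ≤-Reasoning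
  h = ⌊ n /2⌋
  h′ = ⌈ n /2⌉
  split : h + h′ ≡ n
  split = ⌊n/2⌋+⌈n/2⌉≡n n
  h≤h′ : h ≤ h′
  h≤h′ = ⌊n/2⌋≤⌈n/2⌉ n
  2h′≤ : h′ + h′ ≤ suc n
  2h′≤ = begin
    h′ + h′  ≤⟨ +-monoˡ-≤ h′ (⌊n/2⌋-mono (n≤1+n (suc n))) ⟩
    ⌊ suc (suc n) /2⌋ + h′  ≡⟨ cong suc split ⟩
    suc n  ∎
  lem : ∀ a b → 2 * a * (2 * b) ≡ 4 * (a * b)
  lem = solve-∀

-- Bernoulli's inequality 1 + a/n ≤ (1 + 1/n)^a, cleared of denominators.
+-power : ∀ n a → (n + a) * n ^ a ≤ n * suc n ^ a
+-power n zero    = ≤-reflexive (cong (_* 1) (+-identityʳ n))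
+-power n (suc a) = begin
  (n + suc a) * (n * n ^ a)  ≡⟨ lem n a (n ^ a) ⟩
  n * ((n + a) * n ^ a) + n * n ^ a  ≤⟨ +-mono-≤ (*-monoʳ-≤ n (+-power n a)) (*-monoʳ-≤ n (^-monoˡ-≤ a (n≤1+n n))) ⟩
  n * (n * suc n ^ a) + n * suc n ^ a  ≡⟨ lem′ n (suc n ^ a) ⟩
  n * (suc n * suc n ^ a)  ∎
  where
  open ≤-Reasoning
  lem : ∀ n a x → (n + suc a) * (n * x) ≡ n * ((n + a) * x) + n * x
  lem = solve-∀
  lem′ : ∀ n x → n * (n * x) + n * x ≡ n * (suc n * x)
  lem′ = solve-∀

-- A substitute for (1 + a/n)^n ≤ e^a: by Bernoulli the left side is at most (1 + 1/n)^(na). It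
-- controls the exponential moment during the n initial insertions.
growth : ∀ n a → 1 ≤ n → (n + a) ^ n ≤ 8 ^ a * n ^ n
growth n@(suc _) a 1≤n = *-cancelʳ-≤ _ _ ((n ^ a) ^ n) {{m^n≢0 (n ^ a) n {{m^n≢0 n a}}}} (begin
  (n + a) ^ n * (n ^ a) ^ n  ≡⟨ ^-distribʳ-* n (n + a) (n ^ a) ⟨
  ((n + a) * n ^ a) ^ n  ≤⟨ ^-monoˡ-≤ n (+-power n a) ⟩
  (n * suc n ^ a) ^ n  ≡⟨ ^-distribʳ-* n n (suc n ^ a) ⟩
  n ^ n * (suc n ^ a) ^ n  ≡⟨ cong (n ^ n *_) (swap (suc n) a n) ⟩
  n ^ n * (suc n ^ n) ^ a  ≤⟨ *-monoʳ-≤ (n ^ n) (^-monoˡ-≤ a (suc-power n 1≤n)) ⟩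
  n ^ n * (8 * n ^ n) ^ a  ≡⟨ cong (n ^ n *_) (^-distribʳ-* a 8 (n ^ n)) ⟩
  n ^ n * (8 ^ a * (n ^ n) ^ a)  ≡⟨ cong (λ x → n ^ n * (8 ^ a * x)) (swap n n a) ⟩
  n ^ n * (8 ^ a * (n ^ a) ^ n)  ≡⟨ lem (n ^ n) (8 ^ a) ((n ^ a) ^ n) ⟩
  8 ^ a * n ^ n * (n ^ a) ^ n  ∎)
  where
  open ≤-Reasoning
  swap : ∀ b x y → (b ^ x) ^ y ≡ (b ^ y) ^ x
  swap b x y = trans (^-*-assoc b x y) (trans (cong (b ^_) (*-comm x y)) (sym (^-*-assoc b y x)))
  lem : ∀ a b c → a * (b * c) ≡ b * a * c
  lem = solve-∀

-- The exponential moment of the load of a slot along the workload.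

module Drift {U N : ℕ} (A : Algorithm U N) (p : ℕ) (valid-on : ValidOn A (suc p)) (2n≤U : 2 * suc p ≤ U)
             (hit : Fin U → Bool) (H : ℕ) (hit-count : suc p * ∑ (χ ∘ hit) (allFin U) ≤ H * U) where

  open Run A p valid-on

  -- A fresh key hits with probability at most `a / n`; the factor 2 pays for the stored keys being
  -- excluded from the choice. `K` will bound the mean of 2^load at all times from the end of the
  -- initialization on.
  a K : ℕ
  a = 2 * H
  K = 2 * 2 ^ (4 * a)

  hit-load : List (Fin U) → ℕ
  hit-load S = ∑ (χ ∘ hit) S

  z : Config A → ℕ
  z c = 2 ^ hit-load (keys c)

  fresh≥half : ∀ {r k} → r + k ≡ U → k ≤ n → U ≤ 2 * r
  fresh≥half {r} {k} e k≤n = +-cancelʳ-≤ (2 * k) _ _ (begin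
    U + 2 * k  ≤⟨ +-monoʳ-≤ U (≤-trans (*-monoʳ-≤ 2 k≤n) 2n≤U) ⟩
    U + U  ≡⟨ cong₂ _+_ e e ⟨
    r + k + (r + k)  ≡⟨ lem r k ⟩
    2 * r + 2 * k  ∎)
    where
    open ≤-Reasoning
    lem : ∀ r k → r + k + (r + k) ≡ 2 * r + 2 * k
    lem = solve-∀

  length-ins : ∀ {r k b cs} → r + k ≡ U → AllGood A k cs → length (next A (op ins b) cs) ≡ r * length cs
  length-ins {r} {k} {b} {cs} e good = +-cancelʳ-≡ (k * length cs) _ _
    (trans (length-next-ins A good) (trans (cong (_* length cs) (sym e)) (*-distribʳ-+ (length cs) r k)))

  -- A hit doubles `z` and has probability at most a/n, so the mean grows at most by the factor 1 +
  -- a/n.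
  drift-ins : ∀ {r k b cs} → r + k ≡ U → k ≤ n → AllGood A k cs →
              n * ∑ z (next A (op ins b) cs) ≤ r * (n + a) * ∑ z cs
  drift-ins {r} {k} {b} {cs} e k≤n good = begin
    n * ∑ z (next A (op ins b) cs)  ≡⟨ cong (n *_) (∑-next-ins A z b cs) ⟩
    n * ∑ (λ c → ∑ (λ y → if memberB y (keys c) then 0 else 2 ^ (χ (hit y) + hit-load (keys c))) (allFin U)) cs
                                                                ≡⟨ ∑-* n _ cs ⟨
    ∑ (λ c → n * ∑ (λ y → if memberB y (keys c) then 0 else 2 ^ (χ (hit y) + hit-load (keys c))) (allFin U)) cs
                                                                ≤⟨ ∑-mono cs (λ {c} c∈ → each c (good c∈)) ⟩
    ∑ (λ c → r * (n + a) * z c) cs  ≡⟨ ∑-* (r * (n + a)) z cs ⟩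
    r * (n + a) * ∑ z cs  ∎
    where
    open ≤-Reasoning
    each : ∀ c → Good A k c → n * ∑ (λ y → if memberB y (keys c) then 0 else 2 ^ (χ (hit y) + hit-load (keys c))) (allFin U) ≤ r * (n + a) * z c
    each c g = begin
      n * ∑ (λ y → if memberB y (keys c) then 0 else 2 ^ (χ (hit y) + hit-load (keys c))) (allFin U)
        ≤⟨ *-monoʳ-≤ n (∑-mono (allFin U) (λ {y} _ → one (memberB y (keys c)) (hit y))) ⟩
      n * ∑ (λ y → z c * (χ (not (memberB y (keys c))) + χ (hit y))) (allFin U)
        ≡⟨ cong (n *_) (trans (∑-* (z c) _ (allFin U)) (cong (z c *_) (∑-+ _ _ (allFin U)))) ⟩
      n * (z c * (∑ (λ y → χ (not (memberB y (keys c)))) (allFin U) + ∑ (χ ∘ hit) (allFin U)))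
        ≡⟨ cong (λ i → n * (z c * (i + ∑ (χ ∘ hit) (allFin U)))) (+-cancelʳ-≡ k _ _ (trans (fresh-count A g) (sym e))) ⟩
      n * (z c * (r + ∑ (χ ∘ hit) (allFin U)))
        ≡⟨ lem₁ n (z c) r _ ⟩
      z c * (r * n + n * ∑ (χ ∘ hit) (allFin U))
        ≤⟨ *-monoʳ-≤ (z c) (+-monoʳ-≤ (r * n) (≤-trans hit-count (*-monoʳ-≤ H (fresh≥half e k≤n)))) ⟩
      z c * (r * n + H * (2 * r))
        ≡⟨ lem₂ (z c) r n H ⟩
      r * (n + a) * z c ∎
      where
      lem₁ : ∀ n z r s → n * (z * (r + s)) ≡ z * (r * n + n * s)
      lem₁ = solve-∀
      lem₂ : ∀ z r n h → z * (r * n + h * (2 * r)) ≡ r * (n + 2 * h) * z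
      lem₂ = solve-∀
      one : ∀ m b → (if m then 0 else 2 ^ (χ b + hit-load (keys c))) ≤ z c * (χ (not m) + χ b)
      one true  b     = z≤n
      one false true  = ≤-reflexive (*-comm 2 (z c))
      one false false = ≤-reflexive (sym (*-identityʳ (z c)))

  -- A random deletion halves `z` with probability load/n, so the mean loses the share load/(2n). If
  -- the load is at least 4a, this share is at least 2a/n. Otherwise `z` is at most 2^(4a) = K/2,
  -- and the additive term covers the missing loss.
  drift-del : ∀ {b cs} → AllGood A n cs →
              2 * ∑ z (next A (op del b) cs) + 4 * a * ∑ z cs ≤ 2 * n * ∑ z cs + 2 * a * K * length cs
  drift-del {b} {cs} good = begin
    2 * ∑ z (next A (op del b) cs) + 4 * a * ∑ z cs
      ≡⟨ cong₂ _+_ (trans (cong (2 *_) (∑-next-del A z b cs)) (sym (∑-* 2 _ cs))) (sym (∑-* (4 * a) z cs)) ⟩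
    ∑ (λ c → 2 * ∑ (λ y → 2 ^ hit-load (without y (keys c))) (keys c)) cs + ∑ (λ c → 4 * a * z c) cs
      ≡⟨ ∑-+ _ _ cs ⟨
    ∑ (λ c → 2 * ∑ (λ y → 2 ^ hit-load (without y (keys c))) (keys c) + 4 * a * z c) cs
      ≤⟨ ∑-mono cs (λ {c} c∈ → each c (good c∈)) ⟩
    ∑ (λ c → 2 * n * z c + 2 * a * K) cs
      ≡⟨ trans (∑-+ _ _ cs) (cong₂ _+_ (∑-* (2 * n) z cs) (trans (∑-const (2 * a * K) cs) (*-comm (length cs) _))) ⟩
    2 * n * ∑ z cs + 2 * a * K * length cs ∎
    where
    open ≤-Reasoning
    each : ∀ c → Good A n c → 2 * ∑ (λ y → 2 ^ hit-load (without y (keys c))) (keys c) + 4 * a * z c ≤ 2 * n * z c + 2 * a * K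
    each c g = begin
      2 * ∑ (λ y → 2 ^ hit-load (without y S)) S + 4 * a * z c  ≤⟨ +-monoʳ-≤ _ (cap (≤-total (4 * a) (hit-load S))) ⟩
      2 * ∑ (λ y → 2 ^ hit-load (without y S)) S + (hit-load S * z c + 2 * a * K)
        ≡⟨ cong₂ (λ u v → u + (v + 2 * a * K)) (sym (∑-* 2 _ S)) (trans (*-comm (hit-load S) (z c)) (sym (∑-* (z c) (χ ∘ hit) S))) ⟩
      ∑ (λ y → 2 * 2 ^ hit-load (without y S)) S + (∑ (λ y → z c * χ (hit y)) S + 2 * a * K)
        ≡⟨ +-assoc (∑ (λ y → 2 * 2 ^ hit-load (without y S)) S) _ _ ⟨
      ∑ (λ y → 2 * 2 ^ hit-load (without y S)) S + ∑ (λ y → z c * χ (hit y)) S + 2 * a * K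
        ≡⟨ cong (_+ 2 * a * K) (∑-+ _ _ S) ⟨
      ∑ (λ y → 2 * 2 ^ hit-load (without y S) + z c * χ (hit y)) S + 2 * a * K
        ≡⟨ cong (_+ 2 * a * K) (∑-cong S λ {y} y∈ → one y (∑-without (χ ∘ hit) (unique (consistent g)) y∈)) ⟩
      ∑ (λ _ → 2 * z c) S + 2 * a * K
        ≡⟨ cong (_+ 2 * a * K) (trans (∑-const (2 * z c) S) (trans (cong (_* (2 * z c)) (size-keys g)) (lem n (z c)))) ⟩
      2 * n * z c + 2 * a * K ∎
      where
      S = keys c
      lem : ∀ n z → n * (2 * z) ≡ 2 * n * z
      lem = solve-∀
      lem₃ : ∀ a k → 4 * a * k ≡ 2 * a * (2 * k)
      lem₃ = solve-∀
      cap : 4 * a ≤ hit-load S ⊎ hit-load S ≤ 4 * a → 4 * a * z c ≤ hit-load S * z c + 2 * a * K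
      cap (inj₁ le) = ≤-trans (*-monoˡ-≤ (z c) le) (m≤m+n _ _)
      cap (inj₂ le) = ≤-trans (*-monoʳ-≤ (4 * a) (^-monoʳ-≤ 2 le))
                        (≤-trans (≤-reflexive (lem₃ a (2 ^ (4 * a)))) (m≤n+m _ _))
      lem₁ : ∀ x → 2 * x + 2 * x * 1 ≡ 2 * (2 * x)
      lem₁ = solve-∀
      one : ∀ y → hit-load (without y S) + χ (hit y) ≡ hit-load S →
            2 * 2 ^ hit-load (without y S) + z c * χ (hit y) ≡ 2 * z c
      one y eq with hit y
      ... | true  = trans (cong (λ i → 2 * 2 ^ hit-load (without y S) + 2 ^ i * 1) eq′)
                      (trans (lem₁ (2 ^ hit-load (without y S))) (cong (λ i → 2 * 2 ^ i) (sym eq′)))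
        where
        eq′ : hit-load S ≡ suc (hit-load (without y S))
        eq′ = trans (sym eq) (+-comm _ 1)
      ... | false = trans (cong (2 * 2 ^ hit-load (without y S) +_) (*-zeroʳ (z c)))
                      (trans (+-identityʳ _) (cong (λ i → 2 * 2 ^ i) (trans (sym (+-identityʳ _)) eq)))

  z-init : ∀ m → m ≤ n → n ^ m * ∑ z (runs m) ≤ (n + a) ^ m * length (runs m)
  z-init zero    _   rewrite runs-zero = ≤-refl
  z-init (suc m) m<n = begin
    n * n ^ m * ∑ z (runs (suc m))  ≡⟨ cong (λ cs → n * n ^ m * ∑ z cs) (runs-init m m<n) ⟩
    n * n ^ m * ∑ z (next A (op ins false) (runs m))  ≡⟨ lem₁ n (n ^ m) _ ⟩
    n ^ m * (n * ∑ z (next A (op ins false) (runs m)))  ≤⟨ *-monoʳ-≤ (n ^ m) (drift-ins e (<⇒≤ m<n) (good-init m (<⇒≤ m<n))) ⟩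
    n ^ m * (r * (n + a) * ∑ z (runs m))  ≡⟨ lem₂ (n ^ m) (r * (n + a)) _ ⟩
    r * (n + a) * (n ^ m * ∑ z (runs m))  ≤⟨ *-monoʳ-≤ (r * (n + a)) (z-init m (<⇒≤ m<n)) ⟩
    r * (n + a) * ((n + a) ^ m * length (runs m))  ≡⟨ lem₃ r (n + a) ((n + a) ^ m) _ ⟩
    (n + a) * (n + a) ^ m * (r * length (runs m))  ≡⟨ cong ((n + a) * (n + a) ^ m *_) (length-ins e (good-init m (<⇒≤ m<n))) ⟨
    (n + a) * (n + a) ^ m * length (next A (op ins false) (runs m))  ≡⟨ cong (λ cs → (n + a) * (n + a) ^ m * length cs) (runs-init m m<n) ⟨
    (n + a) * (n + a) ^ m * length (runs (suc m))  ∎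
    where
    open ≤-Reasoning
    r = U ∸ m
    e : r + m ≡ U
    e = m∸n+n≡m (≤-trans (<⇒≤ m<n) (≤-trans (m≤m+n n _) 2n≤U))
    lem₁ : ∀ a b c → a * b * c ≡ b * (a * c)
    lem₁ = solve-∀
    lem₂ : ∀ a b c → a * (b * c) ≡ b * (a * c)
    lem₂ = solve-∀
    lem₃ : ∀ r b c d → r * b * (c * d) ≡ b * c * (r * d)
    lem₃ = solve-∀

  module _ (2a≤n : 2 * a ≤ n) where

    -- If the mean is at most `K`, a deletion brings it below (1 - a/n) K, and the next insertion
    -- multiplies by at most 1 + a/n. The product 1 - a²/n² does not exceed 1, so the bound `K`
    -- persists.
    z-full : ∀ j → j ≤ n * n → ∑ z (runs (n + j * 2)) ≤ K * length (runs (n + j * 2))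
    z-pair : ∀ j → j < n * n → ∃ λ d → n ≡ 2 * a + d × ∑ z (runs (suc (n + j * 2))) ≤ (d + a) * (K * length (runs (n + j * 2)))

    z-full zero _ = subst (λ m → ∑ z (runs m) ≤ K * length (runs m)) (sym (+-identityʳ n))
      (*-cancelˡ-≤ (n ^ n) {{m^n≢0 n n}} (begin
        n ^ n * ∑ z (runs n)  ≤⟨ z-init n ≤-refl ⟩
        (n + a) ^ n * length (runs n)  ≤⟨ *-monoˡ-≤ (length (runs n)) (growth n a (s≤s z≤n)) ⟩
        8 ^ a * n ^ n * length (runs n)  ≤⟨ *-monoˡ-≤ (length (runs n)) (*-monoˡ-≤ (n ^ n) 8^a≤K) ⟩
        K * n ^ n * length (runs n)  ≡⟨ lem K (n ^ n) _ ⟩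
        n ^ n * (K * length (runs n))  ∎))
      where
      open ≤-Reasoning
      lem : ∀ a b c → a * b * c ≡ b * (a * c)
      lem = solve-∀
      8^a≤K : 8 ^ a ≤ K
      8^a≤K = begin
        8 ^ a  ≤⟨ ^-monoˡ-≤ a (m≤m+n 8 8) ⟩
        16 ^ a  ≡⟨ ^-*-assoc 2 4 a ⟩
        2 ^ (4 * a)  ≤⟨ m≤m+n _ _ ⟩
        K  ∎
    z-full (suc j) j<n² with z-pair j j<n²
    ... | d , n≡ , le = *-cancelˡ-≤ n (begin
      n * ∑ z (runs (n + suc j * 2))  ≡⟨ cong (λ cs → n * ∑ z cs) (runs-ins j j<n²) ⟩
      n * ∑ z (next A (op ins true) (runs (suc (n + j * 2))))  ≤⟨ drift-ins e (n≤1+n p) (good-less j j<n²) ⟩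
      r * (n + a) * ∑ z (runs (suc (n + j * 2)))  ≤⟨ *-monoʳ-≤ (r * (n + a)) le ⟩
      r * (n + a) * ((d + a) * (K * R))  ≡⟨ cong (λ i → r * (i + a) * ((d + a) * (K * R))) n≡ ⟩
      -- Here n = 2a + d, so d + a is n - a, and adding a² completes (n + a)(n - a) to n².
      r * (2 * a + d + a) * ((d + a) * (K * R))  ≤⟨ m≤m+n _ (r * (a * a) * (K * R)) ⟩
      r * (2 * a + d + a) * ((d + a) * (K * R)) + r * (a * a) * (K * R) ≡⟨ lem r a d (K * R) ⟩
      (2 * a + d) * ((2 * a + d) * (r * (K * R)))  ≡⟨ cong (λ i → i * (i * (r * (K * R)))) n≡ ⟨
      n * (n * (r * (K * R)))  ≡⟨ lem′ n r K R ⟩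
      n * (K * (r * (n * R)))  ≡⟨ cong (λ i → n * (K * (r * i))) (trans (cong length (runs-del j j<n²)) (length-next-del A (good-full j (<⇒≤ j<n²)))) ⟨
      n * (K * (r * length (runs (suc (n + j * 2)))))  ≡⟨ cong (λ i → n * (K * i)) (trans (cong length (runs-ins j j<n²)) (length-ins e (good-less j j<n²))) ⟨
      n * (K * length (runs (n + suc j * 2)))  ∎)
      where
      open ≤-Reasoning
      r = U ∸ p
      R = length (runs (n + j * 2))
      e : r + p ≡ U
      e = m∸n+n≡m (≤-trans (n≤1+n p) (≤-trans (m≤m+n n _) 2n≤U))
      lem : ∀ r a d k → r * (2 * a + d + a) * ((d + a) * k) + r * (a * a) * k ≡ (2 * a + d) * ((2 * a + d) * (r * k))
      lem = solve-∀
      lem′ : ∀ n r k s → n * (n * (r * (k * s))) ≡ n * (k * (r * (n * s)))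
      lem′ = solve-∀
    z-pair j j<n² with m≤n⇒∃[o]m+o≡n 2a≤n
    ... | d , eq = d , sym eq , *-cancelˡ-≤ 2 (+-cancelʳ-≤ (4 * a * Z) _ _ (begin
      2 * ∑ z (runs (suc (n + j * 2))) + 4 * a * Z  ≡⟨ cong (λ cs → 2 * ∑ z cs + 4 * a * Z) (runs-del j j<n²) ⟩
      2 * ∑ z (next A (op del true) (runs (n + j * 2))) + 4 * a * Z ≤⟨ drift-del (good-full j (<⇒≤ j<n²)) ⟩
      2 * n * Z + 2 * a * K * R  ≡⟨ cong (λ i → 2 * i * Z + 2 * a * K * R) (sym eq) ⟩
      2 * (2 * a + d) * Z + 2 * a * K * R  ≡⟨ lem a d Z K R ⟩
      2 * d * Z + 2 * a * (K * R) + 4 * a * Z  ≤⟨ +-monoˡ-≤ (4 * a * Z) (+-monoˡ-≤ (2 * a * (K * R)) (*-monoʳ-≤ (2 * d) (z-full j (<⇒≤ j<n²)))) ⟩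
      2 * d * (K * R) + 2 * a * (K * R) + 4 * a * Z  ≡⟨ cong (_+ 4 * a * Z) (lem′ d a (K * R)) ⟩
      2 * ((d + a) * (K * R)) + 4 * a * Z  ∎))
      where
      open ≤-Reasoning
      Z = ∑ z (runs (n + j * 2))
      R = length (runs (n + j * 2))
      lem : ∀ a d z k r → 2 * (2 * a + d) * z + 2 * a * k * r ≡ 2 * d * z + 2 * a * (k * r) + 4 * a * z
      lem = solve-∀
      lem′ : ∀ d a k → 2 * d * k + 2 * a * k ≡ 2 * ((d + a) * k)
      lem′ = solve-∀

    z-less : ∀ j → j < n * n → ∑ z (runs (suc (n + j * 2))) ≤ K * length (runs (suc (n + j * 2)))
    z-less j j<n² = conclude (z-pair j j<n²)
      where
      R R′ Z : ℕ
      R  = length (runs (n + j * 2))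
      R′ = length (runs (suc (n + j * 2)))
      Z  = ∑ z (runs (suc (n + j * 2)))
      count : R′ ≡ n * R
      count = trans (cong length (runs-del j j<n²)) (length-next-del A (good-full j (<⇒≤ j<n²)))
      combine : ∀ {x R′ d a k n R} → n ≡ 2 * a + d → R′ ≡ n * R → x ≤ (d + a) * (k * R) → x ≤ k * R′
      combine {x} {_} {d} {a} {k} {_} {R} refl refl le = ≤-trans le (≤-trans (m≤m+n _ (a * (k * R))) (≤-reflexive (lem d a k R)))
        where
        lem : ∀ d a k r → (d + a) * (k * r) + a * (k * r) ≡ k * ((2 * a + d) * r)
        lem = solve-∀
      conclude : (∃ λ d → n ≡ 2 * a + d × Z ≤ (d + a) * (K * R)) → Z ≤ K * R′
      conclude (d , n≡ , le) = combine {d = d} {a = a} {k = K} {R = R} n≡ count le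

-- Rarity of exceptional operations, and the drift of the potential at one scale.

n<2^n : ∀ n → n < 2 ^ n
n<2^n zero    = s≤s z≤n
n<2^n (suc n) = begin-strict
  1 + n  <⟨ +-mono-≤-< (m^n>0 2 n) (n<2^n n) ⟩
  2 ^ n + 2 ^ n  ≡⟨ cong (2 ^ n +_) (+-identityʳ _) ⟨
  2 * 2 ^ n  ∎
  where open ≤-Reasoning

n≤2^n : ∀ n → n ≤ 2 ^ n
n≤2^n n = <⇒≤ (n<2^n n)

-- The link from the exponential moment to crowded slots: the mean surplus over b is at most 2^(-b)
-- times the mean of 2^x.
excess≤power : ∀ b x → 2 ^ b * (x ∸ b) ≤ 2 ^ x
excess≤power zero    x       = ≤-trans (≤-reflexive (+-identityʳ x)) (n≤2^n x)
excess≤power (suc b) zero    = ≤-trans (≤-reflexive (*-zeroʳ (2 ^ suc b))) z≤n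
excess≤power (suc b) (suc x) = ≤-trans (≤-reflexive (*-assoc 2 (2 ^ b) (x ∸ b))) (*-monoʳ-≤ 2 (excess≤power b x))

-- In these parameters 2^L stands for 1/ε, 2^q for the allowed probe complexity and `suc p` for n.
-- `holes` bounds the free slots between a deletion and the following insertion, hence `N ∸ p`.
module ScaleBounds {U N : ℕ} (h : ProbeSeq U N) (Λ ℓ₀ : ℕ) (ℓ₀≥1 : 1 ≤ ℓ₀)
  (A : Algorithm U N) (p : ℕ) (valid-on : ValidOn A (suc p)) (2n≤U : 2 * suc p ≤ U)
  (c : ℕ) (c≥1 : 1 ≤ c) (uniform : NearlyUniformWith (suc p) c h)
  (κ Cp q L : ℕ) (probe-bounded : ProbeBoundedOn A h (suc p) (Cp * 2 ^ q))
  (2^L≤n : 2 ^ L ≤ suc p) (holes : 2 ^ L * (N ∸ p) ≤ κ * suc p) (N≤ : N ≤ κ * suc p)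
  (ℓ₀-large : 8 * c + 1 + L ≤ 2 ^ ℓ₀)
  (D : ℕ) (D≥1 : 1 ≤ D) (D<Λ : D < Λ) (ℓ₀≤D : ℓ₀ ≤ D) (q≤D : q ≤ D) (64D≤L : 64 * D ≤ L)
  (D-large : 32 * c * (κ + Cp + κ) ≤ 2 ^ D) (D-large′ : 16 * Cp ≤ 2 ^ D) (D-large″ : 4 * c ≤ 2 ^ D) where

  open Run A p valid-on
  open Weights h Λ ℓ₀ ℓ₀≥1
  open Scale D D≥1 D<Λ ℓ₀≤D

  rate : ℕ → ℕ
  rate ℓ = c * (2 ^ ℓ) ^ 10

  -- Chosen so that 2^threshold is 2^L times the bound `K` on the exponential moment of the load at
  -- this rate. The mean surplus per slot is then at most 2^(-L).
  threshold : ℕ → ℕ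
  threshold ℓ = 4 * (2 * rate ℓ) + 1 + L

  cap : ℕ → ℕ
  cap v = if ℓ₀ ≤ᵇ v then threshold (v ∸ ℓ₀) else 0

  pow-10 : ∀ ℓ → (2 ^ ℓ) ^ 10 ≡ 2 ^ (10 * ℓ)
  pow-10 ℓ = trans (^-*-assoc 2 ℓ 10) (cong (2 ^_) (*-comm ℓ 10))

  D≤L : D ≤ L
  D≤L = ≤-trans (m≤n*m D 64) 64D≤L

  -- Each of 2, `D` and `8 * c + 1 + L` is at most 2^ℓ₀. Three such factors and the 2^(10ℓ) of near
  -- uniformity fit into 2^(12v), because v = ℓ₀ + ℓ.
  cap-small : ∀ v → 1 ≤ v → v ≤ D → 2 * D * cap v ≤ 2 ^ (12 * v)
  cap-small v _ v≤D with ℓ₀ ≤ᵇ v in e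
  ... | false = ≤-trans (≤-reflexive (*-zeroʳ (2 * D))) z≤n
  ... | true  = begin
    2 * D * threshold ℓ  ≤⟨ *-mono-≤ (*-monoʳ-≤ 2 (≤-trans D≤L (≤-trans (m≤n+m L _) ℓ₀-large))) threshold≤ ⟩
    2 * 2 ^ ℓ₀ * (2 ^ ℓ₀ * 2 ^ (10 * ℓ))  ≤⟨ *-monoˡ-≤ _ (*-monoˡ-≤ (2 ^ ℓ₀) (^-monoʳ-≤ 2 ℓ₀≥1)) ⟩
    2 ^ ℓ₀ * 2 ^ ℓ₀ * (2 ^ ℓ₀ * 2 ^ (10 * ℓ))  ≡⟨ cong₂ _*_ (sym (^-distribˡ-+-* 2 ℓ₀ ℓ₀)) (sym (^-distribˡ-+-* 2 ℓ₀ (10 * ℓ))) ⟩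
    2 ^ (ℓ₀ + ℓ₀) * 2 ^ (ℓ₀ + 10 * ℓ)  ≡⟨ ^-distribˡ-+-* 2 (ℓ₀ + ℓ₀) _ ⟨
    2 ^ (ℓ₀ + ℓ₀ + (ℓ₀ + 10 * ℓ))  ≤⟨ ^-monoʳ-≤ 2 (≤-trans (m≤m+n (ℓ₀ + ℓ₀ + (ℓ₀ + 10 * ℓ)) (9 * ℓ₀ + 2 * ℓ)) (≤-reflexive (lem ℓ₀ ℓ))) ⟩
    2 ^ (12 * (ℓ₀ + ℓ))  ≡⟨ cong (λ i → 2 ^ (12 * i)) (m+[n∸m]≡n (≤ᵇ-true⁻ {ℓ₀} e)) ⟩
    2 ^ (12 * v)  ∎
    where
    open ≤-Reasoning
    ℓ = v ∸ ℓ₀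
    lem : ∀ a b → a + a + (a + 10 * b) + (9 * a + 2 * b) ≡ 12 * (a + b)
    lem = solve-∀
    lem′ : ∀ c L x → 4 * (2 * (c * x)) + (1 + L) * x ≡ (8 * c + 1 + L) * x
    lem′ = solve-∀
    threshold≤ : threshold ℓ ≤ 2 ^ ℓ₀ * 2 ^ (10 * ℓ)
    threshold≤ = begin
      4 * (2 * (c * (2 ^ ℓ) ^ 10)) + 1 + L  ≡⟨ trans (cong (λ x → 4 * (2 * (c * x)) + 1 + L) (pow-10 ℓ)) (+-assoc _ 1 L) ⟩
      4 * (2 * (c * 2 ^ (10 * ℓ))) + (1 + L)  ≤⟨ +-monoʳ-≤ _ (m≤m*n (1 + L) (2 ^ (10 * ℓ)) {{m^n≢0 2 (10 * ℓ)}}) ⟩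
      4 * (2 * (c * 2 ^ (10 * ℓ))) + (1 + L) * 2 ^ (10 * ℓ) ≡⟨ lem′ c L (2 ^ (10 * ℓ)) ⟩
      (8 * c + 1 + L) * 2 ^ (10 * ℓ)  ≤⟨ *-monoˡ-≤ _ ℓ₀-large ⟩
      2 ^ ℓ₀ * 2 ^ (10 * ℓ)  ∎

  -- This is the condition `2 * a ≤ n` under which the bound on the exponential moment persists.
  rate-small : ∀ ℓ → ℓ ≤ D → 2 * (2 * rate ℓ) ≤ suc p
  rate-small ℓ ℓ≤D = begin
    2 * (2 * (c * (2 ^ ℓ) ^ 10))  ≡⟨ trans (cong (λ x → 2 * (2 * (c * x))) (pow-10 ℓ)) (lem c _) ⟩
    4 * c * 2 ^ (10 * ℓ)  ≤⟨ *-mono-≤ D-large″ (^-monoʳ-≤ 2 (*-monoʳ-≤ 10 ℓ≤D)) ⟩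
    2 ^ D * 2 ^ (10 * D)  ≡⟨ ^-distribˡ-+-* 2 D (10 * D) ⟨
    2 ^ (11 * D)  ≤⟨ ^-monoʳ-≤ 2 (≤-trans (*-monoˡ-≤ D (m≤m+n 11 53)) 64D≤L) ⟩
    2 ^ L  ≤⟨ 2^L≤n ⟩
    suc p  ∎
    where
    open ≤-Reasoning
    lem : ∀ c x → 2 * (2 * (c * x)) ≡ 4 * c * x
    lem = solve-∀

  overload : ℕ → Config A → ℕ
  overload v s = ∑ (λ t → load (v ∸ ℓ₀) (keys s) t ∸ threshold (v ∸ ℓ₀)) (allFin N)

  excess-backward : ∀ {k s} → Good A k s → ∀ v → v ≤ D → excess (State.backward (tab s)) cap v ≤ overload v s
  excess-backward {s = s} g v v≤D = ∑-mono (allFin N) λ {t} _ →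
    ≤-trans (∸-monoˡ-≤ (cap v) (State.degree-backward (tab s) (consistent g) v t v≤D)) (gate (ℓ₀ ≤ᵇ v) _ _)
    where
    gate : ∀ b x y → (if b then x else 0) ∸ (if b then y else 0) ≤ x ∸ y
    gate true  x y = ≤-refl
    gate false x y = z≤n

  excess-forward : ∀ (T : Table U N) v → v ≤ D → excess (State.forward T) cap v ≡ 0
  excess-forward T v v≤D = trans (∑-cong (allFin N) λ {t} _ →
      m≤n⇒m∸n≡0 (≤-trans (State.degree-forward T v t v≤D) (gate (ℓ₀ ≤ᵇ v)))) (∑-zero (allFin N))
    where
    gate : ∀ b → (if b then 2 ^ (v ∸ ℓ₀) else 0) ≤ (if b then threshold (v ∸ ℓ₀) else 0)
    gate false = z≤n
    gate true  = begin
      2 ^ ℓ  ≤⟨ ≤-trans (≤-reflexive (sym (*-identityʳ _))) (*-monoʳ-≤ (2 ^ ℓ) (m^n>0 (2 ^ ℓ) {{m^n≢0 2 ℓ}} 9)) ⟩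
      (2 ^ ℓ) ^ 10  ≤⟨ m≤n*m _ c {{>-nonZero c≥1}} ⟩
      rate ℓ  ≤⟨ m≤n*m _ 2 ⟩
      2 * rate ℓ  ≤⟨ m≤n*m _ 4 ⟩
      4 * (2 * rate ℓ)  ≤⟨ ≤-trans (m≤m+n _ 1) (m≤m+n _ L) ⟩
      threshold ℓ  ∎
      where
      open ≤-Reasoning
      ℓ = v ∸ ℓ₀

  module _ (cs : List (Config A)) where

    R : ℕ
    R = length cs

    overload-total : ∀ v → v ≤ D →
      (∀ t → ∑ (λ s → 2 ^ load (v ∸ ℓ₀) (keys s) t) cs ≤ 2 * 2 ^ (4 * (2 * rate (v ∸ ℓ₀))) * R) →
      2 ^ L * ∑ (overload v) cs ≤ N * R
    overload-total v v≤D drift = *-cancelˡ-≤ K {{>-nonZero (≤-trans (m^n>0 2 (4 * (2 * rate ℓ))) (m≤m+n _ _))}} (begin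
      K * (2 ^ L * ∑ (overload v) cs)
        ≡⟨ trans (sym (*-assoc K (2 ^ L) _)) (cong (_* ∑ (overload v) cs) (sym power)) ⟩
      2 ^ threshold ℓ * ∑ (overload v) cs
        ≡⟨ trans (cong (2 ^ threshold ℓ *_) (∑-swap (λ s t → load ℓ (keys s) t ∸ threshold ℓ) cs (allFin N))) (sym (∑-* (2 ^ threshold ℓ) _ (allFin N))) ⟩
      ∑ (λ t → 2 ^ threshold ℓ * ∑ (λ s → load ℓ (keys s) t ∸ threshold ℓ) cs) (allFin N)
        ≤⟨ ∑-mono (allFin N) (λ {t} _ → ≤-trans (≤-reflexive (sym (∑-* (2 ^ threshold ℓ) _ cs)))
             (≤-trans (∑-mono cs (λ {s} _ → excess≤power (threshold ℓ) (load ℓ (keys s) t))) (drift t))) ⟩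
      ∑ (λ _ → K * R) (allFin N)
        ≡⟨ trans (∑-const (K * R) (allFin N)) (cong (_* (K * R)) (length-allFin N)) ⟩
      N * (K * R)
        ≡⟨ lem N K R ⟩
      K * (N * R) ∎)
      where
      open ≤-Reasoning
      ℓ = v ∸ ℓ₀
      K = 2 * 2 ^ (4 * (2 * rate ℓ))
      power : 2 ^ threshold ℓ ≡ K * 2 ^ L
      power = trans (^-distribˡ-+-* 2 (4 * (2 * rate ℓ) + 1) L)
                (cong (_* 2 ^ L) (cong (2 ^_) (+-comm (4 * (2 * rate ℓ)) 1)))
      lem : ∀ a b c → a * (b * c) ≡ b * (a * c)
      lem = solve-∀

    heavyTotal vacantTotal overloadTotal reachingTotal reachedTotal : ℕ
    heavyTotal    = ∑ (λ s → size (State.heavy (tab s))) cs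
    vacantTotal   = ∑ (λ s → size (State.vacant (tab s))) cs
    overloadTotal = ∑ (λ s → ∑ (λ v → overload v s) (upTo₁ D)) cs
    reachingTotal = ∑ (λ s → size (State.reaching (tab s))) cs
    reachedTotal  = ∑ (λ s → size (State.reached (tab s))) cs

    -- Markov's inequality: a heavy key has probe complexity at least 2^(31D), while the mean is at
    -- most Cp 2^q with q ≤ D.
    heavy-total : ∀ {k} → k ≤ suc p → AllGood A k cs →
                  ∑ (λ s → pcSum h (2 ^ (31 * D)) (tab s)) cs ≤ Cp * 2 ^ q * ∑ (length ∘ keys) cs →
                  2 ^ (30 * D) * heavyTotal ≤ Cp * (suc p * R)
    heavy-total {k} k≤n good bounded = *-cancelˡ-≤ (2 ^ D) {{m^n≢0 2 D}} (begin
      2 ^ D * (2 ^ (30 * D) * heavyTotal)  ≡⟨ trans (sym (*-assoc (2 ^ D) _ _)) (cong (_* heavyTotal) (sym (^-distribˡ-+-* 2 D (30 * D)))) ⟩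
      2 ^ (31 * D) * heavyTotal  ≡⟨ ∑-* (2 ^ (31 * D)) _ cs ⟨
      ∑ (λ s → 2 ^ (31 * D) * size (State.heavy (tab s))) cs  ≤⟨ ∑-mono cs (λ {s} _ → ≤-trans (≤-reflexive (*-comm (2 ^ (31 * D)) _)) (State.heavy-cost (tab s))) ⟩
      ∑ (λ s → pcSum h (2 ^ (31 * D)) (tab s)) cs  ≤⟨ bounded ⟩
      Cp * 2 ^ q * ∑ (length ∘ keys) cs  ≤⟨ *-mono-≤ (*-monoʳ-≤ Cp (^-monoʳ-≤ 2 q≤D)) (∑-mono cs (λ s∈ → ≤-trans (≤-reflexive (size-keys (good s∈))) k≤n)) ⟩
      Cp * 2 ^ D * ∑ (λ _ → suc p) cs  ≡⟨ cong (Cp * 2 ^ D *_) (trans (∑-const (suc p) cs) (*-comm R (suc p))) ⟩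
      Cp * 2 ^ D * (suc p * R)  ≡⟨ lem Cp (2 ^ D) _ ⟩
      2 ^ D * (Cp * (suc p * R))  ∎)
      where
      open ≤-Reasoning
      lem : ∀ a b c → a * b * c ≡ b * (a * c)
      lem = solve-∀

    reached-total : reachedTotal ≤ 2 * (2 ^ (12 * D) * heavyTotal)
    reached-total = begin
      reachedTotal  ≤⟨ ∑-mono cs (λ {s} _ → each s) ⟩
      ∑ (λ s → 2 * (2 ^ (12 * D) * size (State.heavy (tab s)))) cs  ≡⟨ trans (∑-* 2 _ cs) (cong (2 *_) (∑-* (2 ^ (12 * D)) _ cs)) ⟩
      2 * (2 ^ (12 * D) * heavyTotal)  ∎
      where
      open ≤-Reasoning
      each : ∀ s → size (State.reached (tab s)) ≤ 2 * (2 ^ (12 * D) * size (State.heavy (tab s)))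
      each s = ≤-trans (State.F.Bound.closure-size (tab s) cap D≥1 cap-small D D)
        (≤-reflexive (cong (λ x → 2 * (2 ^ (12 * D) * x)) (trans (cong (size (State.heavy (tab s)) +_)
          (trans (∑-cong (upTo₁ D) (λ {v} v∈ → excess-forward (tab s) v (proj₂ (∈-upTo₁⁻ v∈)))) (∑-zero (upTo₁ D)))) (+-identityʳ _))))

    reaching-total : ∀ {k} → AllGood A k cs → reachingTotal ≤ 2 * (2 ^ (12 * D) * (vacantTotal + heavyTotal + overloadTotal))
    reaching-total good = begin
      reachingTotal  ≤⟨ ∑-mono cs (λ {s} s∈ → each s (good s∈)) ⟩
      ∑ (λ s → 2 * (2 ^ (12 * D) * (size (State.vacant (tab s)) + size (State.heavy (tab s)) + ∑ (λ v → overload v s) (upTo₁ D)))) cs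
        ≡⟨ trans (∑-* 2 _ cs) (cong (2 *_) (trans (∑-* (2 ^ (12 * D)) _ cs) (cong (2 ^ (12 * D) *_)
             (trans (∑-+ _ _ cs) (cong (_+ overloadTotal) (∑-+ _ _ cs)))))) ⟩
      2 * (2 ^ (12 * D) * (vacantTotal + heavyTotal + overloadTotal))  ∎
      where
      open ≤-Reasoning
      each : ∀ {k} s → Good A k s → size (State.reaching (tab s)) ≤
             2 * (2 ^ (12 * D) * (size (State.vacant (tab s)) + size (State.heavy (tab s)) + ∑ (λ v → overload v s) (upTo₁ D)))
      each s g = ≤-trans (State.B.Bound.closure-size (tab s) cap D≥1 cap-small D D)
        (*-monoʳ-≤ 2 (*-monoʳ-≤ (2 ^ (12 * D)) (+-mono-≤
          (≤-trans (∑-mono (allFin N) (λ {t} _ → χ-∨ (State.vacant (tab s) t) _)) (≤-reflexive (∑-+ _ _ (allFin N))))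
          (∑-mono (upTo₁ D) (λ {v} v∈ → excess-backward g v (proj₂ (∈-upTo₁⁻ v∈)))))))

    vacant-total : AllGood A p cs → 2 ^ (30 * D) * vacantTotal ≤ κ * (suc p * R)
    vacant-total good = begin
      2 ^ (30 * D) * vacantTotal  ≤⟨ *-mono-≤ (^-monoʳ-≤ 2 (≤-trans (*-monoˡ-≤ D (m≤m+n 30 34)) 64D≤L)) (∑-mono cs (λ {s} s∈ → ≤-reflexive (each (good s∈)))) ⟩
      2 ^ L * ∑ (λ _ → N ∸ p) cs  ≡⟨ cong (2 ^ L *_) (trans (∑-const (N ∸ p) cs) (*-comm R _)) ⟩
      2 ^ L * ((N ∸ p) * R)  ≡⟨ *-assoc (2 ^ L) _ R ⟨
      2 ^ L * (N ∸ p) * R  ≤⟨ *-monoˡ-≤ R holes ⟩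
      κ * suc p * R  ≡⟨ *-assoc κ (suc p) R ⟩
      κ * (suc p * R)  ∎
      where
      open ≤-Reasoning
      each : ∀ {s} → Good A p s → size (State.vacant (tab s)) ≡ N ∸ p
      each {s} g = trans (sym (m+n∸n≡m _ p)) (cong (_∸ p)
        (trans (cong (size (State.vacant (tab s)) +_) (sym (size-keys g))) (State.vacant-count (tab s) (consistent g) (special-empty g))))

    overloads-total : (∀ v → v ≤ D → 2 ^ L * ∑ (overload v) cs ≤ N * R) → 2 ^ (30 * D) * overloadTotal ≤ κ * (suc p * R)
    overloads-total each = *-cancelˡ-≤ (2 ^ D) {{m^n≢0 2 D}} (begin
      2 ^ D * (2 ^ (30 * D) * overloadTotal)  ≡⟨ trans (sym (*-assoc (2 ^ D) _ _)) (cong (_* overloadTotal) (sym (^-distribˡ-+-* 2 D (30 * D)))) ⟩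
      2 ^ (31 * D) * overloadTotal  ≤⟨ *-monoˡ-≤ overloadTotal (^-monoʳ-≤ 2 (≤-trans (*-monoˡ-≤ D (m≤m+n 31 33)) 64D≤L)) ⟩
      2 ^ L * overloadTotal  ≡⟨ cong (2 ^ L *_) (∑-swap (λ s v → overload v s) cs (upTo₁ D)) ⟩
      2 ^ L * ∑ (λ v → ∑ (overload v) cs) (upTo₁ D)  ≡⟨ ∑-* (2 ^ L) _ (upTo₁ D) ⟨
      ∑ (λ v → 2 ^ L * ∑ (overload v) cs) (upTo₁ D)  ≤⟨ ∑-mono (upTo₁ D) (λ {v} v∈ → each v (proj₂ (∈-upTo₁⁻ v∈))) ⟩
      ∑ (λ _ → N * R) (upTo₁ D)  ≡⟨ trans (∑-const (N * R) (upTo₁ D)) (cong (_* (N * R)) (length-upTo₁ D)) ⟩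
      D * (N * R)  ≤⟨ *-mono-≤ (n≤2^n D) (*-monoˡ-≤ R N≤) ⟩
      2 ^ D * (κ * suc p * R)  ≡⟨ cong (2 ^ D *_) (*-assoc κ (suc p) R) ⟩
      2 ^ D * (κ * (suc p * R))  ∎)
      where open ≤-Reasoning

    badDeletes badInserts : ℕ
    badDeletes = ∑ (λ s → ∑ (χ ∘ State.badDelete (tab s)) (keys s)) cs
    badInserts = ∑ (λ s → ∑ (χ ∘ State.badInsert (tab s)) (allFin U)) cs

    -- Chains multiply the heavy slots by 2 · 2^(12D), and 2^D absorbs the constant; the resulting
    -- 2^(13D) is beaten by the density 2^(-30D) of heavy keys.
    few-bad-deletes : ∀ {k} → AllGood A k cs → 2 ^ (30 * D) * heavyTotal ≤ Cp * (suc p * R) →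
                      8 * badDeletes ≤ suc p * R
    few-bad-deletes good heavy≤ = *-cancelˡ-≤ (2 ^ (30 * D)) {{m^n≢0 2 (30 * D)}} (begin
      2 ^ (30 * D) * (8 * badDeletes)  ≤⟨ *-monoʳ-≤ (2 ^ (30 * D)) (*-monoʳ-≤ 8 (≤-trans (∑-mono cs (λ {s} s∈ → State.badDelete-count (tab s) (consistent (good s∈)))) reached-total)) ⟩
      2 ^ (30 * D) * (8 * (2 * (2 ^ (12 * D) * heavyTotal)))  ≡⟨ lem (2 ^ (30 * D)) (2 ^ (12 * D)) heavyTotal ⟩
      16 * 2 ^ (12 * D) * (2 ^ (30 * D) * heavyTotal)  ≤⟨ *-monoʳ-≤ (16 * 2 ^ (12 * D)) heavy≤ ⟩
      16 * 2 ^ (12 * D) * (Cp * (suc p * R))  ≡⟨ lem′ (2 ^ (12 * D)) Cp (suc p * R) ⟩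
      16 * Cp * 2 ^ (12 * D) * (suc p * R)  ≤⟨ *-monoˡ-≤ (suc p * R) (*-monoˡ-≤ (2 ^ (12 * D)) D-large′) ⟩
      2 ^ D * 2 ^ (12 * D) * (suc p * R)  ≡⟨ cong (_* (suc p * R)) (^-distribˡ-+-* 2 D (12 * D)) ⟨
      2 ^ (13 * D) * (suc p * R)  ≤⟨ *-monoˡ-≤ (suc p * R) (^-monoʳ-≤ 2 (*-monoˡ-≤ D (m≤m+n 13 17))) ⟩
      2 ^ (30 * D) * (suc p * R)  ∎)
      where
      open ≤-Reasoning
      lem : ∀ a b x → a * (8 * (2 * (b * x))) ≡ 16 * b * (a * x)
      lem = solve-∀
      lem′ : ∀ b c x → 16 * b * (c * x) ≡ 16 * c * b * x
      lem′ = solve-∀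

    -- Chains contribute 2^(12D), the early probes of a random key 2^(10D) and the constants 2^D.
    -- This 2^(23D) is beaten by the density 2^(-30D) that holds for vacant slots, heavy keys and
    -- overload alike.
    few-bad-inserts : ∀ {r} → U ≤ 2 * r → AllGood A p cs →
                      2 ^ (30 * D) * heavyTotal ≤ Cp * (suc p * R) → 2 ^ (30 * D) * overloadTotal ≤ κ * (suc p * R) →
                      8 * badInserts ≤ r * R
    few-bad-inserts {r} U≤2r good heavy≤ overload≤ = *-cancelˡ-≤ (2 ^ (30 * D) * suc p) {{m*n≢0 _ (suc p) {{m^n≢0 2 (30 * D)}}}} (begin
      2 ^ (30 * D) * suc p * (8 * badInserts)
        ≡⟨ lem₀ (2 ^ (30 * D)) (suc p) badInserts ⟩
      8 * 2 ^ (30 * D) * (suc p * badInserts)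
        ≤⟨ *-monoʳ-≤ (8 * 2 ^ (30 * D)) counted-bad ⟩
      8 * 2 ^ (30 * D) * (c * (2 ^ D) ^ 10 * U * reachingTotal)
        ≤⟨ *-monoʳ-≤ (8 * 2 ^ (30 * D)) (*-mono-≤ (*-mono-≤ (≤-reflexive (cong (c *_) (pow-10 D))) U≤2r) (reaching-total good)) ⟩
      8 * 2 ^ (30 * D) * (c * 2 ^ (10 * D) * (2 * r) * (2 * (2 ^ (12 * D) * Gs)))
        ≡⟨ lem₁ (2 ^ (30 * D)) (2 ^ (10 * D)) (2 ^ (12 * D)) c r Gs ⟩
      32 * c * (2 ^ (10 * D) * 2 ^ (12 * D)) * r * (2 ^ (30 * D) * Gs)
        ≤⟨ *-monoʳ-≤ (32 * c * (2 ^ (10 * D) * 2 ^ (12 * D)) * r) Gs≤ ⟩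
      32 * c * (2 ^ (10 * D) * 2 ^ (12 * D)) * r * ((κ + Cp + κ) * (suc p * R))
        ≡⟨ lem₂ c (2 ^ (10 * D) * 2 ^ (12 * D)) r (κ + Cp + κ) (suc p) R ⟩
      32 * c * (κ + Cp + κ) * (2 ^ (10 * D) * 2 ^ (12 * D)) * (suc p * (r * R))
        ≤⟨ *-monoˡ-≤ (suc p * (r * R)) (*-monoˡ-≤ (2 ^ (10 * D) * 2 ^ (12 * D)) D-large) ⟩
      2 ^ D * (2 ^ (10 * D) * 2 ^ (12 * D)) * (suc p * (r * R))
        ≡⟨ cong (_* (suc p * (r * R))) (trans (cong (2 ^ D *_) (sym (^-distribˡ-+-* 2 (10 * D) (12 * D)))) (sym (^-distribˡ-+-* 2 D _))) ⟩
      2 ^ (D + (10 * D + 12 * D)) * (suc p * (r * R))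
        ≤⟨ *-monoˡ-≤ (suc p * (r * R)) (^-monoʳ-≤ 2 (≤-trans (m≤m+n (D + (10 * D + 12 * D)) (7 * D)) (≤-reflexive (lem₃ D)))) ⟩
      2 ^ (30 * D) * (suc p * (r * R))
        ≡⟨ *-assoc (2 ^ (30 * D)) (suc p) _ ⟨
      2 ^ (30 * D) * suc p * (r * R) ∎)
      where
      open ≤-Reasoning
      Gs : ℕ
      Gs = vacantTotal + heavyTotal + overloadTotal
      lem₀ : ∀ a n b → a * n * (8 * b) ≡ 8 * a * (n * b)
      lem₀ = solve-∀
      lem₁ : ∀ a b d c r g → 8 * a * (c * b * (2 * r) * (2 * (d * g))) ≡ 32 * c * (b * d) * r * (a * g)
      lem₁ = solve-∀
      lem₂ : ∀ c b r m n s → 32 * c * b * r * (m * (n * s)) ≡ 32 * c * m * b * (n * (r * s))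
      lem₂ = solve-∀
      lem₃ : ∀ d → d + (10 * d + 12 * d) + 7 * d ≡ 30 * d
      lem₃ = solve-∀
      Gs≤ : 2 ^ (30 * D) * Gs ≤ (κ + Cp + κ) * (suc p * R)
      Gs≤ = begin
        2 ^ (30 * D) * Gs
          ≡⟨ trans (*-distribˡ-+ (2 ^ (30 * D)) (vacantTotal + heavyTotal) overloadTotal) (cong (_+ 2 ^ (30 * D) * overloadTotal) (*-distribˡ-+ (2 ^ (30 * D)) vacantTotal heavyTotal)) ⟩
        2 ^ (30 * D) * vacantTotal + 2 ^ (30 * D) * heavyTotal + 2 ^ (30 * D) * overloadTotal
          ≤⟨ +-mono-≤ (+-mono-≤ (vacant-total good) heavy≤) overload≤ ⟩
        κ * (suc p * R) + Cp * (suc p * R) + κ * (suc p * R)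
          ≡⟨ trans (cong (_+ κ * (suc p * R)) (sym (*-distribʳ-+ (suc p * R) κ Cp))) (sym (*-distribʳ-+ (suc p * R) (κ + Cp) κ)) ⟩
        (κ + Cp + κ) * (suc p * R) ∎
      counted-bad : suc p * badInserts ≤ c * (2 ^ D) ^ 10 * U * reachingTotal
      counted-bad = begin
        suc p * badInserts  ≡⟨ ∑-* (suc p) _ cs ⟨
        ∑ (λ s → suc p * ∑ (χ ∘ State.badInsert (tab s)) (allFin U)) cs  ≤⟨ ∑-mono cs (λ {s} _ → ≤-trans (State.badInsert-count (tab s) {suc p} {c} uniform) (≤-reflexive (*-comm (size (State.reaching (tab s))) _))) ⟩
        ∑ (λ s → c * (2 ^ D) ^ 10 * U * size (State.reaching (tab s))) cs  ≡⟨ ∑-* (c * (2 ^ D) ^ 10 * U) _ cs ⟩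
        c * (2 ^ D) ^ 10 * U * reachingTotal  ∎

  time-del : ∀ {j} → j < suc p * suc p → suc (j * 2) ≤ 2 * (suc p * suc p)
  time-del {j} j<n² = ≤-trans (n≤1+n _) (≤-trans (*-monoˡ-≤ 2 j<n²) (≤-reflexive (*-comm (suc p * suc p) 2)))

  bounded-at : ∀ i → i ≤ 2 * (suc p * suc p) →
    ∑ (λ s → pcSum h (2 ^ (31 * D)) (tab s)) (runs (suc p + i)) ≤ Cp * 2 ^ q * ∑ (length ∘ keys) (runs (suc p + i))
  bounded-at i i≤ = begin
    ∑ (λ s → pcSum h (2 ^ (31 * D)) (tab s)) (runs (suc p + i))  ≡⟨ sumAt≡∑ (suc p + i) _ ⟨
    sumAt A (suc p) (suc p + i) (λ s → pcSum h (2 ^ (31 * D)) (tab s)) ≤⟨ probe-bounded (2 ^ (31 * D)) i i≤ ⟩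
    Cp * 2 ^ q * sumAt A (suc p) (suc p + i) (λ s → length (keys s)) ≡⟨ cong (Cp * 2 ^ q *_) (sumAt≡∑ (suc p + i) _) ⟩
    Cp * 2 ^ q * ∑ (length ∘ keys) (runs (suc p + i))  ∎
    where open ≤-Reasoning

  bad-deletes-at : ∀ j → j < suc p * suc p → 8 * badDeletes (runs (suc p + j * 2)) ≤ suc p * length (runs (suc p + j * 2))
  bad-deletes-at j j<n² = few-bad-deletes cs good (heavy-total cs ≤-refl good (bounded-at (j * 2) (≤-trans (n≤1+n _) (time-del j<n²))))
    where
    cs = runs (suc p + j * 2)
    good : AllGood A (suc p) cs
    good = good-full j (<⇒≤ j<n²)

  bad-inserts-at : ∀ j → j < suc p * suc p → ∀ {r} → U ≤ 2 * r →
                   8 * badInserts (runs (suc (suc p + j * 2))) ≤ r * length (runs (suc (suc p + j * 2)))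
  bad-inserts-at j j<n² {r} U≤2r = few-bad-inserts cs {r} U≤2r good
      (heavy-total cs (n≤1+n p) good (subst (λ m → ∑ (λ s → pcSum h (2 ^ (31 * D)) (tab s)) (runs m) ≤ Cp * 2 ^ q * ∑ (length ∘ keys) (runs m))
        (+-suc (suc p) (j * 2)) (bounded-at (suc (j * 2)) (time-del j<n²))))
      -- The moment bound is applied to one slot `t` and one probe depth at a time, with the near
      -- uniformity count of that slot as hitting rate.
      (overloads-total cs λ v v≤D → overload-total cs v v≤D λ t →
        Drift.z-less A p valid-on 2n≤U (λ y → hits (v ∸ ℓ₀) y t) (rate (v ∸ ℓ₀)) (uniform (2 ^ (v ∸ ℓ₀)) t)
          (rate-small (v ∸ ℓ₀) (≤-trans (m∸n≤m v ℓ₀) v≤D)) j j<n²)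
    where
    cs = runs (suc (suc p + j * 2))
    good : AllGood A p cs
    good = good-less j j<n²

  -- A fresh key raises the potential by `D` unless it is bad, and at most one in eight is bad, so
  -- the mean gain is at least 7D/8.
  insert-total : ∀ j → j < suc p * suc p → ∀ {r} → r + p ≡ U → let cs = runs (suc (suc p + j * 2)) in
    8 * (r * (∑ (λ s → Φ (tab s) (keys s)) cs + D * length cs)) ≤
    8 * ∑ (λ s → ∑ (λ y → if memberB y (keys s) then 0 else Φ (setSlot (tab s) special (just y)) (y ∷ keys s)) (allFin U)) cs
      + D * (r * length cs)
  insert-total j j<n² {r} e = begin
    8 * (r * (∑ φ cs + D * length cs))
      ≡⟨ cong (8 *_) (trans (cong (λ x → r * (∑ φ cs + x)) (trans (*-comm D _) (sym (∑-const D cs)))) (trans (cong (r *_) (sym (∑-+ φ _ cs))) (sym (∑-* r _ cs)))) ⟩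
    8 * ∑ (λ s → r * (φ s + D)) cs
      ≤⟨ *-monoʳ-≤ 8 (∑-mono cs (λ {s} s∈ → each s (good s∈))) ⟩
    8 * ∑ (λ s → after s + D * ∑ (χ ∘ State.badInsert (tab s)) (allFin U)) cs
      ≡⟨ cong (8 *_) (trans (∑-+ after _ cs) (cong (∑ after cs +_) (∑-* D _ cs))) ⟩
    8 * (∑ after cs + D * badInserts cs)
      ≡⟨ lem (∑ after cs) D (badInserts cs) ⟩
    8 * ∑ after cs + D * (8 * badInserts cs)
      -- Only the count `U ≤ 2 * r` is wanted from `Drift`, so it is instantiated with the empty
      -- hitting predicate.
      ≤⟨ +-monoʳ-≤ (8 * ∑ after cs) (*-monoʳ-≤ D (bad-inserts-at j j<n² {r} (Drift.fresh≥half A p valid-on 2n≤U (λ _ → false) 0 (≤-reflexive (trans (cong (suc p *_) (∑-zero (allFin U))) (*-zeroʳ (suc p)))) e (n≤1+n p)))) ⟩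
    8 * ∑ after cs + D * (r * length cs) ∎
    where
    open ≤-Reasoning
    cs = runs (suc (suc p + j * 2))
    good : AllGood A p cs
    good = good-less j j<n²
    φ after : Config A → ℕ
    φ s = Φ (tab s) (keys s)
    after s = ∑ (λ y → if memberB y (keys s) then 0 else Φ (setSlot (tab s) special (just y)) (y ∷ keys s)) (allFin U)
    lem : ∀ a d b → 8 * (a + d * b) ≡ 8 * a + d * (8 * b)
    lem = solve-∀
    each : ∀ s → Good A p s → r * (φ s + D) ≤ after s + D * ∑ (χ ∘ State.badInsert (tab s)) (allFin U)
    each s g = begin
      r * (φ s + D)
        ≡⟨ cong (_* (φ s + D)) (+-cancelʳ-≡ p _ _ (trans e (sym (fresh-count A g)))) ⟩
      ∑ (λ y → χ (not (memberB y (keys s)))) (allFin U) * (φ s + D)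
        ≡⟨ trans (*-comm _ (φ s + D)) (sym (∑-* (φ s + D) _ (allFin U))) ⟩
      ∑ (λ y → (φ s + D) * χ (not (memberB y (keys s)))) (allFin U)
        ≤⟨ ∑-mono (allFin U) (λ {y} _ → one y) ⟩
      ∑ (λ y → (if memberB y (keys s) then 0 else Φ (setSlot (tab s) special (just y)) (y ∷ keys s)) + D * χ (State.badInsert (tab s) y)) (allFin U)
        ≡⟨ trans (∑-+ _ _ (allFin U)) (cong (after s +_) (∑-* D _ (allFin U))) ⟩
      after s + D * ∑ (χ ∘ State.badInsert (tab s)) (allFin U) ∎
      where
      one : ∀ y → (φ s + D) * χ (not (memberB y (keys s))) ≤
                  (if memberB y (keys s) then 0 else Φ (setSlot (tab s) special (just y)) (y ∷ keys s)) + D * χ (State.badInsert (tab s) y)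
      one y with memberB y (keys s) in eq
      ... | true  = ≤-trans (≤-reflexive (*-zeroʳ (φ s + D))) z≤n
      ... | false = ≤-trans (≤-reflexive (*-identityʳ _)) (State.insert-gain (tab s) (consistent g) y (λ y∈ → false≢true (trans (sym eq) (∈⇒memberB y∈))))

  -- The potential drops only for bad keys, by at most `D`, and at most one stored key in eight is
  -- bad on average; the mean loss is at most D/8.
  delete-total : ∀ j → j < suc p * suc p → let cs = runs (suc p + j * 2) in
    8 * (suc p * ∑ (λ s → Φ (tab s) (keys s)) cs) ≤
    8 * ∑ (λ s → ∑ (λ y → Φ (removeKey (tab s) y) (without y (keys s))) (keys s)) cs + D * (suc p * length cs)
  delete-total j j<n² = begin
    8 * (suc p * ∑ φ cs)  ≡⟨ cong (8 *_) (∑-* (suc p) φ cs) ⟨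
    8 * ∑ (λ s → suc p * φ s) cs  ≤⟨ *-monoʳ-≤ 8 (∑-mono cs (λ {s} s∈ → each s (good s∈))) ⟩
    8 * ∑ (λ s → after s + D * ∑ (χ ∘ State.badDelete (tab s)) (keys s)) cs ≡⟨ cong (8 *_) (trans (∑-+ after _ cs) (cong (∑ after cs +_) (∑-* D _ cs))) ⟩
    8 * (∑ after cs + D * badDeletes cs)  ≡⟨ lem (∑ after cs) D (badDeletes cs) ⟩
    8 * ∑ after cs + D * (8 * badDeletes cs)  ≤⟨ +-monoʳ-≤ (8 * ∑ after cs) (*-monoʳ-≤ D (bad-deletes-at j j<n²)) ⟩
    8 * ∑ after cs + D * (suc p * length cs)  ∎
    where
    open ≤-Reasoning
    cs = runs (suc p + j * 2)
    good : AllGood A (suc p) cs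
    good = good-full j (<⇒≤ j<n²)
    φ after : Config A → ℕ
    φ s = Φ (tab s) (keys s)
    after s = ∑ (λ y → Φ (removeKey (tab s) y) (without y (keys s))) (keys s)
    lem : ∀ a d b → 8 * (a + d * b) ≡ 8 * a + d * (8 * b)
    lem = solve-∀
    each : ∀ s → Good A (suc p) s → suc p * φ s ≤ after s + D * ∑ (χ ∘ State.badDelete (tab s)) (keys s)
    each s g = begin
      suc p * φ s  ≡⟨ cong (_* φ s) (size-keys g) ⟨
      length (keys s) * φ s  ≡⟨ ∑-const (φ s) (keys s) ⟨
      ∑ (λ _ → φ s) (keys s)  ≤⟨ ∑-mono (keys s) (λ {y} y∈ → State.delete-loss (tab s) (consistent g) (special-empty g) y y∈) ⟩
      ∑ (λ y → Φ (removeKey (tab s) y) (without y (keys s)) + D * χ (State.badDelete (tab s) y)) (keys s)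
                                    ≡⟨ trans (∑-+ _ _ (keys s)) (cong (after s +_) (∑-* D _ (keys s))) ⟩
      after s + D * ∑ (χ ∘ State.badDelete (tab s)) (keys s) ∎

-- Combining the dyadic scales.

-- The weights 2^(k-1-i) of f i make all scales D = 2^(i₀+i) count equally.
comb : (ℕ → ℕ) → ℕ → ℕ
comb f zero    = 0
comb f (suc k) = 2 * comb f k + f k

comb-mono : ∀ {f g} k → (∀ i → i < k → f i ≤ g i) → comb f k ≤ comb g k
comb-mono zero    le = z≤n
comb-mono (suc k) le = +-mono-≤ (*-monoʳ-≤ 2 (comb-mono k (λ i i<k → le i (≤-trans i<k (n≤1+n k))))) (le k ≤-refl)

comb-cong : ∀ {f g} k → (∀ i → f i ≡ g i) → comb f k ≡ comb g k
comb-cong zero    eq = refl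
comb-cong (suc k) eq = cong₂ (λ x y → 2 * x + y) (comb-cong k eq) (eq k)

comb-+ : ∀ f g k → comb (λ i → f i + g i) k ≡ comb f k + comb g k
comb-+ f g zero    = refl
comb-+ f g (suc k) = trans (cong (λ x → 2 * x + (f k + g k)) (comb-+ f g k)) (lem (comb f k) (comb g k) (f k) (g k))
  where
  lem : ∀ a b c d → 2 * (a + b) + (c + d) ≡ 2 * a + c + (2 * b + d)
  lem = solve-∀

comb-* : ∀ a f k → comb (λ i → a * f i) k ≡ a * comb f k
comb-* a f zero    = sym (*-zeroʳ a)
comb-* a f (suc k) = trans (cong (λ x → 2 * x + a * f k) (comb-* a f k)) (lem a (comb f k) (f k))
  where
  lem : ∀ a b c → 2 * (a * b) + a * c ≡ a * (2 * b + c)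
  lem = solve-∀

comb-∑ : {X : Set} (f : ℕ → X → ℕ) (xs : List X) (k : ℕ) → ∑ (λ x → comb (λ i → f i x) k) xs ≡ comb (λ i → ∑ (f i) xs) k
comb-∑ f xs zero    = ∑-zero xs
comb-∑ f xs (suc k) = trans (∑-+ _ (f k) xs) (cong (_+ ∑ (f k) xs) (trans (∑-* 2 _ xs) (cong (2 *_) (comb-∑ f xs k))))

comb-if : ∀ b (f : ℕ → ℕ) k → (if b then 0 else comb f k) ≡ comb (λ i → if b then 0 else f i) k
comb-if true  f k = sym (comb-0 k)
  where
  comb-0 : ∀ k → comb (λ _ → 0) k ≡ 0
  comb-0 zero    = refl
  comb-0 (suc k) = cong (λ x → 2 * x + 0) (comb-0 k)
comb-if false f k = refl

-- Every scale contributes the same 2^(i₀+k-1); the leading 2 avoids the predecessor in the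
-- exponent.
comb-scales : ∀ i₀ k → 2 * comb (λ i → 2 ^ (i₀ + i)) k ≡ k * 2 ^ (i₀ + k)
comb-scales i₀ zero    = refl
comb-scales i₀ (suc k) = begin
  2 * (2 * comb (λ i → 2 ^ (i₀ + i)) k + 2 ^ (i₀ + k)) ≡⟨ cong (λ x → 2 * (x + 2 ^ (i₀ + k))) (comb-scales i₀ k) ⟩
  2 * (k * 2 ^ (i₀ + k) + 2 ^ (i₀ + k))  ≡⟨ lem k (2 ^ (i₀ + k)) ⟩
  suc k * (2 * 2 ^ (i₀ + k))  ≡⟨ cong (λ i → suc k * 2 ^ i) (+-suc i₀ k) ⟨
  suc k * 2 ^ (i₀ + suc k)  ∎
  where
  open ≡-Reasoning
  lem : ∀ k x → 2 * (k * x + x) ≡ suc k * (2 * x)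
  lem = solve-∀

-- The scales charged are those with D ≥ v / 32, so their weighted charges form a geometric series.
comb-charge : ∀ i₀ v k → comb (λ i → charge≤ (32 * 2 ^ (i₀ + i)) v) k ≤ 96 * 2 ^ (i₀ + k)
comb-charge i₀ v k with claim k
  where
  S : ℕ → ℕ
  S = comb (λ i → charge≤ (32 * 2 ^ (i₀ + i)) v)
  open ≤-Reasoning
  lem : ∀ s v → 2 * s + v + 2 * v + v ≡ 2 * (s + 2 * v)
  lem = solve-∀
  lem₁ : ∀ v → v + 2 * v ≡ 3 * v
  lem₁ = solve-∀
  lem₂ : ∀ x → 2 * (96 * x) ≡ 96 * (2 * x)
  lem₂ = solve-∀
  lem₃ : ∀ x → 3 * (32 * x) ≡ 96 * x
  lem₃ = solve-∀
  charge≤v : ∀ θ → charge≤ θ v ≤ v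
  charge≤v θ with v ≤ᵇ θ
  ... | true  = ≤-refl
  ... | false = z≤n
  -- The reserve `2 * v` lets the bound survive a doubling step: 2(S + 2v) covers 2S, the new charge
  -- v and the reserve. At the first charged scale, charge and reserve are 3v, and v is at most 32
  -- times that scale, whence 96.
  claim : ∀ k → S k ≡ 0 ⊎ S k + 2 * v ≤ 96 * 2 ^ (i₀ + k)
  claim zero = inj₁ refl
  claim (suc k) with claim k
  ... | inj₂ le = inj₂ (begin
    2 * S k + charge≤ (32 * 2 ^ (i₀ + k)) v + 2 * v  ≤⟨ +-monoˡ-≤ (2 * v) (+-monoʳ-≤ (2 * S k) (charge≤v _)) ⟩
    2 * S k + v + 2 * v  ≤⟨ m≤m+n _ v ⟩
    2 * S k + v + 2 * v + v  ≡⟨ lem (S k) v ⟩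
    2 * (S k + 2 * v)  ≤⟨ *-monoʳ-≤ 2 le ⟩
    2 * (96 * 2 ^ (i₀ + k))  ≡⟨ trans (lem₂ (2 ^ (i₀ + k))) (cong (λ i → 96 * 2 ^ i) (sym (+-suc i₀ k))) ⟩
    96 * 2 ^ (i₀ + suc k)  ∎)
  ... | inj₁ eq with v ≤ᵇ 32 * 2 ^ (i₀ + k) in e
  ...   | false = inj₁ (cong (λ x → 2 * x + 0) eq)
  ...   | true  = inj₂ (begin
    2 * S k + v + 2 * v  ≡⟨ trans (cong (λ x → 2 * x + v + 2 * v) eq) (lem₁ v) ⟩
    3 * v  ≤⟨ *-monoʳ-≤ 3 (≤ᵇ-true⁻ {v} e) ⟩
    3 * (32 * 2 ^ (i₀ + k))  ≡⟨ lem₃ (2 ^ (i₀ + k)) ⟩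
    96 * 2 ^ (i₀ + k)  ≤⟨ *-monoʳ-≤ 96 (^-monoʳ-≤ 2 (+-monoʳ-≤ i₀ (n≤1+n k))) ⟩
    96 * 2 ^ (i₀ + suc k)  ∎)
... | inj₁ eq = ≤-trans (≤-reflexive eq) z≤n
... | inj₂ le = ≤-trans (m≤m+n _ _) le

-- Amortized accounting: the moves must pay for the growth of the potential.

module Accounting {U N : ℕ} (h : ProbeSeq U N) (Λ ℓ₀ : ℕ) (ℓ₀≥1 : 1 ≤ ℓ₀)
  (A : Algorithm U N) (p : ℕ) (valid-on : ValidOn A (suc p)) (2n≤U : 2 * suc p ≤ U)
  (c : ℕ) (c≥1 : 1 ≤ c) (uniform : NearlyUniformWith (suc p) c h)
  (κ Cp q L : ℕ) (probe-bounded : ProbeBoundedOn A h (suc p) (Cp * 2 ^ q))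
  (2^L≤n : 2 ^ L ≤ suc p) (holes : 2 ^ L * (N ∸ p) ≤ κ * suc p) (N≤ : N ≤ κ * suc p)
  (ℓ₀-large : 8 * c + 1 + L ≤ 2 ^ ℓ₀)
  (i₀ k : ℕ) (ℓ₀≤ : ℓ₀ ≤ 2 ^ i₀) (q≤ : q ≤ 2 ^ i₀)
  (upper : ∀ i → i < k → 64 * 2 ^ (i₀ + i) ≤ L) (L≤Λ : L ≤ Λ)
  (large : 32 * c * (κ + Cp + κ) ≤ 2 ^ 2 ^ i₀) (large′ : 16 * Cp ≤ 2 ^ 2 ^ i₀) (large″ : 4 * c ≤ 2 ^ 2 ^ i₀) where

  open Run A p valid-on
  open Weights h Λ ℓ₀ ℓ₀≥1

  scale : ℕ → ℕ
  scale i = 2 ^ (i₀ + i)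

  Φₛ : ℕ → Table U N → List (Fin U) → ℕ
  Φₛ i = Potential.Φ weight weight≥1 (scale i) (32 * scale i) (m^n>0 2 (i₀ + i))

  module At (i : ℕ) (i<k : i < k) where
    bottom : 2 ^ i₀ ≤ scale i
    bottom = ^-monoʳ-≤ 2 (m≤m+n i₀ i)
    D<Λ : scale i < Λ
    D<Λ = begin-strict
      scale i  <⟨ m<m*n (scale i) 64 {{m^n≢0 2 (i₀ + i)}} (s≤s (s≤s z≤n)) ⟩
      scale i * 64  ≡⟨ *-comm (scale i) 64 ⟩
      64 * scale i  ≤⟨ upper i i<k ⟩
      L  ≤⟨ L≤Λ ⟩
      Λ  ∎
      where open ≤-Reasoning
    open ScaleBounds h Λ ℓ₀ ℓ₀≥1 A p valid-on 2n≤U c c≥1 uniform κ Cp q L probe-bounded 2^L≤n holes N≤ ℓ₀-large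
      (scale i) (m^n>0 2 (i₀ + i)) D<Λ (≤-trans ℓ₀≤ bottom) (≤-trans q≤ bottom) (upper i i<k)
      (≤-trans large (^-monoʳ-≤ 2 bottom)) (≤-trans large′ (^-monoʳ-≤ 2 bottom)) (≤-trans large″ (^-monoʳ-≤ 2 bottom)) public

  Ψ : Table U N → List (Fin U) → ℕ
  Ψ T S = comb (λ i → Φₛ i T S) k

  -- An insertion that is good at every scale raises the combined potential by `g` before any move,
  -- and one move lowers it by at most `M`.
  g M : ℕ
  g = comb scale k
  M = 96 * 2 ^ (i₀ + k)

  Ψ-move : ∀ {T S} → Consistent T S → ∀ m → Ψ T S ≤ Ψ (applyMove T m) S + M
  Ψ-move {T} {S} C m = begin
    Ψ T S  ≤⟨ comb-mono k (λ i _ → Potential.Walk.Φ-move weight weight≥1 (scale i) (32 * scale i) (m^n>0 2 (i₀ + i)) C m) ⟩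
    comb (λ i → Φₛ i (applyMove T m) S + charge≤ (32 * scale i) v) k  ≡⟨ comb-+ _ _ k ⟩
    Ψ (applyMove T m) S + comb (λ i → charge≤ (32 * scale i) v) k  ≤⟨ +-monoʳ-≤ _ (comb-charge i₀ v k) ⟩
    Ψ (applyMove T m) S + M  ∎
    where
    open ≤-Reasoning
    v = moveWeight weight T m

  Ψ-moves : ∀ {T S} → Consistent T S → ∀ ms → Ψ T S ≤ Ψ (foldl applyMove T ms) S + M * length ms
  Ψ-moves C []       = m≤m+n _ _
  Ψ-moves {T} {S} C (m ∷ ms) = begin
    Ψ T S  ≤⟨ Ψ-move C m ⟩
    Ψ (applyMove T m) S + M  ≤⟨ +-monoˡ-≤ M (Ψ-moves (consistent-move m C) ms) ⟩
    Ψ (foldl applyMove (applyMove T m) ms) S + M * length ms + M  ≡⟨ lem (Ψ (foldl applyMove (applyMove T m) ms) S) M (length ms) ⟩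
    Ψ (foldl applyMove (applyMove T m) ms) S + M * suc (length ms) ∎
    where
    open ≤-Reasoning
    lem : ∀ x m l → x + m * l + m ≡ x + m * suc l
    lem = solve-∀

  -- Charging `M` per move compensates the loss of potential, so no sequence of counted moves lowers
  -- `V`; only the arrival and departure of keys need an estimate.
  V : Config A → ℕ
  V s = M * cost s + Ψ (tab s) (keys s)

  V-after : ∀ {T S} → Consistent T S → ∀ x ms → M * x + Ψ T S ≤ M * (x + length ms) + Ψ (foldl applyMove T ms) S
  V-after {T} {S} C x ms = ≤-trans (+-monoʳ-≤ (M * x) (Ψ-moves C ms)) (≤-reflexive (lem M x (length ms) (Ψ (foldl applyMove T ms) S)))
    where
    lem : ∀ m x l y → m * x + (y + m * l) ≡ m * (x + l) + y
    lem = solve-∀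

  R : ℕ → ℕ
  R m = length (runs m)

  module _ (j : ℕ) (j<n² : j < n * n) where

    private
      cs cs′ cs″ : List (Config A)
      cs  = runs (n + j * 2)
      cs′ = runs (suc (n + j * 2))
      cs″ = runs (n + suc j * 2)

      merge : ∀ a b x → 8 * a + (8 * b + x) ≡ 8 * (a + b) + x
      merge = solve-∀

    -- The bounds of the single scales, added with the weights of `comb`, compare the potential
    -- before the deletion with that just after the key is removed. `V-after` then passes over
    -- whatever moves the algorithm makes.
    delete-V : 8 * (n * ∑ V cs) ≤ 8 * ∑ V cs′ + g * (n * length cs)
    delete-V = begin
      8 * (n * ∑ V cs)
        ≡⟨ trans (cong (λ x → 8 * (n * x)) (trans (∑-+ _ _ cs) (cong (∑ (λ s → M * cost s) cs +_) (comb-∑ (λ i s → Φₛ i (tab s) (keys s)) cs k)))) (lem n (∑ (λ s → M * cost s) cs) (comb (λ i → ∑ (λ s → Φₛ i (tab s) (keys s)) cs) k)) ⟩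
      8 * (n * ∑ (λ s → M * cost s) cs) + 8 * n * comb (λ i → ∑ (λ s → Φₛ i (tab s) (keys s)) cs) k
        ≡⟨ cong (8 * (n * ∑ (λ s → M * cost s) cs) +_) (trans (sym (comb-* (8 * n) _ k)) (comb-cong k (λ i → *-assoc 8 n _))) ⟩
      8 * (n * ∑ (λ s → M * cost s) cs) + comb (λ i → 8 * (n * ∑ (λ s → Φₛ i (tab s) (keys s)) cs)) k
        ≤⟨ +-monoʳ-≤ _ (comb-mono k (λ i i<k → At.delete-total i i<k j j<n²)) ⟩
      8 * (n * ∑ (λ s → M * cost s) cs) + comb (λ i → 8 * ∑ (λ s → ∑ (λ y → after i s y) (keys s)) cs + scale i * (n * length cs)) k
        ≡⟨ cong₂ (λ x y → 8 * x + y) spread (trans (comb-+ _ _ k) (cong₂ _+_ (trans (comb-* 8 _ k) (cong (8 *_) (sym gather)))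
             (trans (comb-cong k (λ i → *-comm (scale i) _)) (trans (comb-* (n * length cs) scale k) (*-comm _ g))))) ⟩
      8 * ∑ (λ s → ∑ (λ _ → M * cost s) (keys s)) cs + (8 * ∑ (λ s → ∑ (λ y → comb (λ i → after i s y) k) (keys s)) cs + g * (n * length cs))
        ≡⟨ trans (merge (∑ (λ s → ∑ (λ _ → M * cost s) (keys s)) cs) (∑ (λ s → ∑ (λ y → comb (λ i → after i s y) k) (keys s)) cs) (g * (n * length cs)))
             (cong (λ x → 8 * x + g * (n * length cs)) (sym (trans (∑-cong cs (λ {s} _ → ∑-+ _ _ (keys s))) (∑-+ _ _ cs)))) ⟩
      8 * ∑ (λ s → ∑ (λ y → M * cost s + comb (λ i → after i s y) k) (keys s)) cs + g * (n * length cs)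
        ≤⟨ +-monoˡ-≤ _ (*-monoʳ-≤ 8 (∑-mono cs (λ {s} s∈ → ∑-mono (keys s) (λ {y} _ →
             V-after (consistent-delete y (consistent (good-full j (<⇒≤ j<n²) s∈))) (cost s) (proj₂ (onDelete A (mem s) (removeKey (tab s) y) y)))))) ⟩
      8 * ∑ (λ s → ∑ (λ y → V (deleteStep A true s y)) (keys s)) cs + g * (n * length cs)
        ≡⟨ cong (λ x → 8 * x + g * (n * length cs)) (trans (sym (∑-next-del A V true cs)) (cong (∑ V) (sym (runs-del j j<n²)))) ⟩
      8 * ∑ V cs′ + g * (n * length cs) ∎
      where
      open ≤-Reasoning
      after : ℕ → Config A → Fin U → ℕ
      after i s y = Φₛ i (removeKey (tab s) y) (without y (keys s))
      lem : ∀ n a b → 8 * (n * (a + b)) ≡ 8 * (n * a) + 8 * n * b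
      lem = solve-∀
      gather : ∑ (λ s → ∑ (λ y → comb (λ i → after i s y) k) (keys s)) cs ≡ comb (λ i → ∑ (λ s → ∑ (λ y → after i s y) (keys s)) cs) k
      gather = trans (∑-cong cs (λ {s} _ → comb-∑ (λ i y → after i s y) (keys s) k)) (comb-∑ (λ i s → ∑ (λ y → after i s y) (keys s)) cs k)
      spread : n * ∑ (λ s → M * cost s) cs ≡ ∑ (λ s → ∑ (λ _ → M * cost s) (keys s)) cs
      spread = trans (sym (∑-* n _ cs)) (∑-cong cs (λ {s} s∈ →
        sym (trans (∑-const (M * cost s) (keys s)) (cong (_* (M * cost s)) (size-keys (good-full j (<⇒≤ j<n²) s∈))))))

    insert-V : ∀ {r} → r + p ≡ U → 8 * (r * (∑ V cs′ + g * length cs′)) ≤ 8 * ∑ V cs″ + g * (r * length cs′)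
    insert-V {r} e = begin
      8 * (r * (∑ V cs′ + g * length cs′))
        ≡⟨ trans (cong (λ x → 8 * (r * (x + g * length cs′))) (trans (∑-+ _ _ cs′) (cong (∑ (λ s → M * cost s) cs′ +_) (comb-∑ (λ i s → Φₛ i (tab s) (keys s)) cs′ k)))) (lem r (∑ (λ s → M * cost s) cs′) (comb (λ i → ∑ (λ s → Φₛ i (tab s) (keys s)) cs′) k) (g * length cs′)) ⟩
      8 * (r * ∑ (λ s → M * cost s) cs′) + 8 * r * (comb (λ i → ∑ (λ s → Φₛ i (tab s) (keys s)) cs′) k + g * length cs′)
        ≡⟨ cong (λ x → 8 * (r * ∑ (λ s → M * cost s) cs′) + 8 * r * (comb (λ i → ∑ (λ s → Φₛ i (tab s) (keys s)) cs′) k + x))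
             (trans (*-comm g _) (trans (sym (comb-* (length cs′) scale k)) (comb-cong k (λ i → *-comm (length cs′) (scale i))))) ⟩
      8 * (r * ∑ (λ s → M * cost s) cs′) + 8 * r * (comb (λ i → ∑ (λ s → Φₛ i (tab s) (keys s)) cs′) k + comb (λ i → scale i * length cs′) k)
        ≡⟨ cong (8 * (r * ∑ (λ s → M * cost s) cs′) +_) (trans (cong (8 * r *_) (sym (comb-+ _ _ k))) (trans (sym (comb-* (8 * r) _ k)) (comb-cong k (λ i → *-assoc 8 r _)))) ⟩
      8 * (r * ∑ (λ s → M * cost s) cs′) + comb (λ i → 8 * (r * (∑ (λ s → Φₛ i (tab s) (keys s)) cs′ + scale i * length cs′))) k
        ≤⟨ +-monoʳ-≤ _ (comb-mono k (λ i i<k → At.insert-total i i<k j j<n² e)) ⟩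
      8 * (r * ∑ (λ s → M * cost s) cs′) + comb (λ i → 8 * ∑ (λ s → ∑ (λ y → if memberB y (keys s) then 0 else after i s y) (allFin U)) cs′ + scale i * (r * length cs′)) k
        ≡⟨ cong₂ (λ x y → 8 * x + y) spread (trans (comb-+ _ _ k) (cong₂ _+_ (trans (comb-* 8 _ k) (cong (8 *_) (sym gather)))
             (trans (comb-cong k (λ i → *-comm (scale i) _)) (trans (comb-* (r * length cs′) scale k) (*-comm _ g))))) ⟩
      8 * ∑ (λ s → ∑ (λ y → if memberB y (keys s) then 0 else M * cost s) (allFin U)) cs′ +
        (8 * ∑ (λ s → ∑ (λ y → if memberB y (keys s) then 0 else comb (λ i → after i s y) k) (allFin U)) cs′ + g * (r * length cs′))
        ≡⟨ trans (merge (∑ (λ s → ∑ (λ y → if memberB y (keys s) then 0 else M * cost s) (allFin U)) cs′)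
                        (∑ (λ s → ∑ (λ y → if memberB y (keys s) then 0 else comb (λ i → after i s y) k) (allFin U)) cs′) (g * (r * length cs′)))
             (cong (λ x → 8 * x + g * (r * length cs′)) (sym (trans (∑-cong cs′ (λ {s} _ → ∑-+ _ _ (allFin U))) (∑-+ _ _ cs′)))) ⟩
      8 * ∑ (λ s → ∑ (λ y → (if memberB y (keys s) then 0 else M * cost s) + (if memberB y (keys s) then 0 else comb (λ i → after i s y) k)) (allFin U)) cs′ + g * (r * length cs′)
        ≤⟨ +-monoˡ-≤ _ (*-monoʳ-≤ 8 (∑-mono cs′ (λ {s} s∈ → ∑-mono (allFin U) (λ {y} _ → one s y (good-less j j<n² s∈))))) ⟩
      8 * ∑ (λ s → ∑ (λ y → if memberB y (keys s) then 0 else V (insertStep A true s y)) (allFin U)) cs′ + g * (r * length cs′)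
        ≡⟨ cong (λ x → 8 * x + g * (r * length cs′)) (trans (sym (∑-next-ins A V true cs′)) (cong (∑ V) (sym (runs-ins j j<n²)))) ⟩
      8 * ∑ V cs″ + g * (r * length cs′) ∎
      where
      open ≤-Reasoning
      after : ℕ → Config A → Fin U → ℕ
      after i s y = Φₛ i (setSlot (tab s) special (just y)) (y ∷ keys s)
      lem : ∀ r a b c → 8 * (r * (a + b + c)) ≡ 8 * (r * a) + 8 * r * (b + c)
      lem = solve-∀
      gather : ∑ (λ s → ∑ (λ y → if memberB y (keys s) then 0 else comb (λ i → after i s y) k) (allFin U)) cs′ ≡
               comb (λ i → ∑ (λ s → ∑ (λ y → if memberB y (keys s) then 0 else after i s y) (allFin U)) cs′) k
      gather = trans (∑-cong cs′ (λ {s} _ → trans (∑-cong (allFin U) (λ {y} _ → comb-if (memberB y (keys s)) (λ i → after i s y) k))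
                 (comb-∑ (λ i y → if memberB y (keys s) then 0 else after i s y) (allFin U) k)))
                 (comb-∑ (λ i s → ∑ (λ y → if memberB y (keys s) then 0 else after i s y) (allFin U)) cs′ k)
      gate : ∀ b x → x * χ (not b) ≡ (if b then 0 else x)
      gate true  x = *-zeroʳ x
      gate false x = *-identityʳ x
      spread : r * ∑ (λ s → M * cost s) cs′ ≡ ∑ (λ s → ∑ (λ y → if memberB y (keys s) then 0 else M * cost s) (allFin U)) cs′
      spread = trans (sym (∑-* r _ cs′)) (∑-cong cs′ (λ {s} s∈ →
        trans (cong (_* (M * cost s)) (+-cancelʳ-≡ p _ _ (trans e (sym (fresh-count A (good-less j j<n² s∈))))))
          (trans (*-comm _ (M * cost s)) (trans (sym (∑-* (M * cost s) _ (allFin U))) (∑-cong (allFin U) (λ {y} _ → gate (memberB y (keys s)) (M * cost s)))))))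
      one : ∀ s y → Good A p s →
            (if memberB y (keys s) then 0 else M * cost s) + (if memberB y (keys s) then 0 else comb (λ i → after i s y) k)
            ≤ (if memberB y (keys s) then 0 else V (insertStep A true s y))
      one s y good with memberB y (keys s) in eq
      ... | true  = z≤n
      ... | false = V-after (consistent-insert (special-empty good) (λ y∈ → false≢true (trans (sym eq) (∈⇒memberB y∈))) (consistent good))
                      (cost s) (proj₂ (onInsert A (mem s) (setSlot (tab s) special (just y)) y))

  -- In the mean a round loses at most g/8 at the deletion and gains at least 7g/8 at the insertion,
  -- a net growth of 6g/8 per round.
  V-grows : ∀ j → j ≤ n * n → 6 * (j * (g * R (n + j * 2))) ≤ 8 * ∑ V (runs (n + j * 2))
  V-grows zero    _    = z≤n
  V-grows (suc j) j<n² = +-cancelʳ-≤ (2 * (g * (r * (n * R₀)))) _ _ (begin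
    6 * (suc j * (g * R (n + suc j * 2))) + 2 * (g * (r * (n * R₀)))  ≡⟨ cong (λ x → 6 * (suc j * (g * x)) + 2 * (g * (r * (n * R₀)))) R-step ⟩
    6 * (suc j * (g * (r * (n * R₀)))) + 2 * (g * (r * (n * R₀)))  ≡⟨ lem₁ j g r n R₀ ⟩
    r * n * (6 * (j * (g * R₀))) + 8 * (g * (r * (n * R₀)))  ≤⟨ +-monoˡ-≤ (8 * (g * (r * (n * R₀)))) (*-monoʳ-≤ (r * n) (V-grows j (<⇒≤ j<n²))) ⟩
    r * n * (8 * V₀) + 8 * (g * (r * (n * R₀)))  ≡⟨ cong (_+ 8 * (g * (r * (n * R₀)))) (lem₂ r n V₀) ⟩
    r * (8 * (n * V₀)) + 8 * (g * (r * (n * R₀)))  ≤⟨ +-monoˡ-≤ (8 * (g * (r * (n * R₀)))) (*-monoʳ-≤ r (delete-V j j<n²)) ⟩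
    r * (8 * V₁ + g * (n * R₀)) + 8 * (g * (r * (n * R₀)))  ≡⟨ lem₃ r g (n * R₀) V₁ ⟩
    8 * (r * (V₁ + g * (n * R₀))) + g * (r * (n * R₀))  ≡⟨ cong (λ x → 8 * (r * (V₁ + g * x)) + g * (r * (n * R₀))) R-half ⟨
    8 * (r * (V₁ + g * R (suc (n + j * 2)))) + g * (r * (n * R₀))  ≤⟨ +-monoˡ-≤ (g * (r * (n * R₀))) (insert-V j j<n² e) ⟩
    8 * V₂ + g * (r * R (suc (n + j * 2))) + g * (r * (n * R₀))  ≡⟨ cong (λ x → 8 * V₂ + g * (r * x) + g * (r * (n * R₀))) R-half ⟩
    8 * V₂ + g * (r * (n * R₀)) + g * (r * (n * R₀))  ≡⟨ lem₄ V₂ (g * (r * (n * R₀))) ⟩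
    8 * V₂ + 2 * (g * (r * (n * R₀)))  ∎)
    where
    open ≤-Reasoning
    r R₀ V₀ V₁ V₂ : ℕ
    r = U ∸ p
    R₀ = R (n + j * 2)
    V₀ = ∑ V (runs (n + j * 2))
    V₁ = ∑ V (runs (suc (n + j * 2)))
    V₂ = ∑ V (runs (n + suc j * 2))
    e : r + p ≡ U
    e = m∸n+n≡m (≤-trans (n≤1+n p) (≤-trans (m≤m+n n _) 2n≤U))
    R-half : R (suc (n + j * 2)) ≡ n * R₀
    R-half = trans (cong length (runs-del j j<n²)) (length-next-del A (good-full j (<⇒≤ j<n²)))
    R-step : R (n + suc j * 2) ≡ r * (n * R₀)
    R-step = trans (+-cancelʳ-≡ (p * R (suc (n + j * 2))) _ _
      (trans (cong (λ x → length x + p * R (suc (n + j * 2))) (runs-ins j j<n²))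
        (trans (length-next-ins A (good-less j j<n²)) (trans (cong (_* R (suc (n + j * 2))) (sym e)) (*-distribʳ-+ (R (suc (n + j * 2))) r p)))))
      (cong (r *_) R-half)
    lem₁ : ∀ j g r n x → 6 * (suc j * (g * (r * (n * x)))) + 2 * (g * (r * (n * x))) ≡ r * n * (6 * (j * (g * x))) + 8 * (g * (r * (n * x)))
    lem₁ = solve-∀
    lem₂ : ∀ r n v → r * n * (8 * v) ≡ r * (8 * (n * v))
    lem₂ = solve-∀
    lem₃ : ∀ r g x v → r * (8 * v + g * x) + 8 * (g * (r * x)) ≡ 8 * (r * (v + g * x)) + g * (r * x)
    lem₃ = solve-∀
    lem₄ : ∀ v x → 8 * v + x + x ≡ 8 * v + 2 * x
    lem₄ = solve-∀

  -- After n² rounds the mean of `V` is at least 3gn²/4, of which the potential itself supplies at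
  -- most gn, that is at most gn²/4 for n ≥ 4. So `M` times the mean cost is at least gn²/2.
  -- Inserting 2g = k 2^(i₀+k) and M = 96 · 2^(i₀+k) gives 384 = 4 · 96.
  cost-bound : 4 ≤ n → k * (n * n) * totalRuns A n ≤ 384 * totalCost A n
  cost-bound 4≤n = *-cancelʳ-≤ _ _ (2 ^ (i₀ + k)) {{m^n≢0 2 (i₀ + k)}} (begin
    k * (n * n) * totalRuns A n * 2 ^ (i₀ + k)  ≡⟨ cong (λ x → k * (n * n) * x * 2 ^ (i₀ + k)) runs≡ ⟩
    k * (n * n) * R end * 2 ^ (i₀ + k)  ≡⟨ lem₁ k (n * n) (R end) (2 ^ (i₀ + k)) ⟩
    k * 2 ^ (i₀ + k) * (n * n * R end)  ≡⟨ cong (_* (n * n * R end)) (comb-scales i₀ k) ⟨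
    2 * g * (n * n * R end)  ≡⟨ lem₂ g (n * n) (R end) ⟩
    2 * (n * n * (g * R end))  ≤⟨ *-monoʳ-≤ 2 main ⟩
    2 * (2 * (M * ∑ cost (runs end)))  ≡⟨ lem₃ (2 ^ (i₀ + k)) _ ⟩
    384 * ∑ cost (runs end) * 2 ^ (i₀ + k)  ≡⟨ cong (λ x → 384 * x * 2 ^ (i₀ + k)) cost≡ ⟨
    384 * totalCost A n * 2 ^ (i₀ + k)  ∎)
    where
    open ≤-Reasoning
    end : ℕ
    end = n + n * n * 2
    end≡ : n + 2 * (n * n) ≡ end
    end≡ = cong (n +_) (*-comm 2 (n * n))
    runs≡ : totalRuns A n ≡ R end
    runs≡ = trans (sumAt≡∑ (n + 2 * (n * n)) (λ _ → 1)) (trans (∑-one (runs (n + 2 * (n * n)))) (cong R end≡))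
    cost≡ : totalCost A n ≡ ∑ cost (runs end)
    cost≡ = trans (sumAt≡∑ (n + 2 * (n * n)) cost) (cong (λ m → ∑ cost (runs m)) end≡)
    Ψ≤ : ∀ {s} → s ∈ runs end → Ψ (tab s) (keys s) ≤ g * n
    Ψ≤ {s} s∈ = begin
      Ψ (tab s) (keys s)  ≤⟨ comb-mono k (λ i _ → Potential.Φ≤D*length weight weight≥1 (scale i) (32 * scale i) (m^n>0 2 (i₀ + i)) (tab s) (keys s)) ⟩
      comb (λ i → scale i * length (keys s)) k ≡⟨ trans (comb-cong k (λ i → *-comm (scale i) _)) (comb-* (length (keys s)) scale k) ⟩
      length (keys s) * g  ≡⟨ cong (_* g) (size-keys (good-full (n * n) ≤-refl s∈)) ⟩
      n * g  ≡⟨ *-comm n g ⟩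
      g * n  ∎
    V-end : ∑ V (runs end) ≤ M * ∑ cost (runs end) + g * n * R end
    V-end = begin
      ∑ V (runs end)  ≤⟨ ∑-mono (runs end) (λ {s} s∈ → +-monoʳ-≤ (M * cost s) (Ψ≤ s∈)) ⟩
      ∑ (λ s → M * cost s + g * n) (runs end)  ≡⟨ trans (∑-+ _ _ (runs end)) (cong₂ _+_ (∑-* M cost (runs end)) (trans (∑-const (g * n) (runs end)) (*-comm (R end) (g * n)))) ⟩
      M * ∑ cost (runs end) + g * n * R end  ∎
    lem₁ : ∀ k m r x → k * m * r * x ≡ k * x * (m * r)
    lem₁ = solve-∀
    lem₂ : ∀ g m r → 2 * g * (m * r) ≡ 2 * (m * (g * r))
    lem₂ = solve-∀
    lem₃ : ∀ x c → 2 * (2 * (96 * x * c)) ≡ 384 * c * x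
    lem₃ = solve-∀
    lem₄ : ∀ m x → 4 * (m * x) + 2 * (m * x) ≡ 6 * (m * x)
    lem₄ = solve-∀
    lem₅ : ∀ a g n r → 8 * (a + g * n * r) ≡ 4 * (2 * a) + 2 * (4 * n * (g * r))
    lem₅ = solve-∀
    main : n * n * (g * R end) ≤ 2 * (M * ∑ cost (runs end))
    main = *-cancelˡ-≤ 4 (+-cancelʳ-≤ (2 * (n * n * (g * R end))) _ _ (begin
      4 * (n * n * (g * R end)) + 2 * (n * n * (g * R end))  ≡⟨ lem₄ (n * n) (g * R end) ⟩
      6 * (n * n * (g * R end))  ≤⟨ V-grows (n * n) ≤-refl ⟩
      8 * ∑ V (runs end)  ≤⟨ *-monoʳ-≤ 8 V-end ⟩
      8 * (M * ∑ cost (runs end) + g * n * R end)  ≡⟨ lem₅ (M * ∑ cost (runs end)) g n (R end) ⟩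
      4 * (2 * (M * ∑ cost (runs end))) + 2 * (4 * n * (g * R end)) ≤⟨ +-monoʳ-≤ (4 * (2 * (M * ∑ cost (runs end)))) (*-monoʳ-≤ 2 (*-monoˡ-≤ (g * R end) (*-monoˡ-≤ n 4≤n))) ⟩
      4 * (2 * (M * ∑ cost (runs end))) + 2 * (n * n * (g * R end)) ∎))

-- Integer roots and logarithms, and the choice of parameters.

isqrtGo-square : ∀ m r → isqrtGo m r * isqrtGo m r ≤ m
isqrtGo-square m zero    = z≤n
isqrtGo-square m (suc r) with (suc r * suc r) ≤ᵇ m in e
... | true  = ≤ᵇ-true⁻ {suc r * suc r} e
... | false = isqrtGo-square m r

2^⌊log₂⌋≤ : ∀ n → 1 ≤ n → 2 ^ ⌊log₂ n ⌋ ≤ n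
2^⌊log₂⌋≤ = <-rec _ go
  where
  open ≤-Reasoning
  go : ∀ n → (∀ {m} → m < n → 1 ≤ m → 2 ^ ⌊log₂ m ⌋ ≤ m) → 1 ≤ n → 2 ^ ⌊log₂ n ⌋ ≤ n
  go 1 rec _ = ≤-refl
  go n@(suc (suc n′)) rec _ = begin
    2 ^ ⌊log₂ n ⌋  ≡⟨ cong (2 ^_) (m+[n∸m]≡n log≥1) ⟨
    2 * 2 ^ (⌊log₂ n ⌋ ∸ 1)  ≡⟨ cong (λ l → 2 * 2 ^ l) (⌊log₂⌊n/2⌋⌋≡⌊log₂n⌋∸1 n) ⟨
    2 * 2 ^ ⌊log₂ ⌊ n /2⌋ ⌋  ≤⟨ *-monoʳ-≤ 2 (rec (⌊n/2⌋<n (suc n′)) (s≤s z≤n)) ⟩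
    2 * ⌊ n /2⌋  ≡⟨ cong (⌊ n /2⌋ +_) (+-identityʳ _) ⟩
    ⌊ n /2⌋ + ⌊ n /2⌋  ≤⟨ +-monoʳ-≤ ⌊ n /2⌋ (⌊n/2⌋≤⌈n/2⌉ n) ⟩
    ⌊ n /2⌋ + ⌈ n /2⌉  ≡⟨ ⌊n/2⌋+⌈n/2⌉≡n n ⟩
    n  ∎
    where
    log≥1 : 1 ≤ ⌊log₂ n ⌋
    log≥1 = ⌊log₂⌋-mono-≤ {2} {n} (s≤s (s≤s z≤n))

<2^suc⌊log₂⌋ : ∀ n → n < 2 ^ suc ⌊log₂ n ⌋
<2^suc⌊log₂⌋ n = ≰⇒> λ le → <-irrefl refl
  (≤-trans (≤-reflexive (sym (⌊log₂[2^n]⌋≡n (suc ⌊log₂ n ⌋)))) (⌊log₂⌋-mono-≤ le))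

≤⌊log₂⌋ : ∀ {l n} → 2 ^ l ≤ n → l ≤ ⌊log₂ n ⌋
≤⌊log₂⌋ {l} le = ≤-trans (≤-reflexive (sym (⌊log₂[2^n]⌋≡n l))) (⌊log₂⌋-mono-≤ le)

square-cancel : ∀ {x y} → x * x < y * y → x < y
square-cancel {x} {y} lt = ≰⇒> λ y≤x → <⇒≱ lt (*-mono-≤ y≤x y≤x)

half≤ : ∀ J → ⌊ J /2⌋ + ⌊ J /2⌋ ≤ J
half≤ J = ≤-trans (+-monoʳ-≤ ⌊ J /2⌋ (⌊n/2⌋≤⌈n/2⌉ J)) (≤-reflexive (⌊n/2⌋+⌈n/2⌉≡n J))

≤half : ∀ J → J ≤ suc (⌊ J /2⌋ + ⌊ J /2⌋)
≤half J = begin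
  J  ≡⟨ ⌊n/2⌋+⌈n/2⌉≡n J ⟨
  ⌊ J /2⌋ + ⌈ J /2⌉  ≤⟨ +-monoʳ-≤ ⌊ J /2⌋ (⌊n/2⌋-mono (n≤1+n (suc J))) ⟩
  ⌊ J /2⌋ + suc ⌊ J /2⌋  ≡⟨ +-suc _ _ ⟩
  suc (⌊ J /2⌋ + ⌊ J /2⌋)  ∎
  where open ≤-Reasoning

<∸⇒+< : ∀ m n o → m < n ∸ o → o + m < n
<∸⇒+< m n zero    lt = lt
<∸⇒+< m (suc n) (suc o) lt = s≤s (<∸⇒+< m n o lt)

module Parameters (κ c Cp : ℕ) where

  offset big : ℕ
  offset = 8 * c + 1
  big    = 32 * c * (suc κ + Cp + suc κ) + 16 * Cp + 4 * c

  abstract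
    J₀ : ℕ
    J₀ = 20 + (big + offset)

    J₀≡ : J₀ ≡ 20 + (big + offset)
    J₀≡ = refl

  -- If 1/ε is at least this large, then the twice iterated logarithm is at least 2 J₀ and its half
  -- at least `J₀`, which exceeds every constant involved.
  m₀ : ℕ
  m₀ = 2 ^ 2 ^ (J₀ + J₀)

  20≤J₀ : 20 ≤ J₀
  20≤J₀ = ≤-trans (m≤m+n 20 (big + offset)) (≤-reflexive (sym J₀≡))

  module _ (L : ℕ) (L-large : 2 ^ (J₀ + J₀) ≤ L) where

    open ≤-Reasoning

    -- `L` is log 1/ε and `J` its logarithm. The lowest scale 2^i₀ lies just above the root of `L`,
    -- where it dominates both the allowed logarithmic probe complexity and `ℓ₀`. The `k` scales end
    -- at `L` / 64; since the last index is k - 1, a 5 in place of 6 is subtracted.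
    J x i₀ k ℓ₀ : ℕ
    J  = ⌊log₂ L ⌋
    x  = ⌊ J /2⌋
    i₀ = suc x
    k  = J ∸ (i₀ + 5)
    ℓ₀ = offset + suc J

    J₀≤x : J₀ ≤ x
    J₀≤x = ≤-trans (≤-reflexive (trans (n≡⌊n+n/2⌋ J₀) refl)) (⌊n/2⌋-mono (≤⌊log₂⌋ L-large))

    L≥1 : 1 ≤ L
    L≥1 = ≤-trans (m^n>0 2 (J₀ + J₀)) L-large

    ℓ₀-large : 8 * c + 1 + L ≤ 2 ^ ℓ₀
    ℓ₀-large = begin
      offset + L  ≤⟨ +-mono-≤ (m≤m*n offset (2 ^ suc J) {{m^n≢0 2 (suc J)}}) (<⇒≤ (<2^suc⌊log₂⌋ L)) ⟩
      offset * 2 ^ suc J + 2 ^ suc J  ≡⟨ +-comm _ (2 ^ suc J) ⟩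
      suc offset * 2 ^ suc J  ≤⟨ *-monoˡ-≤ (2 ^ suc J) (n<2^n offset) ⟩
      2 ^ offset * 2 ^ suc J  ≡⟨ ^-distribˡ-+-* 2 offset (suc J) ⟨
      2 ^ ℓ₀  ∎

    ℓ₀≥1 : 1 ≤ ℓ₀
    ℓ₀≥1 = ≤-trans (s≤s z≤n) (m≤n+m (suc J) offset)

    -- From J ≤ 2x + 1 follows J + 1 ≤ 2 i₀, so the square of 2^i₀ exceeds `L`.
    q≤ : isqrt L ≤ 2 ^ i₀
    q≤ = <⇒≤ (square-cancel (begin-strict
      isqrt L * isqrt L  ≤⟨ isqrtGo-square L L ⟩
      L  <⟨ <2^suc⌊log₂⌋ L ⟩
      2 ^ suc J  ≤⟨ ^-monoʳ-≤ 2 (≤-trans (s≤s (≤half J)) (≤-reflexive (sym (cong suc (+-suc x x))))) ⟩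
      2 ^ (i₀ + i₀)  ≡⟨ ^-distribˡ-+-* 2 i₀ i₀ ⟩
      2 ^ i₀ * 2 ^ i₀  ∎))

    -- `ℓ₀` is linear in `J`: it is at most 3x, because x ≥ J₀ absorbs the constants, while 2^i₀ is
    -- exponential in x.
    ℓ₀≤ : ℓ₀ ≤ 2 ^ i₀
    ℓ₀≤ = begin
      offset + suc J  ≤⟨ +-mono-≤ (m≤n+m offset (18 + big)) (s≤s (≤half J)) ⟩
      (18 + big + offset) + suc (suc (x + x)) ≡⟨ lem (18 + big + offset) x ⟩
      (20 + big + offset) + (x + x)  ≤⟨ +-monoˡ-≤ (x + x) (≤-trans (≤-reflexive (trans (+-assoc 20 big offset) (sym J₀≡))) J₀≤x) ⟩
      x + (x + x)  ≤⟨ m≤m+n _ x ⟩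
      x + (x + x) + x  ≡⟨ lem′ x ⟩
      4 * x  ≤⟨ *-monoʳ-≤ 4 (pred-power (≤-trans (≤-trans (m≤m+n 1 19) 20≤J₀) J₀≤x)) ⟩
      4 * 2 ^ (x ∸ 1)  ≡⟨ *-assoc 2 2 (2 ^ (x ∸ 1)) ⟩
      2 ^ (2 + (x ∸ 1))  ≡⟨ cong (λ i → 2 ^ suc i) (m+[n∸m]≡n (≤-trans (≤-trans (m≤m+n 1 19) 20≤J₀) J₀≤x)) ⟩
      2 ^ i₀  ∎
      where
      lem : ∀ a x → a + suc (suc (x + x)) ≡ 2 + a + (x + x)
      lem = solve-∀
      lem′ : ∀ x → x + (x + x) + x ≡ 4 * x
      lem′ = solve-∀
      pred-power : ∀ {x} → 1 ≤ x → x ≤ 2 ^ (x ∸ 1)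
      pred-power {suc x} _ = n<2^n x

    upper : ∀ i → i < k → 64 * 2 ^ (i₀ + i) ≤ L
    upper i i<k = begin
      64 * 2 ^ (i₀ + i)  ≡⟨ ^-distribˡ-+-* 2 6 (i₀ + i) ⟨
      2 ^ (6 + (i₀ + i))  ≤⟨ ^-monoʳ-≤ 2 (≤-trans (≤-reflexive (lem i₀ i)) (<∸⇒+< i J (i₀ + 5) i<k)) ⟩
      2 ^ J  ≤⟨ 2^⌊log₂⌋≤ L L≥1 ⟩
      L  ∎
      where
      lem : ∀ a i → 6 + (a + i) ≡ suc (a + 5 + i)
      lem = solve-∀

    big≤ : big ≤ 2 ^ 2 ^ i₀
    big≤ = begin
      big  ≤⟨ ≤-trans (≤-trans (m≤m+n big offset) (m≤n+m _ 20)) (≤-reflexive (sym J₀≡)) ⟩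
      J₀  ≤⟨ J₀≤x ⟩
      x  ≤⟨ n≤1+n x ⟩
      i₀  ≤⟨ n≤2^n i₀ ⟩
      2 ^ i₀  ≤⟨ n≤2^n (2 ^ i₀) ⟩
      2 ^ 2 ^ i₀  ∎

    large₁ : 32 * c * (suc κ + Cp + suc κ) ≤ 2 ^ 2 ^ i₀
    large₁ = ≤-trans (≤-trans (m≤m+n _ (16 * Cp)) (m≤m+n _ (4 * c))) big≤

    large₂ : 16 * Cp ≤ 2 ^ 2 ^ i₀
    large₂ = ≤-trans (≤-trans (m≤n+m (16 * Cp) (32 * c * (suc κ + Cp + suc κ))) (m≤m+n _ (4 * c))) big≤

    large₃ : 4 * c ≤ 2 ^ 2 ^ i₀
    large₃ = ≤-trans (m≤n+m (4 * c) (32 * c * (suc κ + Cp + suc κ) + 16 * Cp)) big≤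

    -- Up to the constant 6, the number of scales is at least x, about half of `J`; x ≥ 20 absorbs
    -- the constant.
    J≤8k : J ≤ 8 * k
    J≤8k = begin
      J  ≤⟨ ≤half J ⟩
      suc (x + x)  ≤⟨ +-cancelˡ-≤ 48 _ _ (begin
        48 + suc (x + x)  ≤⟨ m≤m+n _ 71 ⟩
        48 + suc (x + x) + 71  ≡⟨ lem x ⟩
        6 * 20 + 2 * x  ≤⟨ +-monoˡ-≤ (2 * x) (*-monoʳ-≤ 6 (≤-trans 20≤J₀ J₀≤x)) ⟩
        6 * x + 2 * x  ≡⟨ *-distribʳ-+ x 6 2 ⟨
        8 * x  ≤⟨ *-monoʳ-≤ 8 x≤ ⟩
        8 * (6 + k)  ≡⟨ *-distribˡ-+ 8 6 k ⟩
        48 + 8 * k  ∎) ⟩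
      8 * k  ∎
      where
      lem : ∀ x → 48 + suc (x + x) + 71 ≡ 6 * 20 + 2 * x
      lem = solve-∀
      lem′ : ∀ x k → suc x + 5 + k ≡ x + (6 + k)
      lem′ = solve-∀
      x≤ : x ≤ 6 + k
      x≤ = +-cancelˡ-≤ x _ _ (begin
        x + x  ≤⟨ half≤ J ⟩
        J  ≤⟨ m≤n+m∸n J (i₀ + 5) ⟩
        i₀ + 5 + k  ≡⟨ lem′ x k ⟩
        x + (6 + k)  ∎)

rescale : ∀ J k m r t → J ≤ 8 * k → k * m * r ≤ 384 * t → J * (2 * m) * r ≤ 6144 * t
rescale J k m r t J≤ le = begin
  J * (2 * m) * r  ≤⟨ *-monoˡ-≤ r (*-monoˡ-≤ (2 * m) J≤) ⟩
  8 * k * (2 * m) * r  ≡⟨ lem k m r ⟩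
  16 * (k * m * r)  ≤⟨ *-monoʳ-≤ 16 le ⟩
  16 * (384 * t)  ≡⟨ *-assoc 16 384 t ⟨
  6144 * t  ∎
  where
  open ≤-Reasoning
  lem : ∀ k m r → 8 * k * (2 * m) * r ≡ 16 * (k * m * r)
  lem = solve-∀

nearly-uniform-suc : ∀ {U N n C} {h : ProbeSeq U N} → NearlyUniformWith n C h → NearlyUniformWith n (suc C) h
nearly-uniform-suc {U} {C = C} uniform i s = ≤-trans (uniform i s) (*-monoˡ-≤ U (*-monoˡ-≤ (i ^ 10) (n≤1+n C)))

theorem4 : (κ Ch Cp : ℕ) →
    ∃[ d₀ ] ((d : ℕ) → ∃[ m₀ ] ∃[ k ] ∃[ n₀ ]
    ((n U N a b : ℕ) →
    n₀ ≤ n → n ^ d₀ ≤ U → U ≤ n ^ d →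
    1 ≤ a → b ≤ a * n → a * m₀ ≤ b →
    n ≤ N → a * n ≤ κ * (b * (N ∸ n)) → b * (N ∸ n) ≤ κ * (a * n) →
    (h : ProbeSeq U N) → NearlyUniformWith n Ch h →
    (A : Algorithm U N) → ValidOn A n →
    ProbeBoundedOn A h n (Cp * probeBudget a b) →
    loglogInv a b * (2 * (n * n)) * totalRuns A n ≤ k * totalCost A n))
-- The exponent 2 yields `2 * n ≤ U` once n ≥ 4. The constant is 6144 = 16 · 384: a factor 8 from
-- `J≤8k`, and 2 because a round consists of two operations.
theorem4 κ Ch Cp = 2 , λ d → P.m₀ , 6144 , 4 , bound d
  where
  module P = Parameters κ (suc Ch) Cp
  bound : (d n U N a b : ℕ) → 4 ≤ n → n ^ 2 ≤ U → U ≤ n ^ d → 1 ≤ a → b ≤ a * n → a * P.m₀ ≤ b →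
          n ≤ N → a * n ≤ κ * (b * (N ∸ n)) → b * (N ∸ n) ≤ κ * (a * n) →
          (h : ProbeSeq U N) → NearlyUniformWith n Ch h → (A : Algorithm U N) → ValidOn A n →
          ProbeBoundedOn A h n (Cp * probeBudget a b) →
          loglogInv a b * (2 * (n * n)) * totalRuns A n ≤ 6144 * totalCost A n
  bound _ n@(suc p) U N a@(suc _) b 4≤n n²≤U _ _ b≤an m₀≤ n≤N _ holes h uniform A valid-on bounded =
    rescale J k (n * n) (totalRuns A n) (totalCost A n) (P.J≤8k L L-large)
      (Accounting.cost-bound h L (P.ℓ₀ L L-large) (P.ℓ₀≥1 L L-large) A p valid-on 2n≤U
        -- `suc Ch` makes the constant positive. `suc κ` makes room for the slot freed by a
        -- deletion: N - p is one more than N - n, and 2^L ≤ n. The cap on weights is `L` itself, as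
        -- all scales satisfy 64D ≤ L.
        (suc Ch) (s≤s z≤n) (nearly-uniform-suc {n = n} {C = Ch} {h = h} uniform) (suc κ) Cp (isqrt L) L bounded 2^L≤n vacant≤ N≤
        (P.ℓ₀-large L L-large) (P.i₀ L L-large) k (P.ℓ₀≤ L L-large) (P.q≤ L L-large) (P.upper L L-large) ≤-refl
        (P.large₁ L L-large) (P.large₂ L L-large) (P.large₃ L L-large) 4≤n)
    where
    open ≤-Reasoning
    ratio L J k : ℕ
    ratio = b / a
    L = ⌊log₂ ratio ⌋
    J = ⌊log₂ L ⌋
    m₀≤ratio : P.m₀ ≤ ratio
    m₀≤ratio = ≤-trans (≤-reflexive (sym (m*n/n≡m P.m₀ a))) (/-monoˡ-≤ a (≤-trans (≤-reflexive (*-comm P.m₀ a)) m₀≤))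
    L-large : 2 ^ (P.J₀ + P.J₀) ≤ L
    L-large = ≤⌊log₂⌋ m₀≤ratio
    k = P.k L L-large
    2^L≤ratio : 2 ^ L ≤ ratio
    2^L≤ratio = 2^⌊log₂⌋≤ ratio (≤-trans (m^n>0 2 (2 ^ (P.J₀ + P.J₀))) m₀≤ratio)
    ratio*a≤b : ratio * a ≤ b
    ratio*a≤b = m/n*n≤m b a
    -- This is where ε ≥ 1/n enters.
    2^L≤n : 2 ^ L ≤ n
    2^L≤n = ≤-trans 2^L≤ratio (*-cancelˡ-≤ a (≤-trans (≤-reflexive (*-comm a ratio)) (≤-trans ratio*a≤b b≤an)))
    gap≤ : 2 ^ L * (N ∸ n) ≤ κ * n
    gap≤ = *-cancelˡ-≤ a (begin
      a * (2 ^ L * (N ∸ n))  ≤⟨ *-monoʳ-≤ a (*-monoˡ-≤ (N ∸ n) 2^L≤ratio) ⟩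
      a * (ratio * (N ∸ n))  ≡⟨ lem₁ a ratio (N ∸ n) ⟩
      ratio * a * (N ∸ n)  ≤⟨ *-monoˡ-≤ (N ∸ n) ratio*a≤b ⟩
      b * (N ∸ n)  ≤⟨ holes ⟩
      κ * (a * n)  ≡⟨ lem₂ κ a n ⟩
      a * (κ * n)  ∎)
      where
      lem₁ : ∀ a r m → a * (r * m) ≡ r * a * m
      lem₁ = solve-∀
      lem₂ : ∀ κ a n → κ * (a * n) ≡ a * (κ * n)
      lem₂ = solve-∀
    vacant≤ : 2 ^ L * (N ∸ p) ≤ suc κ * n
    vacant≤ = begin
      2 ^ L * (N ∸ p)  ≡⟨ cong (2 ^ L *_) (+-∸-assoc 1 n≤N) ⟩
      2 ^ L * suc (N ∸ n)  ≡⟨ *-suc (2 ^ L) (N ∸ n) ⟩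
      2 ^ L + 2 ^ L * (N ∸ n)  ≤⟨ +-mono-≤ 2^L≤n gap≤ ⟩
      suc κ * n  ∎
    N≤ : N ≤ suc κ * n
    N≤ = begin
      N  ≡⟨ m+[n∸m]≡n n≤N ⟨
      n + (N ∸ n)  ≤⟨ +-monoʳ-≤ n (≤-trans (m≤n*m (N ∸ n) (2 ^ L) {{m^n≢0 2 L}}) gap≤) ⟩
      suc κ * n  ∎
    2n≤U : 2 * n ≤ U
    2n≤U = begin
      2 * n  ≤⟨ *-monoˡ-≤ n (≤-trans (m≤m+n 2 2) 4≤n) ⟩
      n * n  ≡⟨ cong (n *_) (*-identityʳ n) ⟨
      n ^ 2  ≤⟨ n²≤U ⟩
      U  ∎
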